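{- Let $t\ge1$ be an integer and $g=2t$. Let $\omega\in\mathcal{SC}_{(g)}$ be a self-conjugate $g$-core, let $\mathbf{v}\in\mathbb{Z}^t$ be its $V_{g,t}$-coding, and set $r_i=v_i-g/2+1/2$ for $1\le i\le t$. Then $$|\omega| = \frac{1}{g}\sum_{i=1}^{t} r_i^2-\frac{g^2-1}{24}.$$ Moreover, setting $\alpha_i(\omega)=\#\{s\in\omega\mid h_s=g-i,\ \varepsilon_s=1\}$, for any field $F$ and any function $\tau:\mathbb{Z}\to F^{\times}$, $$\prod_{s\in\omega}\frac{\tau(h_s-\varepsilon_s g)}{\tau(h_s)}=\prod_{i=1}^{g-1}\left(\frac{\tau(-i)}{\tau(i)}\right)^{\alpha_i(\omega)}\prod_{1\le i<j\le t} \frac{\tau(r_i-r_j)}{\tau(j-i)}\, \frac{\tau(r_i+r_j)}{\tau(g+1-i-j)}.$$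
   Context: For a partition $\lambda$, $h_s$ is the hook length of a box $s$, and $\varepsilon_s=-1$ if $s$ is strictly below the main diagonal of the Ferrers diagram (English convention), $\varepsilon_s=1$ otherwise. A $g$-core is a partition with no hook length divisible by $g$. $\mathcal{SC}$ is the set of self-conjugate partitions and $\mathcal{SC}_{(g)}$ the set of $g$-cores in it (including the empty partition). Word of a partition: $\psi(\lambda)=(c_k)_{k\in\mathbb{Z}}\in\{0,1\}^{\mathbb{Z}}$ encodes the border of the Ferrers diagram read from South-West to North-East ($0$ vertical step, $1$ horizontal step), indexed so that $\#\{k\le -1: c_k=1\}=\#\{k\ge 0: c_k=0\}$; equivalently $c_k=0$ iff $k=\lambda_i-i$ for some $i\ge1$ (with $\lambda_i=0$ beyond the length). $V_{g,t}$-coding: for $i\in\{0,\dots,g-1\}$ let $\beta_i=\max\{(k+1)g+i\mid k\in\mathbb{Z},\ c_{kg+i}=0\}$; the $V_{g,t}$-coding is $\mathbf{v}=(v_1>\dots>v_t)$, the $t$ largest of the distinct integers $\beta_0,\dots,\beta_{g-1}$ in decreasing order. (Here the $r_i$ are half-integers, and $r_i\pm r_j$ are integers.) -}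

module Defs where

open import Level using (_⊔_)
open import Data.Nat.Base using (ℕ; zero; suc; NonZero; s≤s; _<ᵇ_)
import Data.Nat.Base as ℕ
import Data.Nat.Properties as ℕₚ
open import Data.Nat.Divisibility using (_∣_)
open import Data.Nat.ListAction using (sum)
open import Data.Integer.Base as ℤ using (ℤ; +_; -[1+_])
import Data.Integer.Properties as ℤₚ
open import Data.Integer.Tactic.RingSolver using (solve-∀)
open import Data.Rational.Base as ℚ using (ℚ; _/_; ½; fromℚᵘ)
import Data.Rational.Properties as ℚₚ
import Data.Rational.Solver
open import Data.Rational.Unnormalised.Base as ℚᵘ using (mkℚᵘ; *≡*)
import Data.Rational.Unnormalised.Properties as ℚᵘₚ
open import Data.Bool.Base using (if_then_else_)
open import Data.Fin.Base as Fin using (Fin; toℕ)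
open import Data.Fin.Patterns using (0F; 1F)
import Data.Fin.Properties as Finₚ
open import Data.List.Base
  using (List; []; _∷_; map; foldr; filter; length; upTo; concatMap; cartesianProduct; allFin)
open import Data.List.Relation.Unary.All using (All)
open import Data.List.Relation.Unary.Linked using (Linked)
open import Data.List.Membership.Propositional using (_∈_)
open import Data.Vec.Base using (Vec; lookup)
open import Data.Product.Base using (Σ; ∃; _×_; _,_; proj₁; proj₂)
open import Data.Sum.Base using (_⊎_)
open import Relation.Nullary using (¬_; Dec; yes; no; does)
open import Relation.Nullary.Decidable using (map′; _×-dec_)
open import Relation.Binary.PropositionalEquality
  using (_≡_; refl; sym; trans; cong; cong₂; module ≡-Reasoning)
open import Algebra.Apartness.Bundles using (HeytingField; HeytingCommutativeRing)
open import Algebra.Bundles using (CommutativeRing)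
import Algebra.Definitions
import Algebra.Properties.Group
import Algebra.Properties.Semiring.Exp

private
  module ℚSolver = Data.Rational.Solver.+-*-Solver

instance
  2*-nonZero : ∀ {t} .{{_ : NonZero t}} → NonZero (2 ℕ.* t)
  2*-nonZero {suc t} = _

-- Rows and columns of Ferrers diagrams are numbered from 0, so that the part
-- λᵢ (i ≥ 1) is  row λ (i - 1).

record Partition : Set where
  field
    parts      : List ℕ
    positive   : All (ℕ._> 0) parts
    decreasing : Linked ℕ._≥_ parts

open Partition public

at : List ℕ → ℕ → ℕ
at []       _       = 0
at (x ∷ xs) zero    = x
at (x ∷ xs) (suc i) = at xs i

row : Partition → ℕ → ℕ
row ω i = at (parts ω) i

col : Partition → ℕ → ℕ
col ω j = length (filter (j ℕₚ.<?_) (parts ω))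

size : Partition → ℕ
size ω = sum (parts ω)

SelfConjugate : Partition → Set
SelfConjugate ω = ∀ j → col ω j ≡ row ω j

Box : Set
Box = ℕ × ℕ

boxes : Partition → List Box
boxes ω = concatMap (λ i → map (i ,_) (upTo (row ω i))) (upTo (length (parts ω)))

-- Arm plus leg plus one; the subtractions do not truncate on boxes of ω.
hook : Partition → Box → ℕ
hook ω (i , j) = (row ω i ℕ.∸ suc j) ℕ.+ (col ω j ℕ.∸ suc i) ℕ.+ 1

ε : Box → ℤ
ε (i , j) = if j <ᵇ i then -[1+ 0 ] else + 1

IsCore : ℕ → Partition → Set
IsCore g ω = ∀ s → s ∈ boxes ω → ¬ (g ∣ hook ω s)

α : ℕ → Partition → ℕ → ℕ
α g ω i = length (filter (λ s → (hook ω s ℕₚ.≟ g ℕ.∸ i) ×-dec (ε s ℤₚ.≟ + 1)) (boxes ω))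

-- The vertical steps of the border sit exactly at the positions λᵢ - i for i ≥ 1,
-- where λᵢ = 0 beyond the length; this fixes the origin of the indexing.
IsVertical : Partition → ℤ → Set
IsVertical ω k = ∃ λ i → k ≡ + row ω i ℤ.- + suc i

private
  at-beyond : ∀ xs {i} → length xs ℕ.≤ i → at xs i ≡ 0
  at-beyond []       _       = refl
  at-beyond (x ∷ xs) (s≤s p) = at-beyond xs p

  vertical-bound : ∀ ω k i → k ≡ + row ω i ℤ.- + suc i →
                   i ℕ.< length (parts ω) ℕ.+ ℤ.∣ k ∣
  vertical-bound ω k i eq with i ℕₚ.<? length (parts ω)
  ... | yes i<ℓ = ℕₚ.<-≤-trans i<ℓ (ℕₚ.m≤m+n _ _)
  ... | no  i≮ℓ = ℕₚ.≤-trans (ℕₚ.≤-reflexive (sym ∣k∣≡1+i)) (ℕₚ.m≤n+m _ _)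
    where
    ∣k∣≡1+i : ℤ.∣ k ∣ ≡ suc i
    ∣k∣≡1+i = cong ℤ.∣_∣
      (trans eq (cong (λ n → + n ℤ.- + suc i) (at-beyond (parts ω) (ℕₚ.≮⇒≥ i≮ℓ))))

isVertical? : ∀ ω k → Dec (IsVertical ω k)
isVertical? ω k = map′
  (λ (i , _ , eq) → i , eq)
  (λ (i , eq) → i , vertical-bound ω k i eq , eq)
  (ℕₚ.anyUpTo? (λ i → k ℤₚ.≟ + row ω i ℤ.- + suc i) (length (parts ω) ℕ.+ ℤ.∣ k ∣))

word : Partition → ℤ → Fin 2
word ω k = if does (isVertical? ω k) then 0F else 1F

IsMax : (ℤ → Set) → ℤ → Set
IsMax P m = P m × (∀ n → P n → n ℤ.≤ m)

βSet : ℕ → Partition → ℕ → ℤ → Set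
βSet g ω i n = ∃ λ k →
  n ≡ (k ℤ.+ + 1) ℤ.* + g ℤ.+ + i × word ω (k ℤ.* + g ℤ.+ + i) ≡ 0F

-- v lists, in decreasing order, the t largest of the numbers β₀, …, β₍g₋₁₎.
record IsVCoding (g t : ℕ) (ω : Partition) (v : Vec ℤ t) : Set where
  field
    β          : Fin g → ℤ
    β-max      : ∀ i → IsMax (βSet g ω (toℕ i)) (β i)
    decreasing : ∀ i j → i Fin.< j → lookup v j ℤ.< lookup v i
    among-β    : ∀ j → ∃ λ i → lookup v j ≡ β i
    largest    : ∀ i → (∃ λ j → β i ≡ lookup v j) ⊎ (∀ j → β i ℤ.< lookup v j)

r : ∀ {t} → ℕ → Vec ℤ t → Fin t → ℚ
r g v i = lookup v i / 1 ℚ.- + g / 2 ℚ.+ ½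

IsInteger : ℚ → Set
IsInteger q = ∃ λ z → q ≡ z / 1

private
  +-fromℚᵘ : ∀ p q → fromℚᵘ p ℚ.+ fromℚᵘ q ≡ fromℚᵘ (p ℚᵘ.+ q)
  +-fromℚᵘ p q = ℚₚ.toℚᵘ-injective
    (ℚᵘₚ.≃-trans (ℚₚ.toℚᵘ-homo-+ (fromℚᵘ p) (fromℚᵘ q))
    (ℚᵘₚ.≃-trans (ℚᵘₚ.+-cong (ℚₚ.toℚᵘ-fromℚᵘ p) (ℚₚ.toℚᵘ-fromℚᵘ q))
    (ℚᵘₚ.≃-sym (ℚₚ.toℚᵘ-fromℚᵘ (p ℚᵘ.+ q)))))

  +-/1 : ∀ x y → x / 1 ℚ.+ y / 1 ≡ (x ℤ.+ y) / 1
  +-/1 x y = trans (+-fromℚᵘ (mkℚᵘ x 0) (mkℚᵘ y 0))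
    (cong (_/ 1) (cong₂ ℤ._+_ (ℤₚ.*-identityʳ x) (ℤₚ.*-identityʳ y)))

  neg-/1 : ∀ x → ℚ.- (x / 1) ≡ (ℤ.- x) / 1
  neg-/1 x = sym (ℚG.inverseˡ-unique ((ℤ.- x) / 1) (x / 1)
    (trans (+-/1 (ℤ.- x) x) (cong (_/ 1) (ℤₚ.+-inverseˡ x))))
    where module ℚG = Algebra.Properties.Group ℚₚ.+-0-group

  double-/2 : ∀ x → x / 2 ℚ.+ x / 2 ≡ x / 1
  double-/2 x = trans (+-fromℚᵘ (mkℚᵘ x 1) (mkℚᵘ x 1)) 
    (ℚₚ.fromℚᵘ-cong {mkℚᵘ x 1 ℚᵘ.+ mkℚᵘ x 1} {mkℚᵘ x 0} (*≡* (eq x)))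
    where
    eq : ∀ x → (x ℤ.* + 2 ℤ.+ x ℤ.* + 2) ℤ.* + 1 ≡ x ℤ.* + 4
    eq = solve-∀

r-difference-integer : ∀ {t} g (v : Vec ℤ t) i j → IsInteger (r g v i ℚ.- r g v j)
r-difference-integer g v i j = x ℤ.- y , (begin
  r g v i ℚ.- r g v j          ≡⟨ rearrange (x / 1) (y / 1) (+ g / 2) ½ ⟩
  x / 1 ℚ.- y / 1              ≡⟨ cong (x / 1 ℚ.+_) (neg-/1 y) ⟩
  x / 1 ℚ.+ (ℤ.- y) / 1        ≡⟨ +-/1 x (ℤ.- y) ⟩
  (x ℤ.- y) / 1                ∎)
  where
  open ≡-Reasoning
  open ℚSolver
  x = lookup v i
  y = lookup v j
  rearrange : ∀ a b h k → (a ℚ.- h ℚ.+ k) ℚ.- (b ℚ.- h ℚ.+ k) ≡ a ℚ.- b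
  rearrange = solve 4 (λ a b h k → (a :- h :+ k) :- (b :- h :+ k) := a :- b) refl

r-sum-integer : ∀ {t} g (v : Vec ℤ t) i j → IsInteger (r g v i ℚ.+ r g v j)
r-sum-integer g v i j = x ℤ.+ y ℤ.- + g ℤ.+ + 1 , (begin
  r g v i ℚ.+ r g v j
    ≡⟨ rearrange (x / 1) (y / 1) (+ g / 2) ½ ⟩
  x / 1 ℚ.+ y / 1 ℚ.- (+ g / 2 ℚ.+ + g / 2) ℚ.+ (½ ℚ.+ ½)
    ≡⟨ cong₂ (λ p q → p ℚ.- q ℚ.+ (½ ℚ.+ ½)) (+-/1 x y) (double-/2 (+ g)) ⟩
  (x ℤ.+ y) / 1 ℚ.- + g / 1 ℚ.+ + 1 / 1
    ≡⟨ cong (λ q → (x ℤ.+ y) / 1 ℚ.+ q ℚ.+ + 1 / 1) (neg-/1 (+ g)) ⟩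
  (x ℤ.+ y) / 1 ℚ.+ (ℤ.- + g) / 1 ℚ.+ + 1 / 1
    ≡⟨ cong (ℚ._+ + 1 / 1) (+-/1 (x ℤ.+ y) (ℤ.- + g)) ⟩
  (x ℤ.+ y ℤ.- + g) / 1 ℚ.+ + 1 / 1
    ≡⟨ +-/1 (x ℤ.+ y ℤ.- + g) (+ 1) ⟩
  (x ℤ.+ y ℤ.- + g ℤ.+ + 1) / 1 ∎)
  where
  open ≡-Reasoning
  open ℚSolver
  x = lookup v i
  y = lookup v j
  rearrange : ∀ a b h k →
    (a ℚ.- h ℚ.+ k) ℚ.+ (b ℚ.- h ℚ.+ k) ≡ a ℚ.+ b ℚ.- (h ℚ.+ h) ℚ.+ (k ℚ.+ k)
  rearrange = solve 4
    (λ a b h k → (a :- h :+ k) :+ (b :- h :+ k) := a :+ b :- (h :+ h) :+ (k :+ k)) refl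

-- The difference and the sum of rᵢ and rⱼ as elements of ℤ.
r-diff r-sum : ∀ {t} → ℕ → Vec ℤ t → Fin t → Fin t → ℤ
r-diff g v i j = proj₁ (r-difference-integer g v i j)
r-sum  g v i j = proj₁ (r-sum-integer g v i j)

-- The 1-based value of an index.
idx : ∀ {t} → Fin t → ℤ
idx i = + suc (toℕ i)

pairs : ∀ t → List (Fin t × Fin t)
pairs t = filter (λ (i , j) → i Finₚ.<? j) (cartesianProduct (allFin t) (allFin t))

∑ : ∀ {a} {A : Set a} → List A → (A → ℚ) → ℚ
∑ xs f = foldr ℚ._+_ (+ 0 / 1) (map f xs)

module FieldOps {c ℓ₁ ℓ₂} (F : HeytingField c ℓ₁ ℓ₂) where
  open HeytingField F using (Carrier; _#_; _-_; 0#; 1#; #⇒invertible; heytingCommutativeRing)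
  open HeytingField F public using (_≈_; _*_)

  private
    R : CommutativeRing c ℓ₁
    R = HeytingCommutativeRing.commutativeRing heytingCommutativeRing
    module R = CommutativeRing R

  open Algebra.Properties.Semiring.Exp R.semiring public using (_^_)

  -- In a Heyting field  x # 0#  is the positive form of x ≠ 0.
  F^× : Set (c ⊔ ℓ₂)
  F^× = Σ Carrier (_# 0#)

  invertible : (y : F^×) → Algebra.Definitions.Invertible _≈_ 1# _*_ (proj₁ y)
  invertible (y , y#0) =
    let y⁻¹ , left , right = #⇒invertible y#0 in
    y⁻¹ , R.trans (R.*-congˡ (R.sym y-0≈y)) left , R.trans (R.*-congʳ (R.sym y-0≈y)) right
    where
    y-0≈y : (y - 0#) ≈ y
    y-0≈y = R.trans (R.+-congˡ (Algebra.Properties.Group.ε⁻¹≈ε R.+-group)) (R.+-identityʳ y)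

  infixl 7 _÷_
  _÷_ : F^× → F^× → Carrier
  x ÷ y = proj₁ x * proj₁ (invertible y)

  ∏ : ∀ {a} {A : Set a} → List A → (A → Carrier) → Carrier
  ∏ xs f = foldr _*_ 1# (map f xs)

{-# OPTIONS --safe #-}

-- Write x₀ > x₁ > … for the positions of the vertical steps of the border of ω.
-- Since ω is self-conjugate, the box (i , j) has hook length xᵢ + xⱼ + 1, and (i , j)
-- is a box exactly when this number is positive; moreover of the positions k and
-- -1 - k exactly one is vertical.  Since ω is a g-core, moving every vertical step
-- up by g adds exactly the positions β₀, …, β₍g₋₁₎ to the vertical ones, and these are
-- the numbers vᵢ and g - 1 - vᵢ.  Hence, for every function f and all large K,
--     Σ_{i < K + g} f (xᵢ + g) = Σ_{i < K} f xᵢ + Σᵢ (f vᵢ + f (g - 1 - vᵢ)).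
--
-- For f y = (2 y - g + 1)² this identity, compared with the same identity for the
-- empty partition, is the formula for the size.
--
-- For the product it suffices that every integer n occurs equally often among the
-- arguments of τ on both sides.  Let O n and D n be the numbers of ordered pairs with
-- xᵢ + xⱼ + 1 = n and of i with 2 xᵢ + 1 = n.  Using the identity in both arguments,
--     O (n - g) - 2 O n + O (n + g) - D (n - g) + D (n + g)
-- is, for n > 0, twice the number of i < j with rᵢ - rⱼ = n or rᵢ + rⱼ = n.  The values
-- of O and D at n > 0 count boxes.  The values at n - g < 0 are reduced to positive
-- arguments by the antisymmetry k ↦ -1 - k, up to a correction independent of ω; the
-- empty partition identifies the correction as the factors τ (j - i) and
-- τ (g + 1 - i - j).

module Submission where

open import Defs
open import Data.Nat.Base as ℕ using (ℕ; zero; suc; NonZero; z≤n; s≤s)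
import Data.Nat.Properties as ℕₚ
open import Data.Nat.Divisibility using (_∣_; divides; >⇒∤; ∣-refl)
open import Data.Nat.ListAction using (sum)
open import Data.Integer.Base as ℤ using (ℤ; +_; -[1+_]; 0ℤ)
import Data.Integer.Properties as ℤₚ
open import Data.Integer.Tactic.RingSolver using (solve-∀)
open import Data.Rational.Base as ℚ using (ℚ; _/_; ½; 1ℚ; fromℚᵘ)
import Data.Rational.Properties as ℚₚ
import Data.Rational.Solver
open import Data.Rational.Unnormalised.Base as ℚᵘ using (mkℚᵘ; *≡*)
import Data.Rational.Unnormalised.Properties as ℚᵘₚ
open import Data.Bool.Base using (Bool; true; false; not; if_then_else_; _∧_; T)
open import Data.Fin.Base as Fin using (Fin; toℕ)
open import Data.Fin.Patterns using (0F; 1F)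
import Data.Fin.Properties as Finₚ
open import Data.List.Base
  using (List; []; _∷_; _++_; map; filter; length; upTo; concatMap; allFin; tabulate; replicate; cartesianProduct)
open import Data.List.Properties
  using (length-filter; length-++; length-map; length-upTo; length-tabulate; filter-accept; upTo-∷ʳ; map-upTo)
open import Data.List.Membership.Propositional using (_∈_; lose; find)
open import Data.List.Membership.DecPropositional ℤₚ._≟_ using (_∈?_)
open import Data.List.Membership.Propositional.Properties
  using (∈-map⁺; ∈-map⁻; ∈-++⁺ˡ; ∈-++⁺ʳ; ∈-++⁻; ∈-upTo⁺; ∈-upTo⁻; ∈-concatMap⁺; ∈-concatMap⁻; ∈-∃++; ∈-allFin)
open import Data.List.Relation.Binary.Permutation.Propositional as Perm
  using (_↭_; prep; swap; ↭-trans; ↭-sym; ↭-refl)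
import Data.List.Relation.Binary.Permutation.Propositional.Properties as Permₚ
open import Data.List.Relation.Unary.All as All using ([]; _∷_)
open import Data.List.Relation.Unary.AllPairs using (AllPairs; []; _∷_)
import Data.List.Relation.Unary.AllPairs.Properties as AllPairsₚ
open import Data.List.Relation.Unary.Any using (here; there)
open import Data.List.Relation.Unary.Linked as Linked using (Linked; []; [-]; _∷_)
open import Data.List.Relation.Unary.Unique.Propositional using (Unique)
import Data.List.Relation.Unary.Unique.Propositional.Properties as Uniqueₚ
open import Data.Vec.Base using (Vec; lookup)
open import Data.Product.Base using (∃; _×_; _,_; proj₁; proj₂)
open import Data.Sum.Base using (_⊎_; inj₁; inj₂)
open import Function.Base using (_∘_; id; case_of_)
open import Relation.Nullary using (¬_; Dec; yes; no; does; contradiction)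
open import Relation.Nullary.Decidable using (_×-dec_)
open import Relation.Unary using (Decidable; Pred)
open import Relation.Binary.Definitions using (tri<; tri≈; tri>)
open import Relation.Binary.PropositionalEquality
import Relation.Binary.Reasoning.Setoid
open import Algebra.Apartness.Bundles using (HeytingField; HeytingCommutativeRing)
open import Algebra.Bundles using (CommutativeRing)
import Algebra.Properties.AbelianGroup
import Algebra.Properties.CommutativeSemigroup

-- Sums over lists

S : ∀ {a} {A : Set a} → List A → (A → ℤ) → ℤ
S []       f = 0ℤ
S (x ∷ xs) f = f x ℤ.+ S xs f

private
  module ℤ+ = Algebra.Properties.AbelianGroup ℤₚ.+-0-abelianGroup
  open Algebra.Properties.CommutativeSemigroup ℤₚ.+-commutativeSemigroup
    using () renaming (interchange to +-interchange; x∙yz≈y∙xz to +-leftSwap)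

module _ {a} {A : Set a} where

  S-cong∈ : ∀ {f g : A → ℤ} xs → (∀ {x} → x ∈ xs → f x ≡ g x) → S xs f ≡ S xs g
  S-cong∈ []       f≗g = refl
  S-cong∈ (x ∷ xs) f≗g = cong₂ ℤ._+_ (f≗g (here refl)) (S-cong∈ xs (f≗g ∘ there))

  S-cong : ∀ {f g : A → ℤ} xs → (∀ x → f x ≡ g x) → S xs f ≡ S xs g
  S-cong xs f≗g = S-cong∈ xs (λ {x} _ → f≗g x)

  S-zero : ∀ {f : A → ℤ} xs → (∀ {x} → x ∈ xs → f x ≡ 0ℤ) → S xs f ≡ 0ℤ
  S-zero []       f≗0 = refl
  S-zero (x ∷ xs) f≗0 = cong₂ ℤ._+_ (f≗0 (here refl)) (S-zero xs (f≗0 ∘ there))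

  S-++ : ∀ xs ys (f : A → ℤ) → S (xs ++ ys) f ≡ S xs f ℤ.+ S ys f
  S-++ []       ys f = sym (ℤₚ.+-identityˡ _)
  S-++ (x ∷ xs) ys f =
    trans (cong (λ s → f x ℤ.+ s) (S-++ xs ys f)) (sym (ℤₚ.+-assoc (f x) (S xs f) (S ys f)))

  S-+ : ∀ xs (f g : A → ℤ) → S xs (λ x → f x ℤ.+ g x) ≡ S xs f ℤ.+ S xs g
  S-+ []       f g = refl
  S-+ (x ∷ xs) f g =
    trans (cong (λ s → f x ℤ.+ g x ℤ.+ s) (S-+ xs f g)) (+-interchange (f x) (g x) (S xs f) (S xs g))

  S-* : ∀ xs c (f : A → ℤ) → S xs (λ x → c ℤ.* f x) ≡ c ℤ.* S xs f
  S-* []       c f = sym (ℤₚ.*-zeroʳ c)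
  S-* (x ∷ xs) c f =
    trans (cong (λ s → c ℤ.* f x ℤ.+ s) (S-* xs c f)) (sym (ℤₚ.*-distribˡ-+ c (f x) (S xs f)))

  S-neg : ∀ xs (f : A → ℤ) → S xs (λ x → ℤ.- f x) ≡ ℤ.- S xs f
  S-neg []       f = refl
  S-neg (x ∷ xs) f =
    trans (cong (λ s → ℤ.- f x ℤ.+ s) (S-neg xs f)) (sym (ℤₚ.neg-distrib-+ (f x) (S xs f)))

  S-map : ∀ {b} {B : Set b} (h : B → A) xs (f : A → ℤ) → S (map h xs) f ≡ S xs (f ∘ h)
  S-map h []       f = refl
  S-map h (x ∷ xs) f = cong (λ s → f (h x) ℤ.+ s) (S-map h xs f)

  S-concatMap : ∀ {b} {B : Set b} (h : B → List A) xs (f : A → ℤ) →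
                S (concatMap h xs) f ≡ S xs (λ x → S (h x) f)
  S-concatMap h []       f = refl
  S-concatMap h (x ∷ xs) f =
    trans (S-++ (h x) (concatMap h xs) f) (cong (λ s → S (h x) f ℤ.+ s) (S-concatMap h xs f))

  S-↭ : ∀ {xs ys} (f : A → ℤ) → xs ↭ ys → S xs f ≡ S ys f
  S-↭ f Perm.refl = refl
  S-↭ f (prep x p) = cong (λ s → f x ℤ.+ s) (S-↭ f p)
  S-↭ f (swap {xs} {ys} x y p) = trans (cong (λ s → f x ℤ.+ (f y ℤ.+ s)) (S-↭ f p)) (+-leftSwap (f x) (f y) (S ys f))
  S-↭ f (Perm.trans p q) = trans (S-↭ f p) (S-↭ f q)

  S-replicate : ∀ n (x : A) f → S (replicate n x) f ≡ + n ℤ.* f x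
  S-replicate zero    x f = sym (ℤₚ.*-zeroˡ (f x))
  S-replicate (suc n) x f =
    trans (cong (λ s → f x ℤ.+ s) (S-replicate n x f)) (sym (ℤₚ.suc-* (+ n) (f x)))

  S-nonneg : ∀ xs {f : A → ℤ} → (∀ x → 0ℤ ℤ.≤ f x) → 0ℤ ℤ.≤ S xs f
  S-nonneg []       f≥0 = ℤₚ.≤-refl
  S-nonneg (x ∷ xs) f≥0 = ℤₚ.+-mono-≤ (f≥0 x) (S-nonneg xs f≥0)

S-swap : ∀ {a b} {A : Set a} {B : Set b} xs (ys : List B) (k : A → B → ℤ) →
         S xs (λ x → S ys (k x)) ≡ S ys (λ y → S xs (λ x → k x y))
S-swap []       ys k = sym (S-zero ys (λ _ → refl))
S-swap (x ∷ xs) ys k =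
  trans (cong (λ s → S ys (k x) ℤ.+ s) (S-swap xs ys k)) (sym (S-+ ys (k x) (λ y → S xs (λ x → k x y))))

infixr 9 ⟨_⟩_

⟨_⟩_ : Bool → ℤ → ℤ
⟨ b ⟩ z = if b then z else 0ℤ

⟨⟩-zero : ∀ b → ⟨ b ⟩ 0ℤ ≡ 0ℤ
⟨⟩-zero true  = refl
⟨⟩-zero false = refl

⟨⟩-not : ∀ b z → ⟨ not b ⟩ z ℤ.+ ⟨ b ⟩ z ≡ z
⟨⟩-not true  z = ℤₚ.+-identityˡ z
⟨⟩-not false z = ℤₚ.+-identityʳ z

S-filter : ∀ {a p} {A : Set a} {P : Pred A p} (P? : Decidable P) xs (f : A → ℤ) →
           S (filter P? xs) f ≡ S xs (λ x → ⟨ does (P? x) ⟩ f x)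
S-filter P? []       f = refl
S-filter P? (x ∷ xs) f with does (P? x)
... | true  = cong (λ s → f x ℤ.+ s) (S-filter P? xs f)
... | false = trans (S-filter P? xs f) (sym (ℤₚ.+-identityˡ _))

S-length : ∀ {a} {A : Set a} (xs : List A) → + length xs ≡ S xs (λ _ → + 1)
S-length []       = refl
S-length (x ∷ xs) = cong (λ s → + 1 ℤ.+ s) (S-length xs)

S-upTo-suc : ∀ n f → S (upTo (suc n)) f ≡ S (upTo n) f ℤ.+ f n
S-upTo-suc n f = begin
  S (upTo (suc n)) f                ≡⟨ cong (λ xs → S xs f) (upTo-∷ʳ n) ⟨
  S (upTo n ++ n ∷ []) f            ≡⟨ S-++ (upTo n) (n ∷ []) f ⟩
  S (upTo n) f ℤ.+ (f n ℤ.+ 0ℤ)     ≡⟨ cong (λ s → S (upTo n) f ℤ.+ s) (ℤₚ.+-identityʳ (f n)) ⟩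
  S (upTo n) f ℤ.+ f n              ∎
  where open ≡-Reasoning

S-upTo-head : ∀ n f → S (upTo (suc n)) f ≡ f 0 ℤ.+ S (upTo n) (f ∘ suc)
S-upTo-head n f = cong (λ s → f 0 ℤ.+ s)
  (trans (cong (λ xs → S xs f) (sym (map-upTo suc n))) (S-map suc (upTo n) f))

S-upTo-+ : ∀ m n f → S (upTo (m ℕ.+ n)) f ≡ S (upTo m) f ℤ.+ S (upTo n) (λ i → f (m ℕ.+ i))
S-upTo-+ zero    n f = sym (ℤₚ.+-identityˡ _)
S-upTo-+ (suc m) n f = begin
  S (upTo (suc (m ℕ.+ n))) f
    ≡⟨ S-upTo-head (m ℕ.+ n) f ⟩
  f 0 ℤ.+ S (upTo (m ℕ.+ n)) (f ∘ suc)
    ≡⟨ cong (λ s → f 0 ℤ.+ s) (S-upTo-+ m n (f ∘ suc)) ⟩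
  f 0 ℤ.+ (S (upTo m) (f ∘ suc) ℤ.+ rest)
    ≡⟨ ℤₚ.+-assoc (f 0) (S (upTo m) (f ∘ suc)) rest ⟨
  f 0 ℤ.+ S (upTo m) (f ∘ suc) ℤ.+ rest
    ≡⟨ cong (ℤ._+ rest) (S-upTo-head m f) ⟨
  S (upTo (suc m)) f ℤ.+ rest ∎
  where
  open ≡-Reasoning
  rest = S (upTo n) (λ i → f (suc m ℕ.+ i))

S-upTo-reverse : ∀ n (f : ℤ → ℤ) → S (upTo n) (λ i → f (+ n ℤ.- + 1 ℤ.- + i)) ≡ S (upTo n) (f ∘ +_)
S-upTo-reverse zero    f = refl
S-upTo-reverse (suc n) f = begin
  S (upTo (suc n)) (λ i → f (+ suc n ℤ.- + 1 ℤ.- + i))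
    ≡⟨ S-upTo-head n (λ i → f (+ suc n ℤ.- + 1 ℤ.- + i)) ⟩
  f (+ suc n ℤ.- + 1 ℤ.- + 0) ℤ.+ S (upTo n) (λ i → f (+ suc n ℤ.- + 1 ℤ.- + suc i))
    ≡⟨ cong₂ ℤ._+_ (cong f (first (+ n))) (S-cong (upTo n) (λ i → cong f (next (+ n) (+ i)))) ⟩
  f (+ n) ℤ.+ S (upTo n) (λ i → f (+ n ℤ.- + 1 ℤ.- + i))
    ≡⟨ cong (λ s → f (+ n) ℤ.+ s) (S-upTo-reverse n f) ⟩
  f (+ n) ℤ.+ S (upTo n) (f ∘ +_)
    ≡⟨ ℤₚ.+-comm (f (+ n)) _ ⟩
  S (upTo n) (f ∘ +_) ℤ.+ f (+ n)
    ≡⟨ S-upTo-suc n (f ∘ +_) ⟨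
  S (upTo (suc n)) (f ∘ +_) ∎
  where
  open ≡-Reasoning
  first : ∀ n → + 1 ℤ.+ n ℤ.- + 1 ℤ.- + 0 ≡ n
  first = solve-∀
  next : ∀ n i → + 1 ℤ.+ n ℤ.- + 1 ℤ.- (+ 1 ℤ.+ i) ≡ n ℤ.- + 1 ℤ.- i
  next = solve-∀

S-upTo-extend : ∀ {m n} f → m ℕ.≤ n → (∀ i → m ℕ.≤ i → f i ≡ 0ℤ) → S (upTo n) f ≡ S (upTo m) f
S-upTo-extend {m} {n} f m≤n f≗0 = begin
  S (upTo n) f
    ≡⟨ cong (λ k → S (upTo k) f) (ℕₚ.m+[n∸m]≡n m≤n) ⟨
  S (upTo (m ℕ.+ (n ℕ.∸ m))) f
    ≡⟨ S-upTo-+ m (n ℕ.∸ m) f ⟩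
  S (upTo m) f ℤ.+ S (upTo (n ℕ.∸ m)) (λ i → f (m ℕ.+ i))
    ≡⟨ cong (λ s → S (upTo m) f ℤ.+ s) (S-zero (upTo (n ℕ.∸ m)) (λ {i} _ → f≗0 (m ℕ.+ i) (ℕₚ.m≤m+n m i))) ⟩
  S (upTo m) f ℤ.+ 0ℤ
    ≡⟨ ℤₚ.+-identityʳ _ ⟩
  S (upTo m) f ∎
  where open ≡-Reasoning

<ᵇ-true : ∀ {m n} → m ℕ.< n → (m ℕ.<ᵇ n) ≡ true
<ᵇ-true {m} {n} m<n with m ℕ.<ᵇ n | ℕₚ.<⇒<ᵇ m<n
... | true | _ = refl

<ᵇ-false : ∀ {m n} → n ℕ.≤ m → (m ℕ.<ᵇ n) ≡ false
<ᵇ-false {m} {n} n≤m with m ℕ.<ᵇ n in eq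
... | false = refl
... | true  = contradiction (ℕₚ.<ᵇ⇒< m n (subst T (sym eq) _)) (ℕₚ.≤⇒≯ n≤m)

S-trichotomy : ∀ {a} {A : Set a} (key : A → ℕ) {xs} →
  AllPairs (λ x y → key x ℕ.< key y) xs → (k : A → A → ℤ) →
  S xs (λ x → S xs (k x)) ≡
    S xs (λ x → S xs (λ y → ⟨ key x ℕ.<ᵇ key y ⟩ k x y))
    ℤ.+ S xs (λ x → S xs (λ y → ⟨ key y ℕ.<ᵇ key x ⟩ k x y))
    ℤ.+ S xs (λ x → k x x)
S-trichotomy key [] k = refl
S-trichotomy {A = A} key (_∷_ {x} {xs} x<xs ps) k = begin
  k x x ℤ.+ S xs (k x) ℤ.+ S xs (λ y → k y x ℤ.+ S xs (k y))
    ≡⟨ cong (λ s → k x x ℤ.+ S xs (k x) ℤ.+ s) (S-+ xs (λ y → k y x) (λ y → S xs (k y))) ⟩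
  k x x ℤ.+ S xs (k x) ℤ.+ (S xs (λ y → k y x) ℤ.+ S xs (λ y → S xs (k y)))
    ≡⟨ cong (λ s → k x x ℤ.+ S xs (k x) ℤ.+ (S xs (λ y → k y x) ℤ.+ s)) (S-trichotomy key ps k) ⟩
  k x x ℤ.+ S xs (k x) ℤ.+ (S xs (λ y → k y x) ℤ.+ (U ℤ.+ L ℤ.+ D))
    -- The zeros stand for the guarded terms that vanish: the pair of the head with itself in both
    -- triangles, and in each triangle the pairs of the head with tail entries in the wrong order.
    -- The head has the smallest key, so no other guard fails.
    ≡⟨ rearrange (k x x) (S xs (k x)) (S xs (λ y → k y x)) U L D ⟩
  (+ 0 ℤ.+ S xs (k x) ℤ.+ (+ 0 ℤ.+ U)) ℤ.+ (+ 0 ℤ.+ + 0 ℤ.+ (S xs (λ y → k y x) ℤ.+ L)) ℤ.+ (k x x ℤ.+ D)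
    ≡⟨ cong₂ (λ u l → u ℤ.+ l ℤ.+ (k x x ℤ.+ D)) upper lower ⟨
  _ ∎
  where
  open ≡-Reasoning
  U = S xs (λ y → S xs (λ z → ⟨ key y ℕ.<ᵇ key z ⟩ k y z))
  L = S xs (λ y → S xs (λ z → ⟨ key z ℕ.<ᵇ key y ⟩ k y z))
  D = S xs (λ y → k y y)

  rearrange : ∀ a b c u l d → a ℤ.+ b ℤ.+ (c ℤ.+ (u ℤ.+ l ℤ.+ d)) ≡
    (+ 0 ℤ.+ b ℤ.+ (+ 0 ℤ.+ u)) ℤ.+ (+ 0 ℤ.+ + 0 ℤ.+ (c ℤ.+ l)) ℤ.+ (a ℤ.+ d)
  rearrange = solve-∀

  keep : ∀ {m n} z → m ℕ.< n → ⟨ m ℕ.<ᵇ n ⟩ z ≡ z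
  keep z m<n = cong (⟨_⟩ z) (<ᵇ-true m<n)

  drop′ : ∀ {m n} z → n ℕ.≤ m → ⟨ m ℕ.<ᵇ n ⟩ z ≡ + 0
  drop′ z n≤m = cong (⟨_⟩ z) (<ᵇ-false n≤m)

  below : ∀ {y} → y ∈ xs → key x ℕ.< key y
  below = All.lookup x<xs

  upper : _ ≡ _
  upper = cong₂ ℤ._+_
    (cong₂ ℤ._+_ (drop′ (k x x) (ℕₚ.≤-refl {key x})) (S-cong∈ xs (λ {y} y∈ → keep (k x y) (below y∈))))
    (trans (S-+ xs _ _) (cong (ℤ._+ U) (S-zero xs (λ {y} y∈ → drop′ (k y x) (ℕₚ.<⇒≤ (below y∈))))))

  lower : _ ≡ _
  lower = cong₂ ℤ._+_
    (cong₂ ℤ._+_ (drop′ (k x x) (ℕₚ.≤-refl {key x})) (S-zero xs (λ {y} y∈ → drop′ (k x y) (ℕₚ.<⇒≤ (below y∈)))))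
    (trans (S-+ xs _ _) (cong (ℤ._+ L) (S-cong∈ xs (λ {y} y∈ → keep (k y x) (below y∈)))))

-- Pigeonhole: the head of `xs` is removed from `ys`, and uniqueness keeps the tail inside what
-- remains. The length bound does the work of the reverse inclusion, so later rearrangements need
-- only one inclusion and a count.
⊆⇒↭ : ∀ {a} {A : Set a} {xs ys : List A} → Unique xs → (∀ {x} → x ∈ xs → x ∈ ys) →
      length ys ℕ.≤ length xs → xs ↭ ys
⊆⇒↭ {xs = []}     {[]} _ _ _ = ↭-refl
⊆⇒↭ {xs = x ∷ xs} {ys} u@(_ ∷ u′) xs⊆ys len with ∈-∃++ (xs⊆ys (here refl))
... | as , bs , refl = ↭-trans (prep x (⊆⇒↭ u′ sub len′)) (↭-sym move)
  where
  move : as ++ x ∷ bs ↭ x ∷ as ++ bs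
  move = Permₚ.shift x as bs
  sub : ∀ {z} → z ∈ xs → z ∈ as ++ bs
  sub z∈xs with Permₚ.∈-resp-↭ move (xs⊆ys (there z∈xs))
  ... | here refl = contradiction z∈xs (Uniqueₚ.Unique[x∷xs]⇒x∉xs u)
  ... | there z∈  = z∈
  len′ : length (as ++ bs) ℕ.≤ length xs
  len′ = ℕₚ.≤-pred (subst (ℕ._≤ suc (length xs)) (Permₚ.↭-length move) len)

-- Indicator of 0 with integer values, so that summing `δ (z - n)` over a list gives the
-- multiplicity of n in it.
δ : ℤ → ℤ
δ (+ zero)  = + 1
δ (+ suc _) = + 0
δ -[1+ _ ]  = + 0

δ-zero : ∀ {z} → z ≢ 0ℤ → δ z ≡ 0ℤ
δ-zero {+ zero}   z≢0 = contradiction refl z≢0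
δ-zero {+ suc _}  z≢0 = refl
δ-zero { -[1+ _ ]} z≢0 = refl

δ-neg : ∀ z → δ (ℤ.- z) ≡ δ z
δ-neg (+ zero)  = refl
δ-neg (+ suc _) = refl
δ-neg -[1+ _ ]  = refl

δ-nonneg : ∀ z → 0ℤ ℤ.≤ δ z
δ-nonneg (+ zero)  = ℤ.+≤+ ℕ.z≤n
δ-nonneg (+ suc _) = ℤₚ.≤-refl
δ-nonneg -[1+ _ ]  = ℤₚ.≤-refl

δ≢ : ∀ {a b} → a ≢ b → δ (a ℤ.- b) ≡ 0ℤ
δ≢ {a} {b} a≢b = δ-zero (a≢b ∘ ℤₚ.i-j≡0⇒i≡j a b)

-- Vertical steps of self-conjugate partitions

at-beyond : ∀ xs {i} → length xs ℕ.≤ i → at xs i ≡ 0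
at-beyond []       _       = refl
at-beyond (x ∷ xs) (s≤s p) = at-beyond xs p

at-head : ∀ {x xs} → Linked ℕ._≥_ (x ∷ xs) → ∀ j → at xs j ℕ.≤ x
at-head [-]        j       = z≤n
at-head (x≥y ∷ ys) zero    = x≥y
at-head (x≥y ∷ ys) (suc j) = ℕₚ.≤-trans (at-head ys j) x≥y

at-antitone : ∀ {xs} → Linked ℕ._≥_ xs → ∀ {i j} → i ℕ.≤ j → at xs j ℕ.≤ at xs i
at-antitone {[]}     _  _                       = z≤n
at-antitone {x ∷ xs} xs↘ {zero}  {zero}  _       = ℕₚ.≤-refl
at-antitone {x ∷ xs} xs↘ {zero}  {suc j} _       = at-head xs↘ j
at-antitone {x ∷ xs} xs↘ {suc i} {suc j} (s≤s p) = at-antitone (Linked.tail xs↘) p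

-- In a decreasing list every part before position `i` also exceeds `j`, so the filter keeps at
-- least `i + 1` parts.
at⇒column : ∀ {xs} → Linked ℕ._≥_ xs → ∀ {i j} → j ℕ.< at xs i → i ℕ.< length (filter (j ℕₚ.<?_) xs)
at⇒column {x ∷ xs} xs↘ {i} {j} j<at with j ℕₚ.<? x
... | no  j≮x = contradiction (ℕₚ.<-≤-trans j<at (at-antitone xs↘ {0} {i} z≤n)) j≮x
... | yes j<x rewrite filter-accept (j ℕₚ.<?_) {xs = xs} j<x with i
...   | zero  = s≤s z≤n
...   | suc i = s≤s (at⇒column (Linked.tail xs↘) j<at)

-- The positions of the vertical steps, numbered from North-East to South-West.
vert : Partition → ℕ → ℤ
vert ω i = + row ω i ℤ.- + suc i

ℓ : Partition → ℕ
ℓ ω = length (parts ω)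

-- The integers z with -N ≤ z < N, an interval stable under z ↦ -1 - z.
window : ℕ → List ℤ
window N = map +_ (upTo N) ++ map -[1+_] (upTo N)

-- The two hypotheses are the bounds -N ≤ m - n < N, written in ℕ without truncated subtraction.
∈-window : ∀ {N} m n → m ℕ.< N ℕ.+ n → n ℕ.≤ N ℕ.+ m → + m ℤ.- + n ∈ window N
∈-window {N} m n m<N+n n≤N+m with n ℕₚ.≤? m
... | yes n≤m = ∈-++⁺ˡ (subst (_∈ map +_ (upTo N)) (sym eq) (∈-map⁺ +_ (∈-upTo⁺ bound)))
  where
  eq : + m ℤ.- + n ≡ + (m ℕ.∸ n)
  eq = trans (ℤₚ.m-n≡m⊖n m n) (ℤₚ.⊖-≥ n≤m)
  bound : m ℕ.∸ n ℕ.< N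
  bound = subst (m ℕ.∸ n ℕ.<_) (ℕₚ.m+n∸n≡m N n) (ℕₚ.∸-monoˡ-< m<N+n n≤m)
... | no n≰m = ∈-++⁺ʳ (map +_ (upTo N)) (subst (_∈ map -[1+_] (upTo N)) (sym eq) (∈-map⁺ -[1+_] (∈-upTo⁺ bound)))
  where
  k : ℕ
  k = n ℕ.∸ suc m
  n∸m : n ℕ.∸ m ≡ suc k
  n∸m = ℕₚ.+-∸-assoc 1 (ℕₚ.≰⇒> n≰m)
  eq : + m ℤ.- + n ≡ -[1+ k ]
  eq = trans (ℤₚ.m-n≡m⊖n m n) (trans (ℤₚ.⊖-< (ℕₚ.≰⇒> n≰m)) (cong (λ d → ℤ.- + d) n∸m))
  bound : k ℕ.< N
  bound = subst (ℕ._≤ N) n∸m (subst (n ℕ.∸ m ℕ.≤_) (ℕₚ.m+n∸n≡m N m) (ℕₚ.∸-monoˡ-≤ m n≤N+m))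

∈-window-∣∣ : ∀ {N} z → ℤ.∣ z ∣ ℕ.< N → z ∈ window N
∈-window-∣∣ {N} (+ k)    k<N = ∈-++⁺ˡ (∈-map⁺ +_ (∈-upTo⁺ k<N))
∈-window-∣∣ {N} -[1+ k ] k<N = ∈-++⁺ʳ (map +_ (upTo N)) (∈-map⁺ -[1+_] (∈-upTo⁺ (ℕₚ.<⇒≤ k<N)))

module SelfConjugatePartition (ω : Partition) (sc : SelfConjugate ω) where

  x : ℕ → ℤ
  x = vert ω

  row-beyond : ∀ {i} → ℓ ω ℕ.≤ i → row ω i ≡ 0
  row-beyond = at-beyond (parts ω)

  row-transpose : ∀ {i j} → j ℕ.< row ω i → i ℕ.< row ω j
  row-transpose {i} {j} j<row = subst (i ℕ.<_) (sc j) (at⇒column (Partition.decreasing ω) j<row)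

  -- The longest row is row 0, which has the length of column 0, and a column has at most one box in
  -- each part.
  row-bound : ∀ i → row ω i ℕ.≤ ℓ ω
  row-bound i = ℕₚ.≤-trans (at-antitone (Partition.decreasing ω) z≤n)
    (subst (ℕ._≤ ℓ ω) (sc 0) (length-filter (0 ℕₚ.<?_) (parts ω)))

  x-beyond : ∀ {i} → ℓ ω ℕ.≤ i → x i ≡ -[1+ i ]
  x-beyond ℓ≤i = cong (λ n → + n ℤ.- + suc _) (row-beyond ℓ≤i)

  x-strict : ∀ {i j} → i ℕ.< j → x j ℤ.< x i
  x-strict i<j = ℤₚ.+-mono-≤-< (ℤ.+≤+ (at-antitone (Partition.decreasing ω) (ℕₚ.<⇒≤ i<j)))
    (ℤₚ.neg-mono-< (ℤ.+<+ (s≤s i<j)))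

  x-injective : ∀ {i j} → x i ≡ x j → i ≡ j
  x-injective {i} {j} eq with ℕₚ.<-cmp i j
  ... | tri< i<j _ _ = contradiction (sym eq) (ℤₚ.<⇒≢ (x-strict i<j))
  ... | tri≈ _ i≡j _ = i≡j
  ... | tri> _ _ j<i = contradiction eq (ℤₚ.<⇒≢ (x-strict j<i))

  -- Self-conjugacy replaces column `j` by row `j`. Arm and leg then carry `suc j` and `suc i`, and
  -- exchanging these two terms produces `x i` and `x j`. On a box the truncated subtractions are
  -- exact.
  +-hook : ∀ {i j} → j ℕ.< row ω i → + hook ω (i , j) ≡ x i ℤ.+ x j ℤ.+ + 1
  +-hook {i} {j} j<row = begin
    + ((row ω i ℕ.∸ suc j) ℕ.+ (col ω j ℕ.∸ suc i) ℕ.+ 1)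
      ≡⟨ cong (λ c → + ((row ω i ℕ.∸ suc j) ℕ.+ (c ℕ.∸ suc i) ℕ.+ 1)) (sc j) ⟩
    + ((row ω i ℕ.∸ suc j) ℕ.+ (row ω j ℕ.∸ suc i) ℕ.+ 1)
      ≡⟨ cong₂ (λ a b → a ℤ.+ b ℤ.+ + 1) (sub j<row) (sub (row-transpose j<row)) ⟩
    (+ row ω i ℤ.- + suc j) ℤ.+ (+ row ω j ℤ.- + suc i) ℤ.+ + 1
      ≡⟨ regroup (+ row ω i) (+ row ω j) (+ suc i) (+ suc j) ⟩
    x i ℤ.+ x j ℤ.+ + 1 ∎
    where
    open ≡-Reasoning
    sub : ∀ {m n} → n ℕ.≤ m → + (m ℕ.∸ n) ≡ + m ℤ.- + n
    sub {m} {n} n≤m = sym (trans (ℤₚ.m-n≡m⊖n m n) (ℤₚ.⊖-≥ n≤m))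
    regroup : ∀ a b c d → (a ℤ.- d) ℤ.+ (b ℤ.- c) ℤ.+ + 1 ≡ (a ℤ.- c) ℤ.+ (b ℤ.- d) ℤ.+ + 1
    regroup = solve-∀

  hook-positive : ∀ i j → 0ℤ ℤ.< + hook ω (i , j)
  hook-positive i j = ℤ.+<+ (ℕₚ.m≤n+m 1 (row ω i ℕ.∸ suc j ℕ.+ (col ω j ℕ.∸ suc i)))

  -- Outside the diagram row i ≤ j and, by transposition, row j ≤ i; the quantity equals (row i - j)
  -- + (row j - i) - 1.
  x+x-negative : ∀ {i j} → row ω i ℕ.≤ j → x i ℤ.+ x j ℤ.+ + 1 ℤ.< 0ℤ
  x+x-negative {i} {j} row≤j = subst (ℤ._< 0ℤ) (regroup (+ row ω i) (+ row ω j) (+ i) (+ j))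
    (ℤₚ.+-mono-≤-< (ℤₚ.+-mono-≤ (nonpos row≤j) (nonpos row′≤i)) ℤ.-<+)
    where
    row′≤i : row ω j ℕ.≤ i
    row′≤i = ℕₚ.≮⇒≥ (λ i<row → ℕₚ.≤⇒≯ row≤j (row-transpose i<row))
    nonpos : ∀ {m n} → m ℕ.≤ n → + m ℤ.- + n ℤ.≤ 0ℤ
    nonpos m≤n = ℤₚ.i≤j⇒i-j≤0 (ℤ.+≤+ m≤n)
    regroup : ∀ a b c d → (a ℤ.- d) ℤ.+ (b ℤ.- c) ℤ.+ (ℤ.- + 1) ≡
      (a ℤ.- (+ 1 ℤ.+ c)) ℤ.+ (b ℤ.- (+ 1 ℤ.+ d)) ℤ.+ + 1
    regroup = solve-∀

  x+x≢0 : ∀ i j → x i ℤ.+ x j ℤ.+ + 1 ≢ 0ℤ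
  x+x≢0 i j with j ℕₚ.<? row ω i
  ... | yes j<row = λ eq → ℤₚ.<⇒≢ (hook-positive i j) (sym (trans (+-hook j<row) eq))
  ... | no  j≮row = ℤₚ.<⇒≢ (x+x-negative (ℕₚ.≮⇒≥ j≮row))

  ∈-boxes : ∀ {i j} → j ℕ.< row ω i → (i , j) ∈ boxes ω
  ∈-boxes {i} {j} j<row = ∈-concatMap⁺ (λ i → map (i ,_) (upTo (row ω i)))
    (lose (∈-upTo⁺ i<ℓ) (∈-map⁺ (i ,_) (∈-upTo⁺ j<row)))
    where
    i<ℓ : i ℕ.< ℓ ω
    i<ℓ = ℕₚ.≰⇒> (λ ℓ≤i → ℕₚ.n≮0 (subst (j ℕ.<_) (row-beyond ℓ≤i) j<row))

  x+x-positive⇒box : ∀ i j → 0ℤ ℤ.< x i ℤ.+ x j ℤ.+ + 1 → j ℕ.< row ω i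
  x+x-positive⇒box i j pos with j ℕₚ.<? row ω i
  ... | yes j<row = j<row
  ... | no  j≮row = contradiction (x+x-negative (ℕₚ.≮⇒≥ j≮row)) (ℤₚ.<-asym pos)

  -- The action of conjugation on border positions: the border is read backwards and the two kinds
  -- of steps are exchanged.
  conj : ℤ → ℤ
  conj z = ℤ.- + 1 ℤ.- z

  conj-involutive : ∀ z → conj (conj z) ≡ z
  conj-involutive = lemma
    where
    lemma : ∀ z → ℤ.- + 1 ℤ.- (ℤ.- + 1 ℤ.- z) ≡ z
    lemma = solve-∀

  x≢conj : ∀ i j → x i ≢ conj (x j)
  x≢conj i j eq = x+x≢0 i j (trans (cong (λ z → z ℤ.+ x j ℤ.+ + 1) eq) (cancel (x j)))
    where
    cancel : ∀ b → ℤ.- + 1 ℤ.- b ℤ.+ b ℤ.+ + 1 ≡ + 0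
    cancel = solve-∀

  -- Of the positions k and -1 - k exactly one is vertical.
  x-conj-↭ : ∀ {N} → ℓ ω ℕ.≤ N → map x (upTo N) ++ map (conj ∘ x) (upTo N) ↭ window N
  x-conj-↭ {N} ℓ≤N = ⊆⇒↭ unique sub len
    where
    unique : Unique (map x (upTo N) ++ map (conj ∘ x) (upTo N))
    unique = Uniqueₚ.++⁺ (Uniqueₚ.map⁺ x-injective (Uniqueₚ.upTo⁺ N))
      (Uniqueₚ.map⁺ (λ {i} {j} eq → x-injective
        (trans (sym (conj-involutive (x i))) (trans (cong conj eq) (conj-involutive (x j)))))
        (Uniqueₚ.upTo⁺ N))
      λ (z∈₁ , z∈₂) → case (∈-map⁻ x z∈₁ , ∈-map⁻ (conj ∘ x) z∈₂) of λ where
        ((i , _ , eq₁) , (j , _ , eq₂)) → x≢conj i j (trans (sym eq₁) eq₂)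

    row<N+ : ∀ i → row ω i ℕ.< N ℕ.+ suc i
    row<N+ i = ℕₚ.≤-<-trans (ℕₚ.≤-trans (row-bound i) ℓ≤N) (ℕₚ.m<m+n N (s≤s z≤n))

    sub : ∀ {z} → z ∈ map x (upTo N) ++ map (conj ∘ x) (upTo N) → z ∈ window N
    sub z∈ with ∈-++⁻ (map x (upTo N)) z∈
    ... | inj₁ z∈₁ with i , i∈ , refl ← ∈-map⁻ x z∈₁ =
      ∈-window (row ω i) (suc i) (row<N+ i) (ℕₚ.≤-trans (∈-upTo⁻ i∈) (ℕₚ.m≤m+n N _))
    ... | inj₂ z∈₂ with i , i∈ , refl ← ∈-map⁻ (conj ∘ x) z∈₂ =
      subst (_∈ window N) (flip (+ row ω i) (+ i))
        (∈-window i (row ω i) (ℕₚ.<-≤-trans (∈-upTo⁻ i∈) (ℕₚ.m≤m+n N _))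
          (ℕₚ.≤-trans (ℕₚ.≤-trans (row-bound i) ℓ≤N) (ℕₚ.m≤m+n N i)))
      where
      flip : ∀ r i → i ℤ.- r ≡ ℤ.- + 1 ℤ.- (r ℤ.- (+ 1 ℤ.+ i))
      flip = solve-∀

    -- Both lists have 2 N entries, so uniqueness and one inclusion suffice.
    len : length (window N) ℕ.≤ length (map x (upTo N) ++ map (conj ∘ x) (upTo N))
    len = ℕₚ.≤-reflexive (trans (len-++ +_ -[1+_]) (sym (len-++ x (conj ∘ x))))
      where
      len-++ : ∀ (f g : ℕ → ℤ) → length (map f (upTo N) ++ map g (upTo N)) ≡ length (upTo N) ℕ.+ length (upTo N)
      len-++ f g = trans (length-++ (map f (upTo N))) (cong₂ ℕ._+_ (length-map f (upTo N)) (length-map g (upTo N)))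

  -- With N larger than |k| and at least the number of parts, the window contains k, and `x-conj-↭`
  -- places k among the `x i` or among the `conj (x i)`.
  vertical-or-conj : ∀ k → ¬ IsVertical ω k → IsVertical ω (conj k)
  vertical-or-conj k ¬k
    with ∈-++⁻ (map x (upTo N)) (Permₚ.∈-resp-↭ (↭-sym (x-conj-↭ (ℕₚ.m≤m+n (ℓ ω) _)))
           (∈-window-∣∣ {N} k (ℕₚ.m≤n+m _ (ℓ ω))))
    where
    N : ℕ
    N = ℓ ω ℕ.+ suc ℤ.∣ k ∣
  ... | inj₁ k∈ with i , _ , eq ← ∈-map⁻ x k∈ = contradiction (i , eq) ¬k
  ... | inj₂ k∈ with i , _ , eq ← ∈-map⁻ (conj ∘ x) k∈ =
    i , trans (cong conj eq) (conj-involutive (x i))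

  vertical-conj : ∀ {k} → IsVertical ω k → ¬ IsVertical ω (conj k)
  vertical-conj (i , eq) (j , eq′) = x≢conj j i (trans (sym eq′) (cong conj eq))

-- Cores and their coding

word⇒vertical : ∀ ω k → word ω k ≡ 0F → IsVertical ω k
word⇒vertical ω k = from (isVertical? ω k)
  where
  from : ∀ {p} {P : Set p} (d : Dec P) → _≡_ {A = Fin 2} (if does d then 0F else 1F) 0F → P
  from (yes p) _ = p

vertical⇒word : ∀ ω k → IsVertical ω k → word ω k ≡ 0F
vertical⇒word ω k = to (isVertical? ω k)
  where
  to : ∀ {p} {P : Set p} (d : Dec P) → P → _≡_ {A = Fin 2} (if does d then 0F else 1F) 0F
  to (yes _) _ = refl
  to (no ¬p) p = contradiction p ¬p

<⇒1≤- : ∀ {a b} → a ℤ.< b → + 1 ℤ.≤ b ℤ.- a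
<⇒1≤- {a} {b} a<b = subst (ℤ._≤ b ℤ.- a) (cancel a) (ℤₚ.+-monoˡ-≤ (ℤ.- a) (ℤₚ.i<j⇒suc[i]≤j a<b))
  where
  cancel : ∀ a → + 1 ℤ.+ a ℤ.- a ≡ + 1
  cancel = solve-∀

1≤-⇒< : ∀ {a b} → + 1 ℤ.≤ b ℤ.- a → a ℤ.< b
1≤-⇒< {a} {b} 1≤b-a = ℤₚ.suc[i]≤j⇒i<j (subst (+ 1 ℤ.+ a ℤ.≤_) (cancel a b) (ℤₚ.+-monoˡ-≤ a 1≤b-a))
  where
  cancel : ∀ a b → b ℤ.- a ℤ.+ a ≡ b
  cancel = solve-∀

-- If `ys` is not longer than `xs`, `⊆⇒↭` already makes the two lists permutations of each other.
⊆⇒length≤ : ∀ {a} {A : Set a} {xs ys : List A} → Unique xs → (∀ {x} → x ∈ xs → x ∈ ys) →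
            length xs ℕ.≤ length ys
⊆⇒length≤ {xs = xs} {ys} u xs⊆ys with ℕₚ.≤-total (length xs) (length ys)
... | inj₁ ≤ = ≤
... | inj₂ ≥ = ℕₚ.≤-reflexive (Permₚ.↭-length (⊆⇒↭ u xs⊆ys ≥))

length-allFin : ∀ n → length (allFin n) ≡ n
length-allFin n = length-tabulate (id {A = Fin n})

module Coding (t : ℕ) .{{_ : NonZero t}} (ω : Partition) (sc : SelfConjugate ω)
              (core : IsCore (2 ℕ.* t) ω) (w : Vec ℤ t) (vc : IsVCoding (2 ℕ.* t) t ω w) where

  open SelfConjugatePartition ω sc
  open IsVCoding vc using (β; β-max; among-β; largest)

  g : ℕ
  g = 2 ℕ.* t

  v : Fin t → ℤ
  v = lookup w

  0<g : 0ℤ ℤ.< + g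
  0<g = ℤ.+<+ (ℕ.>-nonZero⁻¹ g)

  -- If k = `x i` were vertical and k - g were not, then -1 - (k - g) = `x j` would be vertical, and
  -- the box (i , j) would have hook length k - 1 - (k - g) + 1 = g, which a g-core excludes.
  vertical-down : ∀ {k} → IsVertical ω k → IsVertical ω (k ℤ.- + g)
  vertical-down {k} (i , k≡x) = down (isVertical? ω (k ℤ.- + g))
    where
    cancel : ∀ k g → k ℤ.+ (ℤ.- + 1 ℤ.- (k ℤ.- g)) ℤ.+ + 1 ≡ g
    cancel = solve-∀

    no-gap : IsVertical ω (conj (k ℤ.- + g)) → IsVertical ω (k ℤ.- + g)
    no-gap (j , eq) =
      contradiction (subst (g ∣_) (sym (ℤₚ.+-injective (trans (+-hook j<row) hook≡g))) ∣-refl)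
        (core (i , j) (∈-boxes j<row))
      where
      hook≡g : x i ℤ.+ x j ℤ.+ + 1 ≡ + g
      hook≡g = trans (cong₂ (λ a b → a ℤ.+ b ℤ.+ + 1) (sym k≡x) (sym eq)) (cancel k (+ g))
      j<row : j ℕ.< row ω i
      j<row = x+x-positive⇒box i j (subst (0ℤ ℤ.<_) (sym hook≡g) 0<g)

    down : Dec (IsVertical ω (k ℤ.- + g)) → IsVertical ω (k ℤ.- + g)
    down (yes p) = p
    down (no ¬p) = no-gap (vertical-or-conj (k ℤ.- + g) ¬p)

  -- `β b` lies one step of length g beyond the largest vertical position in its residue class, so
  -- subtracting g gives that position.
  β-vertical : ∀ b → IsVertical ω (β b ℤ.- + g)
  β-vertical b with (k , eq , wd) , _ ← β-max b =
    subst (IsVertical ω) (trans (cancel k (+ g) (+ toℕ b)) (cong (ℤ._- + g) (sym eq))) (word⇒vertical ω _ wd)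
    where
    cancel : ∀ k g i → k ℤ.* g ℤ.+ i ≡ (k ℤ.+ + 1) ℤ.* g ℤ.+ i ℤ.- g
    cancel = solve-∀

  -- Otherwise `β b + g` would belong to the set of which `β b` is the maximum.
  β-not-vertical : ∀ b → ¬ IsVertical ω (β b)
  β-not-vertical b p with (k , eq , _) , max ← β-max b =
    ℤₚ.<⇒≱ β<β+g (max (β b ℤ.+ + g)
      (k ℤ.+ + 1 , trans (cong (ℤ._+ + g) eq) (next k (+ g) (+ toℕ b))
                 , vertical⇒word ω _ (subst (IsVertical ω) eq p)))
    where
    next : ∀ k g i → (k ℤ.+ + 1) ℤ.* g ℤ.+ i ℤ.+ g ≡ (k ℤ.+ + 1 ℤ.+ + 1) ℤ.* g ℤ.+ i
    next = solve-∀
    β<β+g : β b ℤ.< β b ℤ.+ + g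
    β<β+g = subst (ℤ._< β b ℤ.+ + g) (ℤₚ.+-identityʳ (β b)) (ℤₚ.+-monoʳ-< (β b) 0<g)

  -- `β a` is congruent to `toℕ a` modulo g, and two residues in the range 0 to g - 1 whose
  -- difference is a multiple of g coincide.
  β-injective : ∀ {a b} → β a ≡ β b → a ≡ b
  β-injective {a} {b} eq
    with (k , eqa , _) , _ ← β-max a | (m , eqb , _) , _ ← β-max b =
    Finₚ.toℕ-injective (ℤₚ.+-injective (ℤₚ.i-j≡0⇒i≡j (+ toℕ a) (+ toℕ b) (ℤₚ.∣i∣≡0⇒i≡0 (small d refl))))
    where
    regroup : ∀ k m g a b → (k ℤ.+ + 1) ℤ.* g ℤ.+ a ≡ (m ℤ.+ + 1) ℤ.* g ℤ.+ b → a ℤ.- b ≡ (m ℤ.- k) ℤ.* g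
    regroup k m g a b eq = trans (lemma₁ k g a b)
      (trans (cong (λ z → z ℤ.- ((k ℤ.+ + 1) ℤ.* g ℤ.+ b)) eq) (lemma₂ k m g b))
      where
      lemma₁ : ∀ k g a b → a ℤ.- b ≡ (k ℤ.+ + 1) ℤ.* g ℤ.+ a ℤ.- ((k ℤ.+ + 1) ℤ.* g ℤ.+ b)
      lemma₁ = solve-∀
      lemma₂ : ∀ k m g b → (m ℤ.+ + 1) ℤ.* g ℤ.+ b ℤ.- ((k ℤ.+ + 1) ℤ.* g ℤ.+ b) ≡ (m ℤ.- k) ℤ.* g
      lemma₂ = solve-∀
    d : ℕ
    d = ℤ.∣ + toℕ a ℤ.- + toℕ b ∣
    g∣d : g ∣ d
    g∣d = divides ℤ.∣ m ℤ.- k ∣ (trans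
      (cong ℤ.∣_∣ (regroup k m (+ g) (+ toℕ a) (+ toℕ b) (trans (sym eqa) (trans eq eqb))))
      (ℤₚ.abs-* (m ℤ.- k) (+ g)))
    d<g : d ℕ.< g
    d<g = ℕₚ.≤-<-trans (subst (λ z → ℤ.∣ z ∣ ℕ.≤ toℕ a ℕ.⊔ toℕ b) (sym (ℤₚ.m-n≡m⊖n (toℕ a) (toℕ b)))
      (ℤₚ.∣m⊝n∣≤m⊔n (toℕ a) (toℕ b))) (ℕₚ.⊔-lub (Finₚ.toℕ<n a) (Finₚ.toℕ<n b))
    -- The copy `e` of `d` is what is matched on: a positive multiple of g cannot be smaller than g.
    small : ∀ e → e ≡ d → d ≡ 0
    small zero    eq = sym eq
    small (suc e) eq = contradiction (subst (g ∣_) (sym eq) g∣d) (>⇒∤ (subst (ℕ._< g) (sym eq) d<g))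

  βs : List ℤ
  βs = map β (allFin g)

  βs-unique : Unique βs
  βs-unique = Uniqueₚ.map⁺ β-injective (Uniqueₚ.allFin⁺ g)

  length-βs : length βs ≡ g
  length-βs = trans (length-map β (allFin g)) (length-allFin g)

  x-far : ∀ {m} → ℓ ω ℕ.≤ m → x (m ℕ.+ g) ℤ.+ + g ≡ x m
  x-far {m} ℓ≤m = begin
    x (m ℕ.+ g) ℤ.+ + g
      ≡⟨ cong (λ r → + r ℤ.- + suc (m ℕ.+ g) ℤ.+ + g) (row-beyond (ℕₚ.≤-trans ℓ≤m (ℕₚ.m≤m+n m g))) ⟩
    + 0 ℤ.- + suc (m ℕ.+ g) ℤ.+ + g
      ≡⟨ cancel (+ m) (+ g) ⟩
    + 0 ℤ.- + suc m
      ≡⟨ cong (λ r → + r ℤ.- + suc m) (row-beyond ℓ≤m) ⟨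
    x m ∎
    where
    open ≡-Reasoning
    cancel : ∀ m g → + 0 ℤ.- (+ 1 ℤ.+ (m ℤ.+ g)) ℤ.+ g ≡ + 0 ℤ.- (+ 1 ℤ.+ m)
    cancel = solve-∀

  -- Moving every bead of the abacus of a core up by g adds exactly the beads β.
  x-shift-↭ : ∀ {K} → ℓ ω ℕ.≤ K →
    map x (upTo K) ++ βs ↭ map (λ i → x i ℤ.+ + g) (upTo (K ℕ.+ g))
  x-shift-↭ {K} ℓ≤K = ⊆⇒↭ unique sub (ℕₚ.≤-reflexive len)
    where
    unique : Unique (map x (upTo K) ++ βs)
    unique = Uniqueₚ.++⁺ (Uniqueₚ.map⁺ x-injective (Uniqueₚ.upTo⁺ K)) βs-unique
      λ (z∈₁ , z∈₂) → case (∈-map⁻ x z∈₁ , ∈-map⁻ β z∈₂) of λ where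
        ((i , _ , eq) , (b , _ , eq′)) → β-not-vertical b (i , trans (sym eq′) eq)

    len : length (map (λ i → x i ℤ.+ + g) (upTo (K ℕ.+ g))) ≡ length (map x (upTo K) ++ βs)
    len = trans (trans (length-map _ (upTo (K ℕ.+ g))) (length-upTo (K ℕ.+ g)))
      (sym (trans (length-++ (map x (upTo K)))
        (cong₂ ℕ._+_ (trans (length-map x (upTo K)) (length-upTo K)) length-βs)))

    -- Let z - g = `x j`. For j < K + g the entry is in the list. For larger j, row j - g is empty
    -- as well, so z would equal `x (j - g)` with j - g ≥ K, which the last hypothesis excludes.
    lift : ∀ z → IsVertical ω (z ℤ.- + g) → (∀ j → K ℕ.≤ j → z ≢ x j) →
           z ∈ map (λ i → x i ℤ.+ + g) (upTo (K ℕ.+ g))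
    lift z (j , eq) z≢x with j ℕₚ.<? K ℕ.+ g
    ... | yes j<K+g = subst (_∈ map (λ i → x i ℤ.+ + g) (upTo (K ℕ.+ g))) (sym z≡) (∈-map⁺ _ (∈-upTo⁺ j<K+g))
      where
      cancel : ∀ z g → z ≡ z ℤ.- g ℤ.+ g
      cancel = solve-∀
      z≡ : z ≡ x j ℤ.+ + g
      z≡ = trans (cancel z (+ g)) (cong (ℤ._+ + g) eq)
    ... | no j≮K+g = contradiction z≡ (z≢x m K≤m)
      where
      open ≡-Reasoning
      m : ℕ
      m = j ℕ.∸ g
      K+g≤j : K ℕ.+ g ℕ.≤ j
      K+g≤j = ℕₚ.≮⇒≥ j≮K+g
      K≤m : K ℕ.≤ m
      K≤m = subst (ℕ._≤ m) (ℕₚ.m+n∸n≡m K g) (ℕₚ.∸-monoˡ-≤ g K+g≤j)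
      m+g≡j : m ℕ.+ g ≡ j
      m+g≡j = ℕₚ.m∸n+n≡m (ℕₚ.≤-trans (ℕₚ.m≤n+m g K) K+g≤j)
      cancel : ∀ z g → z ≡ z ℤ.- g ℤ.+ g
      cancel = solve-∀
      z≡ : z ≡ x m
      z≡ = begin
        z                      ≡⟨ cancel z (+ g) ⟩
        z ℤ.- + g ℤ.+ + g      ≡⟨ cong (ℤ._+ + g) eq ⟩
        x j ℤ.+ + g            ≡⟨ cong (λ n → x n ℤ.+ + g) m+g≡j ⟨
        x (m ℕ.+ g) ℤ.+ + g    ≡⟨ x-far (ℕₚ.≤-trans ℓ≤K K≤m) ⟩
        x m                    ∎

    sub : ∀ {z} → z ∈ map x (upTo K) ++ βs → z ∈ map (λ i → x i ℤ.+ + g) (upTo (K ℕ.+ g))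
    sub z∈ with ∈-++⁻ (map x (upTo K)) z∈
    ... | inj₁ z∈₁ with i , i∈ , refl ← ∈-map⁻ x z∈₁ =
      lift (x i) (vertical-down (i , refl))
        (λ j K≤j eq → ℕₚ.<⇒≢ (ℕₚ.<-≤-trans (∈-upTo⁻ i∈) K≤j) (x-injective eq))
    ... | inj₂ z∈₂ with b , _ , refl ← ∈-map⁻ β z∈₂ =
      lift (β b) (β-vertical b) (λ j _ eq → β-not-vertical b (j , eq))

  -- The form that `conj` takes after the shift by g: `reflect z` is `conj z + g` and also
  -- `conj (z - g)`.
  reflect : ℤ → ℤ
  reflect z = + g ℤ.- + 1 ℤ.- z

  reflect-involutive : ∀ z → reflect (reflect z) ≡ z
  reflect-involutive = lemma (+ g)
    where
    lemma : ∀ g z → g ℤ.- + 1 ℤ.- (g ℤ.- + 1 ℤ.- z) ≡ z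
    lemma = solve-∀

  -- Since `β b` is not vertical, `conj (β b)` is, so its shift `reflect (β b)` is a shifted
  -- vertical step. Since `β b - g` is vertical, `reflect (β b) = conj (β b - g)` is not vertical
  -- itself. By `x-shift-↭` only the β's remain.
  β-reflect : ∀ b → ∃ λ b′ → reflect (β b) ≡ β b′
  β-reflect b = lookup-β (vertical-or-conj (β b) (β-not-vertical b))
    where
    up : ∀ g b → ℤ.- + 1 ℤ.- b ℤ.+ g ≡ g ℤ.- + 1 ℤ.- b
    up = solve-∀
    down : ∀ g b → ℤ.- + 1 ℤ.- (b ℤ.- g) ≡ g ℤ.- + 1 ℤ.- b
    down = solve-∀

    not-x : ∀ i → reflect (β b) ≢ x i
    not-x i eq = vertical-conj (β-vertical b) (i , trans (down (+ g) (β b)) eq)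

    locate : ∀ {K} → reflect (β b) ∈ map x (upTo K) ⊎ reflect (β b) ∈ βs → ∃ λ b′ → reflect (β b) ≡ β b′
    locate (inj₁ z∈) = let i , _ , eq = ∈-map⁻ x z∈ in contradiction eq (not-x i)
    locate (inj₂ z∈) = let b′ , _ , eq = ∈-map⁻ β z∈ in b′ , eq

    lookup-β : IsVertical ω (conj (β b)) → ∃ λ b′ → reflect (β b) ≡ β b′
    lookup-β (j , eq) = locate (∈-++⁻ (map x (upTo (ℓ ω ℕ.+ j)))
      (Permₚ.∈-resp-↭ (↭-sym (x-shift-↭ (ℕₚ.m≤m+n (ℓ ω) j)))
        (subst (_∈ map (λ i → x i ℤ.+ + g) (upTo (ℓ ω ℕ.+ j ℕ.+ g)))
          (trans (cong (ℤ._+ + g) (sym eq)) (up (+ g) (β b)))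
          (∈-map⁺ (λ i → x i ℤ.+ + g) (∈-upTo⁺ j<)))))
      where
      j< : j ℕ.< ℓ ω ℕ.+ j ℕ.+ g
      j< = ℕₚ.≤-<-trans (ℕₚ.m≤n+m j (ℓ ω)) (ℕₚ.m<m+n _ (ℕ.>-nonZero⁻¹ g))

  v-injective : ∀ {i j} → v i ≡ v j → i ≡ j
  v-injective {i} {j} eq with Finₚ.<-cmp i j
  ... | tri< i<j _ _ = contradiction (sym eq) (ℤₚ.<⇒≢ (IsVCoding.decreasing vc i j i<j))
  ... | tri≈ _ i≡j _ = i≡j
  ... | tri> _ _ j<i = contradiction eq (ℤₚ.<⇒≢ (IsVCoding.decreasing vc j i j<i))

  vs : List ℤ
  vs = map v (allFin t)

  -- If v j lay in the lower half, then every β not among the v's would be the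
  -- reflection of some v i > v j, leaving at most t + (t - 1) values for β.
  t≤v : ∀ j → + t ℤ.≤ v j
  t≤v j = ℤₚ.≮⇒≥ λ vj<t → impossible vj<t (∈-∃++ (∈-allFin j))
    where
    impossible : v j ℤ.< + t → ¬ ∃ λ as → ∃ λ bs → allFin t ≡ as ++ j ∷ bs
    impossible vj<t (as , bs , eq) =
      ℕₚ.<⇒≱ len (subst (ℕ._≤ length ys) length-βs (⊆⇒length≤ βs-unique covered))
      where
      rest : List (Fin t)
      rest = as ++ bs
      ys : List ℤ
      ys = vs ++ map (reflect ∘ v) rest

      split : allFin t ↭ j ∷ rest
      split = subst (_↭ j ∷ rest) (sym eq) (Permₚ.shift j as bs)

      len : length ys ℕ.< g
      len = ℕₚ.≤-reflexive (begin
        suc (length ys)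
          ≡⟨ cong suc (length-++ vs) ⟩
        suc (length vs ℕ.+ length (map (reflect ∘ v) rest))
          ≡⟨ cong₂ (λ a b → suc (a ℕ.+ b)) (trans (length-map v (allFin t)) (length-allFin t)) (length-map _ rest) ⟩
        suc (t ℕ.+ length rest)
          ≡⟨ ℕₚ.+-suc t (length rest) ⟨
        t ℕ.+ suc (length rest)
          ≡⟨ cong (t ℕ.+_) (trans (sym (Permₚ.↭-length split)) (length-allFin t)) ⟩
        t ℕ.+ t
          ≡⟨ cong (t ℕ.+_) (ℕₚ.+-identityʳ t) ⟨
        g ∎)
        where open ≡-Reasoning

      -- `reflect (β b) - v j` is (v j - β b) + 2 (t - v j) - 1, where each of the three differences
      -- is at least 1.
      above : ∀ {b} → β b ℤ.< v j → v j ℤ.< reflect (β b)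
      above {b} βb<vj = 1≤-⇒< (ℤₚ.≤-trans (ℤ.+≤+ (s≤s z≤n))
        (subst (+ 2 ℤ.≤_) (regroup (v j) (β b) (+ t))
          (ℤₚ.+-monoˡ-≤ (ℤ.- + 1) (ℤₚ.+-mono-≤ (ℤₚ.+-mono-≤ (<⇒1≤- βb<vj) (<⇒1≤- vj<t)) (<⇒1≤- vj<t)))))
        where
        regroup : ∀ c a t → c ℤ.- a ℤ.+ (t ℤ.- c) ℤ.+ (t ℤ.- c) ℤ.- + 1 ≡ t ℤ.+ (t ℤ.+ + 0) ℤ.- + 1 ℤ.- a ℤ.- c
        regroup = solve-∀

      β∈ys : ∀ b → β b ∈ ys
      β∈ys b = from (largest b)
        where
        from : (∃ λ i → β b ≡ v i) ⊎ (∀ i → β b ℤ.< v i) → β b ∈ ys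
        from (inj₁ (i , eq)) = ∈-++⁺ˡ (subst (_∈ vs) (sym eq) (∈-map⁺ v (∈-allFin i)))
        from (inj₂ βb<v)     = reflected (β-reflect b)
          where
          -- The index j is impossible because `reflect (β b)` is strictly above `v j`; this leaves
          -- only the t - 1 indices of `rest`.
          top : ∀ i → reflect (β b) ≡ v i → i ∈ j ∷ rest → β b ∈ ys
          top i eq (here refl) = contradiction (sym eq) (ℤₚ.<⇒≢ (above (βb<v j)))
          top i eq (there i∈)  = ∈-++⁺ʳ vs (subst (_∈ map (reflect ∘ v) rest)
            (trans (cong reflect (sym eq)) (reflect-involutive (β b))) (∈-map⁺ (reflect ∘ v) i∈))

          reflected : (∃ λ b′ → reflect (β b) ≡ β b′) → β b ∈ ys
          reflected (b′ , eq) with largest b′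
          ... | inj₁ (i , eq′) = top i (trans eq eq′) (Permₚ.∈-resp-↭ split (∈-allFin i))
          ... | inj₂ βb′<v     =
            contradiction (subst (ℤ._< v j) (sym eq) (βb′<v j)) (ℤₚ.<-asym (above (βb<v j)))

      covered : ∀ {z} → z ∈ βs → z ∈ ys
      covered z∈ = let b , _ , eq = ∈-map⁻ β z∈ in subst (_∈ ys) (sym eq) (β∈ys b)

  -- All `v i` are at least t, so all their reflections are at most t - 1. These are therefore 2 t
  -- distinct values of β, and β has exactly g = 2 t values.
  v-reflect-↭ : vs ++ map (reflect ∘ v) (allFin t) ↭ βs
  v-reflect-↭ = ⊆⇒↭ unique sub (ℕₚ.≤-reflexive len)
    where
    separated : ∀ i j → v i ≢ reflect (v j)
    separated i j eq = ℤₚ.<⇒≢ below (sym eq)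
      where
      regroup : ∀ a b t → + 1 ℤ.+ ((a ℤ.- t) ℤ.+ (b ℤ.- t)) ≡ a ℤ.- (t ℤ.+ (t ℤ.+ + 0) ℤ.- + 1 ℤ.- b)
      regroup = solve-∀
      below : reflect (v j) ℤ.< v i
      below = 1≤-⇒< (subst (+ 1 ℤ.≤_) (regroup (v i) (v j) (+ t))
        (ℤₚ.+-monoʳ-≤ (+ 1) (ℤₚ.+-mono-≤ (ℤₚ.i≤j⇒0≤j-i (t≤v i)) (ℤₚ.i≤j⇒0≤j-i (t≤v j)))))

    unique : Unique (vs ++ map (reflect ∘ v) (allFin t))
    unique = Uniqueₚ.++⁺ (Uniqueₚ.map⁺ v-injective (Uniqueₚ.allFin⁺ t))
      (Uniqueₚ.map⁺ (λ {i} {j} eq → v-injective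
        (trans (sym (reflect-involutive (v i))) (trans (cong reflect eq) (reflect-involutive (v j)))))
        (Uniqueₚ.allFin⁺ t))
      λ (z∈₁ , z∈₂) → case (∈-map⁻ v z∈₁ , ∈-map⁻ (reflect ∘ v) z∈₂) of λ where
        ((i , _ , eq₁) , (j , _ , eq₂)) → separated i j (trans (sym eq₁) eq₂)

    v∈βs : ∀ i → v i ∈ βs
    v∈βs i = let b , eq = among-β i in subst (_∈ βs) (sym eq) (∈-map⁺ β (∈-allFin b))

    reflect∈βs : ∀ i → reflect (v i) ∈ βs
    reflect∈βs i = let b , eq = among-β i ; b′ , eq′ = β-reflect b in
      subst (_∈ βs) (sym (trans (cong reflect eq) eq′)) (∈-map⁺ β (∈-allFin b′))

    sub : ∀ {z} → z ∈ vs ++ map (reflect ∘ v) (allFin t) → z ∈ βs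
    sub z∈ with ∈-++⁻ vs z∈
    ... | inj₁ z∈₁ = let i , _ , eq = ∈-map⁻ v z∈₁ in subst (_∈ βs) (sym eq) (v∈βs i)
    ... | inj₂ z∈₂ = let i , _ , eq = ∈-map⁻ (reflect ∘ v) z∈₂ in subst (_∈ βs) (sym eq) (reflect∈βs i)

    len : length βs ≡ length (vs ++ map (reflect ∘ v) (allFin t))
    len = trans length-βs (sym (trans (length-++ vs)
      (trans (cong₂ ℕ._+_ (trans (length-map v (allFin t)) (length-allFin t))
                          (trans (length-map _ (allFin t)) (length-allFin t)))
             (cong (t ℕ.+_) (sym (ℕₚ.+-identityʳ t))))))

  S-shift : ∀ {K} → ℓ ω ℕ.≤ K → (f : ℤ → ℤ) →
    S (upTo (K ℕ.+ g)) (λ i → f (x i ℤ.+ + g)) ≡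
      S (upTo K) (λ i → f (x i)) ℤ.+ S (allFin t) (λ i → f (v i) ℤ.+ f (reflect (v i)))
  S-shift {K} ℓ≤K f = begin
    S (upTo (K ℕ.+ g)) (λ i → f (x i ℤ.+ + g))
      ≡⟨ S-map (λ i → x i ℤ.+ + g) (upTo (K ℕ.+ g)) f ⟨
    S (map (λ i → x i ℤ.+ + g) (upTo (K ℕ.+ g))) f
      ≡⟨ S-↭ f (x-shift-↭ ℓ≤K) ⟨
    S (map x (upTo K) ++ βs) f
      ≡⟨ S-++ (map x (upTo K)) βs f ⟩
    S (map x (upTo K)) f ℤ.+ S βs f
      ≡⟨ cong₂ ℤ._+_ (S-map x (upTo K) f) (sym (S-↭ f v-reflect-↭)) ⟩
    S (upTo K) (f ∘ x) ℤ.+ S (vs ++ map (reflect ∘ v) (allFin t)) f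
      ≡⟨ cong (λ s → S (upTo K) (f ∘ x) ℤ.+ s) (trans (S-++ vs _ f)
           (trans (cong₂ ℤ._+_ (S-map v (allFin t) f) (S-map (reflect ∘ v) (allFin t) f))
             (sym (S-+ (allFin t) (f ∘ v) (f ∘ reflect ∘ v))))) ⟩
    S (upTo K) (f ∘ x) ℤ.+ S (allFin t) (λ i → f (v i) ℤ.+ f (reflect (v i))) ∎
    where open ≡-Reasoning

-- Hook lengths as sums of vertical positions

S-pick : ∀ {a} {A : Set a} {f : A → ℤ} {a} xs → Unique xs → a ∈ xs →
         (∀ {x} → x ∈ xs → x ≢ a → f x ≡ 0ℤ) → S xs f ≡ f a
S-pick {f = f} {a} (x ∷ xs) (x≢xs ∷ _) (here refl) f≗0 =
  trans (cong (λ s → f x ℤ.+ s) (S-zero xs (λ y∈ → f≗0 (there y∈) (≢-sym (All.lookup x≢xs y∈)))))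
        (ℤₚ.+-identityʳ (f x))
S-pick {f = f} {a} (x ∷ xs) (x≢xs ∷ u) (there a∈) f≗0 =
  trans (cong₂ ℤ._+_ (f≗0 (here refl) (All.lookup x≢xs a∈)) (S-pick xs u a∈ (f≗0 ∘ there)))
        (ℤₚ.+-identityˡ (f a))

upTo-increasing : ∀ n → AllPairs ℕ._<_ (upTo n)
upTo-increasing n = AllPairsₚ.applyUpTo⁺₁ id n (λ i<j _ → i<j)

window-unique : ∀ N → Unique (window N)
window-unique N = Uniqueₚ.++⁺ (Uniqueₚ.map⁺ ℤₚ.+-injective (Uniqueₚ.upTo⁺ N))
  (Uniqueₚ.map⁺ ℤₚ.-[1+-injective (Uniqueₚ.upTo⁺ N))
  λ (z∈₁ , z∈₂) → case (∈-map⁻ +_ z∈₁ , ∈-map⁻ -[1+_] z∈₂) of λ where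
    ((_ , _ , refl) , (_ , _ , ()))

below : Box → Bool
below (i , j) = j ℕ.<ᵇ i

-- Numbers of boxes of hook length m with ε = 1 and with ε = -1. The argument is an integer, so that
-- m + g and m - g can be inserted freely.
up lo : Partition → ℤ → ℤ
up ω m = S (boxes ω) (λ s → ⟨ not (below s) ⟩ δ (+ hook ω s ℤ.- m))
lo ω m = S (boxes ω) (λ s → ⟨ below s ⟩ δ (+ hook ω s ℤ.- m))

-- The count O of the overview, truncated. The two ranges are separate because each use of the shift
-- identity changes one range by g.
pairSums : (ℕ → ℤ) → ℕ → ℕ → ℤ → ℤ
pairSums x M N m = S (upTo M) (λ i → S (upTo N) (λ j → δ (x i ℤ.+ x j ℤ.+ + 1 ℤ.- m)))

doubles : (ℕ → ℤ) → ℕ → ℤ → ℤ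
doubles x N m = S (upTo N) (λ i → δ (x i ℤ.+ x i ℤ.+ + 1 ℤ.- m))

-- The number of z in the window with u + z + 1 = m. It arises when a sum over the `x j` is
-- completed by the sum over the `conj (x j)`.
partners : ℕ → ℤ → ℤ → ℤ
partners N m u = S (window N) (λ z → δ (u ℤ.+ z ℤ.+ + 1 ℤ.- m))

partners≡1 : ∀ {N m u} → m ℤ.- + 1 ℤ.- u ∈ window N → partners N m u ≡ + 1
partners≡1 {N} {m} {u} a∈ = trans (S-pick (window N) (window-unique N) a∈ others) (cong δ (cancel m u))
  where
  a : ℤ
  a = m ℤ.- + 1 ℤ.- u
  cancel : ∀ m u → u ℤ.+ (m ℤ.- + 1 ℤ.- u) ℤ.+ + 1 ℤ.- m ≡ + 0
  cancel = solve-∀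
  shape : ∀ m u z → z ℤ.- (m ℤ.- + 1 ℤ.- u) ≡ u ℤ.+ z ℤ.+ + 1 ℤ.- m
  shape = solve-∀
  others : ∀ {z} → z ∈ window N → z ≢ a → δ (u ℤ.+ z ℤ.+ + 1 ℤ.- m) ≡ 0ℤ
  others {z} _ z≢a = trans (cong δ (sym (shape m u z))) (δ≢ z≢a)

module _ {L N : ℕ} {m r i : ℕ} (L+m≤N : L ℕ.+ m ℕ.≤ N) (r≤L : r ℕ.≤ L) (i<L : i ℕ.< L) where

  -- The margin of m between `L` and `N` keeps the unique partner m - 1 - u inside the window. The
  -- value is the same for every row length up to `L`, which permits comparison with an empty row.
  partners-step : partners N (+ m) (+ r ℤ.- + suc i) ≡ + 1
  partners-step = partners≡1 {N} {+ m} {+ r ℤ.- + suc i} (subst (_∈ window N) (shape (+ m) (+ r) (+ i))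
    (∈-window (m ℕ.+ i) r
      (ℕₚ.<-≤-trans (subst (m ℕ.+ i ℕ.<_) (ℕₚ.+-comm m L) (ℕₚ.+-monoʳ-< m i<L))
        (ℕₚ.≤-trans L+m≤N (ℕₚ.m≤m+n N r)))
      (ℕₚ.≤-trans r≤L (ℕₚ.≤-trans (ℕₚ.≤-trans (ℕₚ.m≤m+n L m) L+m≤N) (ℕₚ.m≤m+n N _)))))
    where
    shape : ∀ m r i → m ℤ.+ i ℤ.- r ≡ m ℤ.- + 1 ℤ.- (r ℤ.- (+ 1 ℤ.+ i))
    shape = solve-∀

  partners-conj-step : partners N (+ m) (ℤ.- + 1 ℤ.- (+ r ℤ.- + suc i)) ≡ + 1
  partners-conj-step = partners≡1 {N} {+ m} {ℤ.- + 1 ℤ.- (+ r ℤ.- + suc i)} (subst (_∈ window N) (shape (+ m) (+ r) (+ i))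
    (∈-window (m ℕ.+ r) (suc i)
      (ℕₚ.≤-<-trans (ℕₚ.≤-trans (subst (m ℕ.+ r ℕ.≤_) (ℕₚ.+-comm m L) (ℕₚ.+-monoʳ-≤ m r≤L)) L+m≤N)
        (ℕₚ.m<m+n N (s≤s z≤n)))
      (ℕₚ.≤-trans i<L (ℕₚ.≤-trans (ℕₚ.≤-trans (ℕₚ.m≤m+n L m) L+m≤N) (ℕₚ.m≤m+n N _)))))
    where
    shape : ∀ m r i → m ℤ.+ r ℤ.- (+ 1 ℤ.+ i) ≡ m ℤ.- + 1 ℤ.- (ℤ.- + 1 ℤ.- (r ℤ.- (+ 1 ℤ.+ i)))
    shape = solve-∀

∅ : Partition
∅ = record { parts = [] ; positive = [] ; decreasing = [] }

∅-selfConjugate : SelfConjugate ∅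
∅-selfConjugate _ = refl

module BoxCounts (ω : Partition) (sc : SelfConjugate ω) where

  open SelfConjugatePartition ω sc

  O : ℕ → ℕ → ℤ → ℤ
  O = pairSums x

  D : ℕ → ℤ → ℤ
  D = doubles x

  ∈-boxes⁻ : ∀ {i j} → (i , j) ∈ boxes ω → j ℕ.< row ω i
  ∈-boxes⁻ s∈ =
    let i , _ , s∈row = find (∈-concatMap⁻ (λ i → map (i ,_) (upTo (row ω i))) {xs = upTo (ℓ ω)} s∈)
    in in-row i s∈row
    where
    in-row : ∀ {i j} k → (i , j) ∈ map (k ,_) (upTo (row ω k)) → j ℕ.< row ω i
    in-row k s∈ with _ , j∈ , refl ← ∈-map⁻ (k ,_) s∈ = ∈-upTo⁻ j∈

  S-boxes : ∀ {M N} → ℓ ω ℕ.≤ M → ℓ ω ℕ.≤ N → (k : ℕ → ℕ → ℤ) →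
            (∀ i j → row ω i ℕ.≤ j → k i j ≡ 0ℤ) →
            S (boxes ω) (λ (i , j) → k i j) ≡ S (upTo M) (λ i → S (upTo N) (k i))
  S-boxes {M} {N} ℓ≤M ℓ≤N k k≗0 = begin
    S (boxes ω) (λ (i , j) → k i j)
      ≡⟨ S-concatMap (λ i → map (i ,_) (upTo (row ω i))) (upTo (ℓ ω)) _ ⟩
    S (upTo (ℓ ω)) (λ i → S (map (i ,_) (upTo (row ω i))) (λ (i , j) → k i j))
      ≡⟨ S-cong (upTo (ℓ ω)) (λ i → S-map (i ,_) (upTo (row ω i)) _) ⟩
    S (upTo (ℓ ω)) (λ i → S (upTo (row ω i)) (k i))
      ≡⟨ S-cong (upTo (ℓ ω)) (λ i → sym (S-upTo-extend (k i) (ℕₚ.≤-trans (row-bound i) ℓ≤N) (k≗0 i))) ⟩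
    S (upTo (ℓ ω)) (λ i → S (upTo N) (k i))
      ≡⟨ S-upTo-extend (λ i → S (upTo N) (k i)) ℓ≤M (λ i ℓ≤i → S-zero (upTo N) (λ {j} _ →
           k≗0 i j (ℕₚ.≤-trans (ℕₚ.≤-reflexive (row-beyond ℓ≤i)) z≤n))) ⟨
    S (upTo M) (λ i → S (upTo N) (k i)) ∎
    where open ≡-Reasoning

  module _ (m : ℕ) where

    term : ℕ → ℕ → ℤ
    term i j = δ (x i ℤ.+ x j ℤ.+ + 1 ℤ.- + m)

    term-outside : ∀ i j → row ω i ℕ.≤ j → term i j ≡ 0ℤ
    term-outside i j row≤j =
      δ≢ (ℤₚ.<⇒≢ (ℤₚ.<-≤-trans (x+x-negative row≤j) (ℤ.+≤+ z≤n)))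

    term-hook : ∀ {i j} → (i , j) ∈ boxes ω → δ (+ hook ω (i , j) ℤ.- + m) ≡ term i j
    term-hook s∈ = cong (λ h → δ (h ℤ.- + m)) (+-hook (∈-boxes⁻ s∈))

    module _ {M N : ℕ} (ℓ≤M : ℓ ω ℕ.≤ M) (ℓ≤N : ℓ ω ℕ.≤ N) where

      up+lo : up ω (+ m) ℤ.+ lo ω (+ m) ≡ O M N (+ m)
      up+lo = begin
        up ω (+ m) ℤ.+ lo ω (+ m)
          ≡⟨ S-+ (boxes ω) _ _ ⟨
        S (boxes ω) (λ s → ⟨ not (below s) ⟩ δ (+ hook ω s ℤ.- + m) ℤ.+ ⟨ below s ⟩ δ (+ hook ω s ℤ.- + m))
          ≡⟨ S-cong∈ (boxes ω) (λ {s} s∈ → trans (⟨⟩-not (below s) _) (term-hook s∈)) ⟩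
        S (boxes ω) (λ (i , j) → term i j)
          ≡⟨ S-boxes ℓ≤M ℓ≤N term term-outside ⟩
        O M N (+ m) ∎
        where open ≡-Reasoning

      lo≡ : lo ω (+ m) ≡ S (upTo M) (λ i → S (upTo N) (λ j → ⟨ j ℕ.<ᵇ i ⟩ term i j))
      lo≡ = trans
        (S-cong∈ (boxes ω) (λ {s} s∈ → cong (⟨ below s ⟩_) (term-hook s∈)))
        (S-boxes ℓ≤M ℓ≤N _ (λ i j row≤j →
          trans (cong (⟨ j ℕ.<ᵇ i ⟩_) (term-outside i j row≤j)) (⟨⟩-zero (j ℕ.<ᵇ i))))

    -- The summand is symmetric in i and j: the triangle below the diagonal is `lo`, the one above
    -- is its mirror image, and the diagonal is `D`.
    lo+lo+D : ∀ {N} → ℓ ω ℕ.≤ N → lo ω (+ m) ℤ.+ lo ω (+ m) ℤ.+ D N (+ m) ≡ O N N (+ m)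
    lo+lo+D {N} ℓ≤N = begin
      lo ω (+ m) ℤ.+ lo ω (+ m) ℤ.+ D N (+ m)
        ≡⟨ cong₂ (λ a b → a ℤ.+ b ℤ.+ D N (+ m)) (trans (lo≡ ℓ≤N ℓ≤N) transpose) (lo≡ ℓ≤N ℓ≤N) ⟩
      S (upTo N) (λ i → S (upTo N) (λ j → ⟨ i ℕ.<ᵇ j ⟩ term i j))
        ℤ.+ S (upTo N) (λ i → S (upTo N) (λ j → ⟨ j ℕ.<ᵇ i ⟩ term i j)) ℤ.+ D N (+ m)
        ≡⟨ S-trichotomy id (upTo-increasing N) term ⟨
      O N N (+ m) ∎
      where
      open ≡-Reasoning
      transpose : S (upTo N) (λ i → S (upTo N) (λ j → ⟨ j ℕ.<ᵇ i ⟩ term i j))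
                ≡ S (upTo N) (λ i → S (upTo N) (λ j → ⟨ i ℕ.<ᵇ j ⟩ term i j))
      transpose = trans (S-swap (upTo N) (upTo N) _)
        (S-cong (upTo N) (λ i → S-cong (upTo N) (λ j → cong (λ z → ⟨ i ℕ.<ᵇ j ⟩ δ (z ℤ.+ + 1 ℤ.- + m))
          (ℤₚ.+-comm (x j) (x i)))))

  up-nonpositive : ∀ {m} → m ℤ.≤ 0ℤ → up ω m ≡ 0ℤ
  up-nonpositive {m} m≤0 = S-zero (boxes ω) (λ { {i , j} _ →
    trans (cong (⟨ not (below (i , j)) ⟩_) (δ≢ (≢-sym (ℤₚ.<⇒≢ (ℤₚ.≤-<-trans m≤0 (hook-positive i j))))))
          (⟨⟩-zero (not (below (i , j)))) })

  lo-nonpositive : ∀ {m} → m ℤ.≤ 0ℤ → lo ω m ≡ 0ℤ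
  lo-nonpositive {m} m≤0 = S-zero (boxes ω) (λ { {i , j} _ →
    trans (cong (⟨ below (i , j) ⟩_) (δ≢ (≢-sym (ℤₚ.<⇒≢ (ℤₚ.≤-<-trans m≤0 (hook-positive i j))))))
          (⟨⟩-zero (below (i , j))) })

  S-conj : ∀ {N} → ℓ ω ℕ.≤ N → (f : ℤ → ℤ) →
           S (upTo N) (λ i → f (x i)) ℤ.+ S (upTo N) (λ i → f (conj (x i))) ≡ S (window N) f
  S-conj {N} ℓ≤N f = begin
    S (upTo N) (f ∘ x) ℤ.+ S (upTo N) (f ∘ conj ∘ x)
      ≡⟨ cong₂ ℤ._+_ (S-map x (upTo N) f) (S-map (conj ∘ x) (upTo N) f) ⟨
    S (map x (upTo N)) f ℤ.+ S (map (conj ∘ x) (upTo N)) f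
      ≡⟨ S-++ (map x (upTo N)) _ f ⟨
    S (map x (upTo N) ++ map (conj ∘ x) (upTo N)) f
      ≡⟨ S-↭ f (x-conj-↭ ℓ≤N) ⟩
    S (window N) f ∎
    where open ≡-Reasoning

  -- Applying `conj` to both arguments changes the sign of a + b + 1.
  δ-conj : ∀ a b m → δ (a ℤ.+ b ℤ.+ + 1 ℤ.- (ℤ.- m)) ≡ δ (conj a ℤ.+ conj b ℤ.+ + 1 ℤ.- m)
  δ-conj a b m = trans (sym (δ-neg _)) (cong δ (shape a b m))
    where
    shape : ∀ a b m → ℤ.- (a ℤ.+ b ℤ.+ + 1 ℤ.- (ℤ.- m)) ≡ (ℤ.- + 1 ℤ.- a) ℤ.+ (ℤ.- + 1 ℤ.- b) ℤ.+ + 1 ℤ.- m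
    shape = solve-∀

  D-conj : ∀ {N} → ℓ ω ℕ.≤ N → ∀ m →
           D N m ℤ.+ D N (ℤ.- m) ≡ S (window N) (λ z → δ (z ℤ.+ z ℤ.+ + 1 ℤ.- m))
  D-conj {N} ℓ≤N m = trans
    (cong (λ s → D N m ℤ.+ s) (S-cong (upTo N) (λ i → δ-conj (x i) (x i) m)))
    (S-conj ℓ≤N (λ z → δ (z ℤ.+ z ℤ.+ + 1 ℤ.- m)))

  -- Splitting each window into the `x j` and the `conj (x j)` turns both sides into the same three
  -- sums: pairs of two `x` at m, mixed pairs at m, and pairs of two `conj x` at m, which are pairs
  -- of two `x` at -m.
  O-conj : ∀ {N} → ℓ ω ℕ.≤ N → ∀ m →
    O N N m ℤ.+ S (upTo N) (λ i → partners N m (conj (x i))) ≡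
    O N N (ℤ.- m) ℤ.+ S (upTo N) (λ i → partners N m (x i))
  O-conj {N} ℓ≤N m = begin
    O N N m ℤ.+ S (upTo N) (λ i → partners N m (conj (x i)))
      ≡⟨ cong (λ s → O N N m ℤ.+ s) (split conj) ⟨
    O N N m ℤ.+ (mixed′ ℤ.+ S (upTo N) (λ i → S (upTo N) (λ j → δ (conj (x i) ℤ.+ conj (x j) ℤ.+ + 1 ℤ.- m))))
      ≡⟨ cong₂ (λ a b → O N N m ℤ.+ (a ℤ.+ b)) mixed-sym
           (S-cong (upTo N) (λ i → S-cong (upTo N) (λ j → sym (δ-conj (x i) (x j) m)))) ⟩
    O N N m ℤ.+ (mixed ℤ.+ O N N (ℤ.- m))
      ≡⟨ rearrange (O N N m) mixed (O N N (ℤ.- m)) ⟩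
    O N N (ℤ.- m) ℤ.+ (O N N m ℤ.+ mixed)
      ≡⟨ cong (λ s → O N N (ℤ.- m) ℤ.+ s) (split id) ⟩
    O N N (ℤ.- m) ℤ.+ S (upTo N) (λ i → partners N m (x i)) ∎
    where
    open ≡-Reasoning
    mixed mixed′ : ℤ
    mixed  = S (upTo N) (λ i → S (upTo N) (λ j → δ (x i ℤ.+ conj (x j) ℤ.+ + 1 ℤ.- m)))
    mixed′ = S (upTo N) (λ i → S (upTo N) (λ j → δ (conj (x i) ℤ.+ x j ℤ.+ + 1 ℤ.- m)))

    split : ∀ (c : ℤ → ℤ) →
      S (upTo N) (λ i → S (upTo N) (λ j → δ (c (x i) ℤ.+ x j ℤ.+ + 1 ℤ.- m)))
      ℤ.+ S (upTo N) (λ i → S (upTo N) (λ j → δ (c (x i) ℤ.+ conj (x j) ℤ.+ + 1 ℤ.- m)))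
      ≡ S (upTo N) (λ i → partners N m (c (x i)))
    split c = trans (sym (S-+ (upTo N) _ _))
      (S-cong (upTo N) (λ i → S-conj ℓ≤N (λ z → δ (c (x i) ℤ.+ z ℤ.+ + 1 ℤ.- m))))

    mixed-sym : mixed′ ≡ mixed
    mixed-sym = trans (S-swap (upTo N) (upTo N) _)
      (S-cong (upTo N) (λ i → S-cong (upTo N) (λ j → cong (λ z → δ (z ℤ.+ + 1 ℤ.- m))
        (ℤₚ.+-comm (conj (x j)) (x i)))))

    rearrange : ∀ a b c → a ℤ.+ (b ℤ.+ c) ≡ c ℤ.+ (a ℤ.+ b)
    rearrange = solve-∀

-- Comparison with the empty partition

module RelativeToEmpty (ω : Partition) (sc : SelfConjugate ω) where

  open BoxCounts ω sc
  open SelfConjugatePartition ω sc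
  private
    module ∅C = BoxCounts ∅ ∅-selfConjugate

  -- At nonnegative arguments pair sums count boxes, and the empty partition has none.
  ∅-O : ∀ m M N → pairSums (vert ∅) M N (+ m) ≡ 0ℤ
  ∅-O m M N = sym (∅C.up+lo m {M} {N} z≤n z≤n)

  ∅-D : ∀ m N → doubles (vert ∅) N (+ m) ≡ 0ℤ
  ∅-D m N = trans (sym (ℤₚ.+-identityˡ _)) (trans (∅C.lo+lo+D m {N} z≤n) (∅-O m N N))

  -- The sum in `D-conj` depends only on N and m, so it can be evaluated for the empty partition,
  -- where `doubles` vanishes at m.
  D-relative : ∀ {N} m → ℓ ω ℕ.≤ N →
    D N (+ m) ℤ.+ D N (ℤ.- + m) ≡ doubles (vert ∅) N (ℤ.- + m)
  D-relative {N} m ℓ≤N = trans (D-conj ℓ≤N (+ m)) (trans (sym (∅C.D-conj {N} z≤n (+ m)))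
    (trans (cong (ℤ._+ doubles (vert ∅) N (ℤ.- + m)) (∅-D m N)) (ℤₚ.+-identityˡ _)))

  -- The partner sums in `O-conj` agree with those of the empty partition: below `ℓ ω` every count
  -- of partners is 1, and from there on the vertical steps are the same.
  O-relative : ∀ {N} m → ℓ ω ℕ.+ m ℕ.≤ N →
    O N N (ℤ.- + m) ≡ O N N (+ m) ℤ.+ pairSums (vert ∅) N N (ℤ.- + m)
  O-relative {N} m ℓ+m≤N = begin
    O N N (ℤ.- + m)
      ≡⟨ isolate (O N N (+ m)) (P (conj ∘ x)) (O N N (ℤ.- + m)) (P x) (O-conj ℓ≤N (+ m)) ⟩
    O N N (+ m) ℤ.+ (P (conj ∘ x) ℤ.- P x)
      ≡⟨ cong₂ (λ a b → O N N (+ m) ℤ.+ (a ℤ.- b)) (S-cong (upTo N) same-conj) (S-cong (upTo N) same) ⟩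
    O N N (+ m) ℤ.+ (P (conj ∘ vert ∅) ℤ.- P (vert ∅))
      ≡⟨ cong (λ s → O N N (+ m) ℤ.+ s) (trans (sym (ℤₚ.+-identityˡ _))
           (trans (cong (ℤ._+ (P (conj ∘ vert ∅) ℤ.- P (vert ∅))) (sym (∅-O m N N)))
             (sym (isolate (pairSums (vert ∅) N N (+ m)) (P (conj ∘ vert ∅)) (pairSums (vert ∅) N N (ℤ.- + m)) (P (vert ∅)) (∅C.O-conj {N} z≤n (+ m)))))) ⟩
    O N N (+ m) ℤ.+ pairSums (vert ∅) N N (ℤ.- + m) ∎
    where
    open ≡-Reasoning
    P : (ℕ → ℤ) → ℤ
    P y = S (upTo N) (λ i → partners N (+ m) (y i))

    ℓ≤N : ℓ ω ℕ.≤ N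
    ℓ≤N = ℕₚ.≤-trans (ℕₚ.m≤m+n (ℓ ω) m) ℓ+m≤N

    isolate : ∀ a b c d → a ℤ.+ b ≡ c ℤ.+ d → c ≡ a ℤ.+ (b ℤ.- d)
    isolate a b c d eq = trans (lemma₁ c d) (trans (cong (ℤ._- d) (sym eq)) (ℤₚ.+-assoc a b (ℤ.- d)))
      where
      lemma₁ : ∀ c d → c ≡ c ℤ.+ d ℤ.- d
      lemma₁ = solve-∀

    same : ∀ i → partners N (+ m) (x i) ≡ partners N (+ m) (vert ∅ i)
    same i with i ℕₚ.<? ℓ ω
    ... | yes i<ℓ = trans (partners-step ℓ+m≤N (row-bound i) i<ℓ) (sym (partners-step {r = 0} ℓ+m≤N z≤n i<ℓ))
    ... | no  i≮ℓ = cong (partners N (+ m)) (x-beyond (ℕₚ.≮⇒≥ i≮ℓ))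

    same-conj : ∀ i → partners N (+ m) (conj (x i)) ≡ partners N (+ m) (conj (vert ∅ i))
    same-conj i with i ℕₚ.<? ℓ ω
    ... | yes i<ℓ = trans (partners-conj-step ℓ+m≤N (row-bound i) i<ℓ) (sym (partners-conj-step {r = 0} ℓ+m≤N z≤n i<ℓ))
    ... | no  i≮ℓ = cong (partners N (+ m) ∘ conj) (x-beyond (ℕₚ.≮⇒≥ i≮ℓ))

-- Pairs of coding values

S-tabulate : ∀ {a} {A : Set a} n (h : Fin n → A) {f : A → ℤ} {k : ℕ → ℤ} →
             (∀ i → f (h i) ≡ k (toℕ i)) → S (tabulate h) f ≡ S (upTo n) k
S-tabulate zero    h         eq = refl
S-tabulate (suc n) h {f} {k} eq = trans
  (cong₂ ℤ._+_ (eq Fin.zero) (S-tabulate n (h ∘ Fin.suc) {f} {k ∘ suc} (eq ∘ Fin.suc)))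
  (sym (S-upTo-head n k))

S-cartesianProduct : ∀ {a b} {A : Set a} {B : Set b} (xs : List A) (ys : List B) (f : A × B → ℤ) →
                     S (cartesianProduct xs ys) f ≡ S xs (λ x → S ys (λ y → f (x , y)))
S-cartesianProduct []       ys f = refl
S-cartesianProduct (x ∷ xs) ys f = trans (S-++ (map (x ,_) ys) _ f)
  (cong₂ ℤ._+_ (S-map (x ,_) ys f) (S-cartesianProduct xs ys f))

S-pairs : ∀ t (f : Fin t × Fin t → ℤ) →
  S (pairs t) f ≡ S (allFin t) (λ i → S (allFin t) (λ j → ⟨ toℕ i ℕ.<ᵇ toℕ j ⟩ f (i , j)))
S-pairs t f = trans (S-filter (λ (i , j) → i Finₚ.<? j) (cartesianProduct (allFin t) (allFin t)) f)
  (S-cartesianProduct (allFin t) (allFin t) _)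

allFin-increasing : ∀ t → AllPairs (λ i j → toℕ i ℕ.< toℕ j) (allFin t)
allFin-increasing t = AllPairsₚ.tabulate⁺-< (λ i<j → i<j)

-- The factors r i - r j and r i + r j, for r i = v i - (g - 1) / 2.
pairValues : ∀ t → (Fin t → ℤ) → Fin t × Fin t → List ℤ
pairValues t v (i , j) = v i ℤ.- v j ∷ v i ℤ.+ v j ℤ.- + (2 ℕ.* t) ℤ.+ + 1 ∷ []

pairCount : ∀ t → (Fin t → ℤ) → ℤ → ℤ
pairCount t v n = S (pairs t) (λ p → S (pairValues t v p) (λ z → δ (z ℤ.- n)))

-- Stated for any decreasing `v` with values at least t, so as to apply both to the coding of ω and
-- to that of the empty partition.
module PairCounts (t : ℕ) (v : Fin t → ℤ) (v↘ : ∀ i j → i Fin.< j → v j ℤ.< v i)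
                  (t≤v : ∀ i → + t ℤ.≤ v i) where

  g : ℕ
  g = 2 ℕ.* t

  v-antitone : ∀ i j → toℕ i ℕ.≤ toℕ j → v j ℤ.≤ v i
  v-antitone i j i≤j with ℕₚ.m≤n⇒m<n∨m≡n i≤j
  ... | inj₁ i<j = ℤₚ.<⇒≤ (v↘ i j i<j)
  ... | inj₂ i≡j = ℤₚ.≤-reflexive (cong v (sym (Finₚ.toℕ-injective i≡j)))

  sum-positive : ∀ i j → 0ℤ ℤ.< v i ℤ.+ v j ℤ.- + g ℤ.+ + 1
  sum-positive i j = ℤₚ.suc[i]≤j⇒i<j (subst (+ 1 ℤ.≤_) (regroup (v i) (v j) (+ t))
    (ℤₚ.+-monoˡ-≤ (+ 1) (ℤₚ.+-mono-≤ (ℤₚ.i≤j⇒0≤j-i (t≤v i)) (ℤₚ.i≤j⇒0≤j-i (t≤v j)))))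
    where
    regroup : ∀ a b t → (a ℤ.- t) ℤ.+ (b ℤ.- t) ℤ.+ + 1 ≡ a ℤ.+ b ℤ.- (t ℤ.+ (t ℤ.+ + 0)) ℤ.+ + 1
    regroup = solve-∀

  difference-positive : ∀ i j → toℕ i ℕ.< toℕ j → 0ℤ ℤ.< v i ℤ.- v j
  difference-positive i j i<j = ℤₚ.suc[i]≤j⇒i<j (<⇒1≤- (v↘ i j i<j))

  pairCount-nonpositive : ∀ {n} → n ℤ.≤ 0ℤ → pairCount t v n ≡ 0ℤ
  pairCount-nonpositive {n} n≤0 = trans (S-pairs t _)
    (S-zero (allFin t) (λ {i} _ → S-zero (allFin t) (λ {j} _ → none i j)))
    where
    none : ∀ i j → ⟨ toℕ i ℕ.<ᵇ toℕ j ⟩ S (pairValues t v (i , j)) (λ z → δ (z ℤ.- n)) ≡ 0ℤ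
    none i j with toℕ i ℕ.<ᵇ toℕ j in eq
    ... | false = refl
    ... | true  = cong₂ (λ a b → a ℤ.+ (b ℤ.+ 0ℤ))
      (δ≢ (≢-sym (ℤₚ.<⇒≢ (ℤₚ.≤-<-trans n≤0
        (difference-positive i j (ℕₚ.<ᵇ⇒< (toℕ i) (toℕ j) (subst T (sym eq) _)))))))
      (δ≢ (≢-sym (ℤₚ.<⇒≢ (ℤₚ.≤-<-trans n≤0 (sum-positive i j)))))

  sums differences diagonal : ℤ → ℤ
  sums        n = S (allFin t) (λ i → S (allFin t) (λ j → δ (v i ℤ.+ v j ℤ.- + g ℤ.+ + 1 ℤ.- n)))
  differences n = S (allFin t) (λ i → S (allFin t) (λ j → δ (v i ℤ.- v j ℤ.- n)))
  diagonal    n = S (allFin t) (λ i → δ (v i ℤ.+ v i ℤ.- + g ℤ.+ + 1 ℤ.- n))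

  -- A positive n is a difference v i - v j only for i < j.
  pairCount-double : ∀ {n} → 0ℤ ℤ.< n →
    pairCount t v n ℤ.+ pairCount t v n ℤ.+ diagonal n ≡ sums n ℤ.+ (differences n ℤ.+ differences n)
  pairCount-double {n} 0<n = begin
    pairCount t v n ℤ.+ pairCount t v n ℤ.+ diagonal n
      ≡⟨ cong (λ c → c ℤ.+ c ℤ.+ diagonal n) split ⟩
    (Δ ℤ.+ Σ′) ℤ.+ (Δ ℤ.+ Σ′) ℤ.+ diagonal n
      ≡⟨ rearrange Δ Σ′ (diagonal n) ⟩
    (Σ′ ℤ.+ Σ′ ℤ.+ diagonal n) ℤ.+ (Δ ℤ.+ Δ)
      ≡⟨ cong₂ (λ a b → a ℤ.+ (b ℤ.+ b)) sums≡ differences≡ ⟨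
    sums n ℤ.+ (differences n ℤ.+ differences n) ∎
    where
    open ≡-Reasoning
    d s : Fin t → Fin t → ℤ
    d i j = δ (v i ℤ.- v j ℤ.- n)
    s i j = δ (v i ℤ.+ v j ℤ.- + g ℤ.+ + 1 ℤ.- n)

    upper lower : (Fin t → Fin t → ℤ) → ℤ
    upper k = S (allFin t) (λ i → S (allFin t) (λ j → ⟨ toℕ i ℕ.<ᵇ toℕ j ⟩ k i j))
    lower k = S (allFin t) (λ i → S (allFin t) (λ j → ⟨ toℕ j ℕ.<ᵇ toℕ i ⟩ k i j))

    Δ Σ′ : ℤ
    Δ  = upper d
    Σ′ = upper s

    rearrange : ∀ a b c → (a ℤ.+ b) ℤ.+ (a ℤ.+ b) ℤ.+ c ≡ (b ℤ.+ b ℤ.+ c) ℤ.+ (a ℤ.+ a)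
    rearrange = solve-∀

    ⟨⟩-+ : ∀ b y z → ⟨ b ⟩ (y ℤ.+ (z ℤ.+ 0ℤ)) ≡ ⟨ b ⟩ y ℤ.+ ⟨ b ⟩ z
    ⟨⟩-+ true  y z = cong (λ w → y ℤ.+ w) (ℤₚ.+-identityʳ z)
    ⟨⟩-+ false y z = refl

    split : pairCount t v n ≡ Δ ℤ.+ Σ′
    split = trans (S-pairs t _) (trans
      (S-cong (allFin t) (λ i → trans
        (S-cong (allFin t) (λ j → ⟨⟩-+ (toℕ i ℕ.<ᵇ toℕ j) (d i j) (s i j)))
        (S-+ (allFin t) _ _)))
      (S-+ (allFin t) _ _))

    sums≡ : sums n ≡ Σ′ ℤ.+ Σ′ ℤ.+ diagonal n
    sums≡ = trans (S-trichotomy toℕ (allFin-increasing t) s)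
      (cong (λ l → Σ′ ℤ.+ l ℤ.+ diagonal n) (trans (S-swap (allFin t) (allFin t) _)
        (S-cong (allFin t) (λ i → S-cong (allFin t) (λ j →
          cong (λ z → ⟨ toℕ i ℕ.<ᵇ toℕ j ⟩ δ (z ℤ.- + g ℤ.+ + 1 ℤ.- n)) (ℤₚ.+-comm (v j) (v i)))))))

    d-zero : ∀ i j → toℕ j ℕ.≤ toℕ i → d i j ≡ 0ℤ
    d-zero i j j≤i = δ≢ (ℤₚ.<⇒≢ (ℤₚ.≤-<-trans (ℤₚ.i≤j⇒i-j≤0 (v-antitone j i j≤i)) 0<n))

    lower-zero : ∀ i j → ⟨ toℕ j ℕ.<ᵇ toℕ i ⟩ d i j ≡ 0ℤ
    lower-zero i j with toℕ j ℕ.<ᵇ toℕ i in eq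
    ... | false = refl
    ... | true  = d-zero i j (ℕₚ.<⇒≤ (ℕₚ.<ᵇ⇒< (toℕ j) (toℕ i) (subst T (sym eq) _)))

    differences≡ : differences n ≡ Δ
    differences≡ = trans (S-trichotomy toℕ (allFin-increasing t) d)
      (trans (cong₂ (λ l c → Δ ℤ.+ l ℤ.+ c)
        (S-zero (allFin t) (λ {i} _ → S-zero (allFin t) (λ {j} _ → lower-zero i j)))
        (S-zero (allFin t) (λ {i} _ → d-zero i i ℕₚ.≤-refl)))
        (trans (ℤₚ.+-identityʳ _) (ℤₚ.+-identityʳ _)))

  reflect : ℤ → ℤ
  reflect z = + g ℤ.- + 1 ℤ.- z

  -- Expanding both arguments of pair sums by the shift identity expresses the
  -- second difference in n of the pair sums through the pairs of v alone.
  module SecondDifference (x : ℕ → ℤ) (K : ℕ)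
    (shift : ∀ (f : ℤ → ℤ) → S (upTo (K ℕ.+ g)) (λ i → f (x i ℤ.+ + g)) ≡
       S (upTo K) (λ i → f (x i)) ℤ.+ S (allFin t) (λ i → f (v i) ℤ.+ f (reflect (v i))))
    (n : ℤ) (0<n : 0ℤ ℤ.< n) where

    private
      N : ℕ
      N = K ℕ.+ g
      -- Raising one argument by g turns the target n into n + g, and raising both turns n - g into
      -- n + g. Hence a single kernel `e` serves for both expansions.
      c : ℤ
      c = n ℤ.+ + g

      e : ℤ → ℤ → ℤ
      e a b = δ (a ℤ.+ b ℤ.+ + 1 ℤ.- c)

      e-comm : ∀ a b → e a b ≡ e b a
      e-comm a b = cong (λ z → δ (z ℤ.+ + 1 ℤ.- c)) (ℤₚ.+-comm a b)

      -- `V` sums over the new positions `v i` and `reflect (v i)`. The shift identity splits a sum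
      -- of `e a` over shifted steps into the old part `G a` and the new part `H a`.
      V : (ℤ → ℤ) → ℤ
      V f = S (allFin t) (λ i → f (v i) ℤ.+ f (reflect (v i)))

      G H : ℤ → ℤ
      G a = S (upTo K) (λ j → e a (x j))
      H a = V (e a)

      cross Q : ℤ
      cross = S (upTo K) (λ j → H (x j))
      Q     = V H

      V-G : V G ≡ cross
      V-G = begin
        V G
          ≡⟨ S-cong (allFin t) (λ i → sym (S-+ (upTo K) (λ j → e (v i) (x j)) _)) ⟩
        S (allFin t) (λ i → S (upTo K) (λ j → e (v i) (x j) ℤ.+ e (reflect (v i)) (x j)))
          ≡⟨ S-swap (allFin t) (upTo K) _ ⟩
        S (upTo K) (λ j → S (allFin t) (λ i → e (v i) (x j) ℤ.+ e (reflect (v i)) (x j)))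
          ≡⟨ S-cong (upTo K) (λ j → S-cong (allFin t) (λ i →
               cong₂ ℤ._+_ (e-comm (v i) (x j)) (e-comm (reflect (v i)) (x j)))) ⟩
        cross ∎
        where open ≡-Reasoning

      single : pairSums x N K n ≡ pairSums x K K c ℤ.+ cross
      single = begin
        pairSums x N K n
          ≡⟨ S-cong (upTo N) (λ i → S-cong (upTo K) (λ j → cong δ (shape (x i) (x j) n (+ g)))) ⟩
        S (upTo N) (λ i → G (x i ℤ.+ + g))
          ≡⟨ shift G ⟩
        pairSums x K K c ℤ.+ V G
          ≡⟨ cong (λ s → pairSums x K K c ℤ.+ s) V-G ⟩
        pairSums x K K c ℤ.+ cross ∎
        where
        open ≡-Reasoning
        shape : ∀ a b n g → a ℤ.+ b ℤ.+ + 1 ℤ.- n ≡ a ℤ.+ g ℤ.+ b ℤ.+ + 1 ℤ.- (n ℤ.+ g)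
        shape = solve-∀

      double : pairSums x N N (n ℤ.- + g) ≡ (pairSums x K K c ℤ.+ cross) ℤ.+ (cross ℤ.+ Q)
      double = begin
        pairSums x N N (n ℤ.- + g)
          ≡⟨ S-cong (upTo N) (λ i → S-cong (upTo N) (λ j → cong δ (shape (x i) (x j) n (+ g)))) ⟩
        S (upTo N) (λ i → S (upTo N) (λ j → e (x i ℤ.+ + g) (x j ℤ.+ + g)))
          ≡⟨ S-cong (upTo N) (λ i → shift (e (x i ℤ.+ + g))) ⟩
        S (upTo N) (λ i → G (x i ℤ.+ + g) ℤ.+ H (x i ℤ.+ + g))
          ≡⟨ S-+ (upTo N) _ _ ⟩
        S (upTo N) (λ i → G (x i ℤ.+ + g)) ℤ.+ S (upTo N) (λ i → H (x i ℤ.+ + g))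
          ≡⟨ cong₂ ℤ._+_ (trans (shift G) (cong (λ s → pairSums x K K c ℤ.+ s) V-G)) (shift H) ⟩
        (pairSums x K K c ℤ.+ cross) ℤ.+ (cross ℤ.+ Q) ∎
        where
        open ≡-Reasoning
        shape : ∀ a b n g → a ℤ.+ b ℤ.+ + 1 ℤ.- (n ℤ.- g) ≡ a ℤ.+ g ℤ.+ (b ℤ.+ g) ℤ.+ + 1 ℤ.- (n ℤ.+ g)
        shape = solve-∀

      -- Reflecting both values negates the positive number `v i + v j - g + 1`, which then cannot
      -- equal n > 0.
      both-reflected : ∀ i j → e (reflect (v i)) (reflect (v j)) ≡ 0ℤ
      both-reflected i j = trans (cong δ (shape (v i) (v j) (+ g) n))
        (δ≢ (ℤₚ.<⇒≢ (ℤₚ.<-trans (ℤₚ.neg-mono-< (sum-positive i j)) 0<n)))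
        where
        shape : ∀ a b g n → (g ℤ.- + 1 ℤ.- a) ℤ.+ (g ℤ.- + 1 ℤ.- b) ℤ.+ + 1 ℤ.- (n ℤ.+ g)
                          ≡ ℤ.- (a ℤ.+ b ℤ.- g ℤ.+ + 1) ℤ.- n
        shape = solve-∀

      unreflected : ∀ a b → e a b ≡ δ (a ℤ.+ b ℤ.- + g ℤ.+ + 1 ℤ.- n)
      unreflected a b = cong δ (shape a b (+ g) n)
        where
        shape : ∀ a b g n → a ℤ.+ b ℤ.+ + 1 ℤ.- (n ℤ.+ g) ≡ a ℤ.+ b ℤ.- g ℤ.+ + 1 ℤ.- n
        shape = solve-∀

      half-reflected : ∀ a b → e a (reflect b) ≡ δ (a ℤ.- b ℤ.- n)
      half-reflected a b = cong δ (shape a b (+ g) n)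
        where
        shape : ∀ a b g n → a ℤ.+ (g ℤ.- + 1 ℤ.- b) ℤ.+ + 1 ℤ.- (n ℤ.+ g) ≡ a ℤ.- b ℤ.- n
        shape = solve-∀

      -- Of the four kinds of pairs of new positions, the unreflected one gives `sums`, each mixed
      -- one gives `differences`, and the doubly reflected one gives nothing.
      Q≡ : Q ≡ sums n ℤ.+ (differences n ℤ.+ differences n)
      Q≡ = begin
        Q
          ≡⟨ S-+ (allFin t) (H ∘ v) (H ∘ reflect ∘ v) ⟩
        S (allFin t) (H ∘ v) ℤ.+ S (allFin t) (H ∘ reflect ∘ v)
          ≡⟨ cong₂ ℤ._+_ first second ⟩
        sums n ℤ.+ differences n ℤ.+ differences n
          ≡⟨ ℤₚ.+-assoc (sums n) _ _ ⟩
        sums n ℤ.+ (differences n ℤ.+ differences n) ∎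
        where
        open ≡-Reasoning
        first : S (allFin t) (H ∘ v) ≡ sums n ℤ.+ differences n
        first = trans (S-cong (allFin t) (λ i → trans
            (S-cong (allFin t) (λ j → cong₂ ℤ._+_ (unreflected (v i) (v j)) (half-reflected (v i) (v j))))
            (S-+ (allFin t) _ _)))
          (S-+ (allFin t) _ _)
        second : S (allFin t) (H ∘ reflect ∘ v) ≡ differences n
        second = trans (S-cong (allFin t) (λ i → S-cong (allFin t) (λ j → trans
            (cong₂ ℤ._+_ (trans (e-comm (reflect (v i)) (v j)) (half-reflected (v j) (v i))) (both-reflected i j))
            (ℤₚ.+-identityʳ _))))
          (S-swap (allFin t) (allFin t) _)

      doubles≡ : doubles x N (n ℤ.- + g) ≡ doubles x K c ℤ.+ diagonal n
      doubles≡ = begin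
        doubles x N (n ℤ.- + g)
          ≡⟨ S-cong (upTo N) (λ i → cong δ (shape (x i) n (+ g))) ⟩
        S (upTo N) (λ i → e (x i ℤ.+ + g) (x i ℤ.+ + g))
          ≡⟨ shift (λ z → e z z) ⟩
        doubles x K c ℤ.+ V (λ z → e z z)
          ≡⟨ cong (λ s → doubles x K c ℤ.+ s) (S-cong (allFin t) (λ i →
               trans (cong₂ ℤ._+_ (unreflected (v i) (v i)) (both-reflected i i)) (ℤₚ.+-identityʳ _))) ⟩
        doubles x K c ℤ.+ diagonal n ∎
        where
        open ≡-Reasoning
        shape : ∀ a n g → a ℤ.+ a ℤ.+ + 1 ℤ.- (n ℤ.- g) ≡ a ℤ.+ g ℤ.+ (a ℤ.+ g) ℤ.+ + 1 ℤ.- (n ℤ.+ g)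
        shape = solve-∀

    -- Expanding gives `double` - 2 `single` + O₀ = `Q`. The `diagonal` in `pairCount-double` is the
    -- difference of the two `doubles`. Terms are moved so that every count is added and none
    -- subtracted.
    second-difference :
      pairCount t v n ℤ.+ pairCount t v n
        ℤ.+ (pairSums x (K ℕ.+ g) K n ℤ.+ pairSums x (K ℕ.+ g) K n)
        ℤ.+ doubles x (K ℕ.+ g) (n ℤ.- + g)
      ≡ pairSums x (K ℕ.+ g) (K ℕ.+ g) (n ℤ.- + g)
        ℤ.+ (pairSums x K K (n ℤ.+ + g) ℤ.+ doubles x K (n ℤ.+ + g))
    second-difference = begin
      C ℤ.+ C ℤ.+ (pairSums x N K n ℤ.+ pairSums x N K n) ℤ.+ doubles x N (n ℤ.- + g)
        ≡⟨ cong₂ (λ a b → C ℤ.+ C ℤ.+ (a ℤ.+ a) ℤ.+ b) single doubles≡ ⟩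
      C ℤ.+ C ℤ.+ ((O₀ ℤ.+ cross) ℤ.+ (O₀ ℤ.+ cross)) ℤ.+ (D₀ ℤ.+ diagonal n)
        ≡⟨ rearrange₁ C O₀ cross D₀ (diagonal n) ⟩
      C ℤ.+ C ℤ.+ diagonal n ℤ.+ ((O₀ ℤ.+ cross) ℤ.+ (O₀ ℤ.+ cross) ℤ.+ D₀)
        ≡⟨ cong (ℤ._+ ((O₀ ℤ.+ cross) ℤ.+ (O₀ ℤ.+ cross) ℤ.+ D₀)) (trans (pairCount-double 0<n) (sym Q≡)) ⟩
      Q ℤ.+ ((O₀ ℤ.+ cross) ℤ.+ (O₀ ℤ.+ cross) ℤ.+ D₀)
        ≡⟨ rearrange₂ Q O₀ cross D₀ ⟩
      ((O₀ ℤ.+ cross) ℤ.+ (cross ℤ.+ Q)) ℤ.+ (O₀ ℤ.+ D₀)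
        ≡⟨ cong (ℤ._+ (O₀ ℤ.+ D₀)) double ⟨
      pairSums x N N (n ℤ.- + g) ℤ.+ (O₀ ℤ.+ D₀) ∎
      where
      open ≡-Reasoning
      C O₀ D₀ : ℤ
      C  = pairCount t v n
      O₀ = pairSums x K K c
      D₀ = doubles x K c
      rearrange₁ : ∀ C o x d e → C ℤ.+ C ℤ.+ ((o ℤ.+ x) ℤ.+ (o ℤ.+ x)) ℤ.+ (d ℤ.+ e) ≡
        C ℤ.+ C ℤ.+ e ℤ.+ ((o ℤ.+ x) ℤ.+ (o ℤ.+ x) ℤ.+ d)
      rearrange₁ = solve-∀
      rearrange₂ : ∀ q o x d → q ℤ.+ ((o ℤ.+ x) ℤ.+ (o ℤ.+ x) ℤ.+ d) ≡
        ((o ℤ.+ x) ℤ.+ (x ℤ.+ q)) ℤ.+ (o ℤ.+ d)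
      rearrange₂ = solve-∀

-- For the empty partition the values β are 0, ..., g - 1; these are the t largest of them, g - 1
-- down to t.
v∅ : ∀ t → Fin t → ℤ
v∅ t i = + (2 ℕ.* t) ℤ.- + 1 ℤ.- + toℕ i

v∅-decreasing : ∀ t i j → i Fin.< j → v∅ t j ℤ.< v∅ t i
v∅-decreasing t i j i<j = ℤₚ.+-monoʳ-< (+ (2 ℕ.* t) ℤ.- + 1) (ℤₚ.neg-mono-< (ℤ.+<+ i<j))

t≤v∅ : ∀ t i → + t ℤ.≤ v∅ t i
t≤v∅ t i = ℤₚ.0≤i-j⇒j≤i (subst (0ℤ ℤ.≤_) (shape (+ t) (+ toℕ i)) (ℤₚ.i≤j⇒0≤j-i (ℤ.+≤+ (Finₚ.toℕ<n i))))
  where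
  shape : ∀ t i → t ℤ.- (+ 1 ℤ.+ i) ≡ t ℤ.+ (t ℤ.+ + 0) ℤ.- + 1 ℤ.- i ℤ.- t
  shape = solve-∀

-- The steps -1, -2, ... moved up by g first run through g - 1, ..., 0 and then repeat the original
-- steps. The upper half of the first block consists of the `v∅`, the lower half of their
-- reflections.
∅-shift : ∀ t K (f : ℤ → ℤ) → let g = 2 ℕ.* t in
  S (upTo (K ℕ.+ g)) (λ i → f (vert ∅ i ℤ.+ + g)) ≡
  S (upTo K) (λ i → f (vert ∅ i)) ℤ.+ S (allFin t) (λ i → f (v∅ t i) ℤ.+ f (+ g ℤ.- + 1 ℤ.- v∅ t i))
∅-shift t K f = begin
  S (upTo (K ℕ.+ g)) h
    ≡⟨ cong (λ N → S (upTo N) h) (ℕₚ.+-comm K g) ⟩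
  S (upTo (g ℕ.+ K)) h
    ≡⟨ S-upTo-+ g K h ⟩
  S (upTo g) h ℤ.+ S (upTo K) (λ i → h (g ℕ.+ i))
    ≡⟨ ℤₚ.+-comm (S (upTo g) h) _ ⟩
  S (upTo K) (λ i → h (g ℕ.+ i)) ℤ.+ S (upTo g) h
    ≡⟨ cong₂ ℤ._+_ (S-cong (upTo K) (λ i → cong f (far (+ i) (+ g)))) near ⟩
  S (upTo K) (λ i → f (vert ∅ i)) ℤ.+ S (allFin t) (λ i → f (v∅ t i) ℤ.+ f (+ g ℤ.- + 1 ℤ.- v∅ t i)) ∎
  where
  open ≡-Reasoning
  g : ℕ
  g = 2 ℕ.* t
  h : ℕ → ℤ
  h i = f (vert ∅ i ℤ.+ + g)
  far : ∀ i g → + 0 ℤ.- (+ 1 ℤ.+ (g ℤ.+ i)) ℤ.+ g ≡ + 0 ℤ.- (+ 1 ℤ.+ i)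
  far = solve-∀
  upper : ∀ i g → + 0 ℤ.- (+ 1 ℤ.+ i) ℤ.+ g ≡ g ℤ.- + 1 ℤ.- i
  upper = solve-∀
  lower : ∀ t i → + 0 ℤ.- (+ 1 ℤ.+ (t ℤ.+ i)) ℤ.+ (t ℤ.+ (t ℤ.+ + 0)) ≡ t ℤ.- + 1 ℤ.- i
  lower = solve-∀
  reflected : ∀ g i → g ℤ.- + 1 ℤ.- (g ℤ.- + 1 ℤ.- i) ≡ i
  reflected = solve-∀
  near : S (upTo g) h ≡ S (allFin t) (λ i → f (v∅ t i) ℤ.+ f (+ g ℤ.- + 1 ℤ.- v∅ t i))
  near = begin
    S (upTo (t ℕ.+ (t ℕ.+ 0))) h
      ≡⟨ S-upTo-+ t (t ℕ.+ 0) h ⟩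
    S (upTo t) h ℤ.+ S (upTo (t ℕ.+ 0)) (λ i → h (t ℕ.+ i))
      ≡⟨ cong (λ N → S (upTo t) h ℤ.+ S (upTo N) (λ i → h (t ℕ.+ i))) (ℕₚ.+-identityʳ t) ⟩
    S (upTo t) h ℤ.+ S (upTo t) (λ i → h (t ℕ.+ i))
      -- The lower half appears in decreasing order t - 1, ..., 0, whereas the reflection of
      -- `v∅ t i` is i; hence the reversal.
      ≡⟨ cong (λ s → S (upTo t) h ℤ.+ s) (trans (S-cong (upTo t) (λ i → cong f (lower (+ t) (+ i)))) (S-upTo-reverse t f)) ⟩
    S (upTo t) h ℤ.+ S (upTo t) (f ∘ +_)
      ≡⟨ S-+ (upTo t) h (f ∘ +_) ⟨
    S (upTo t) (λ i → h i ℤ.+ f (+ i))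
      ≡⟨ S-tabulate t id (λ i → cong₂ (λ a b → f a ℤ.+ f b) (sym (upper (+ toℕ i) (+ g))) (reflected (+ g) (+ toℕ i))) ⟨
    S (allFin t) (λ i → f (v∅ t i) ℤ.+ f (+ g ℤ.- + 1 ℤ.- v∅ t i)) ∎

-- Multiplicities of the arguments of τ

double-injective : ∀ {a b} → a ℤ.+ a ≡ b ℤ.+ b → a ≡ b
double-injective {a} {b} eq = ℤₚ.*-cancelˡ-≡ (+ 2) a b (trans (twice a) (trans eq (sym (twice b))))
  where
  twice : ∀ z → + 2 ℤ.* z ≡ z ℤ.+ z
  twice = solve-∀

⟨≟⟩≡δ : ∀ {m n} (d : Dec (m ≡ n)) → ⟨ does d ⟩ (+ 1) ≡ δ (+ m ℤ.- + n)
⟨≟⟩≡δ {m} (yes refl) = cong δ (sym (ℤₚ.+-inverseʳ (+ m)))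
⟨≟⟩≡δ     (no m≢n)   = sym (δ≢ (m≢n ∘ ℤₚ.+-injective))

+α≡up : ∀ g ω i → + α g ω i ≡ up ω (+ (g ℕ.∸ i))
+α≡up g ω i = begin
  + α g ω i
    ≡⟨ S-length (filter P? (boxes ω)) ⟩
  S (filter P? (boxes ω)) (λ _ → + 1)
    ≡⟨ S-filter P? (boxes ω) (λ _ → + 1) ⟩
  S (boxes ω) (λ s → ⟨ does (P? s) ⟩ (+ 1))
    ≡⟨ S-cong (boxes ω) count ⟩
  up ω (+ (g ℕ.∸ i)) ∎
  where
  open ≡-Reasoning
  P? : ∀ s → Dec (hook ω s ≡ g ℕ.∸ i × ε s ≡ + 1)
  P? s = (hook ω s ℕₚ.≟ g ℕ.∸ i) ×-dec (ε s ℤₚ.≟ + 1)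
  guard : ∀ b → does ((if b then -[1+ 0 ] else + 1) ℤₚ.≟ + 1) ≡ not b
  guard true  = refl
  guard false = refl
  ⟨∧⟩ : ∀ a b → ⟨ a ∧ b ⟩ (+ 1) ≡ ⟨ b ⟩ ⟨ a ⟩ (+ 1)
  ⟨∧⟩ true  b     = refl
  ⟨∧⟩ false true  = refl
  ⟨∧⟩ false false = refl
  count : ∀ s → ⟨ does (P? s) ⟩ (+ 1) ≡ ⟨ not (below s) ⟩ δ (+ hook ω s ℤ.- + (g ℕ.∸ i))
  count s = trans (⟨∧⟩ (does (hook ω s ℕₚ.≟ g ℕ.∸ i)) (does (ε s ℤₚ.≟ + 1)))
    (cong₂ ⟨_⟩_ (guard (below s)) (⟨≟⟩≡δ (hook ω s ℕₚ.≟ g ℕ.∸ i)))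

-- Arguments of τ in the product of the powers: `h i` with multiplicity α i for 1 ≤ i ≤ g - 1, where
-- `h i` is i for the denominators and -i for the numerators.
αList : ∀ g → Partition → (ℕ → ℤ) → List ℤ
αList g ω h = concatMap (λ i → replicate (α g ω i) (h i)) (map suc (upTo (g ℕ.∸ 1)))

S-αList : ∀ g ω h f → S (αList g ω h) f ≡ S (upTo (g ℕ.∸ 1)) (λ i → + α g ω (suc i) ℤ.* f (h (suc i)))
S-αList g ω h f = begin
  S (αList g ω h) f
    ≡⟨ S-concatMap (λ i → replicate (α g ω i) (h i)) (map suc (upTo (g ℕ.∸ 1))) f ⟩
  S (map suc (upTo (g ℕ.∸ 1))) (λ i → S (replicate (α g ω i) (h i)) f)
    ≡⟨ S-map suc (upTo (g ℕ.∸ 1)) _ ⟩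
  S (upTo (g ℕ.∸ 1)) (λ i → S (replicate (α g ω (suc i)) (h (suc i))) f)
    ≡⟨ S-cong (upTo (g ℕ.∸ 1)) (λ i → S-replicate (α g ω (suc i)) (h (suc i)) f) ⟩
  S (upTo (g ℕ.∸ 1)) (λ i → + α g ω (suc i) ℤ.* f (h (suc i))) ∎
  where open ≡-Reasoning

module _ (g : ℕ) (ω : Partition) (h : ℕ → ℤ) (h-injective : ∀ {i j} → h i ≡ h j → i ≡ j) where

  private
    summand : ℕ → ℤ → ℤ
    summand n i = + α g ω (suc n) ℤ.* δ (h (suc n) ℤ.- i)

    summand-zero : ∀ {n z} → h (suc n) ≢ z → summand n z ≡ 0ℤ
    summand-zero {n} h≢z = trans (cong (+ α g ω (suc n) ℤ.*_) (δ≢ h≢z)) (ℤₚ.*-zeroʳ (+ α g ω (suc n)))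

  αList-count : ∀ {k} → suc k ℕ.< g → S (αList g ω h) (λ z → δ (z ℤ.- h (suc k))) ≡ up ω (+ (g ℕ.∸ suc k))
  αList-count {k} k<g = begin
    S (αList g ω h) (λ z → δ (z ℤ.- h (suc k)))
      ≡⟨ S-αList g ω h _ ⟩
    S (upTo (g ℕ.∸ 1)) (λ i → summand i (h (suc k)))
      ≡⟨ S-pick (upTo (g ℕ.∸ 1)) (Uniqueₚ.upTo⁺ (g ℕ.∸ 1)) (∈-upTo⁺ (ℕₚ.∸-monoˡ-< k<g (s≤s z≤n)))
           (λ _ i≢k → summand-zero (i≢k ∘ ℕₚ.suc-injective ∘ h-injective)) ⟩
    summand k (h (suc k))
      ≡⟨ cong (λ z → + α g ω (suc k) ℤ.* δ z) (ℤₚ.+-inverseʳ (h (suc k))) ⟩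
    + α g ω (suc k) ℤ.* + 1
      ≡⟨ ℤₚ.*-identityʳ _ ⟩
    + α g ω (suc k)
      ≡⟨ +α≡up g ω (suc k) ⟩
    up ω (+ (g ℕ.∸ suc k)) ∎
    where open ≡-Reasoning

  αList-absent : ∀ {z} → (∀ i → suc i ℕ.< g → h (suc i) ≢ z) → S (αList g ω h) (λ y → δ (y ℤ.- z)) ≡ 0ℤ
  αList-absent absent = trans (S-αList g ω h _) (S-zero (upTo (g ℕ.∸ 1)) (λ {i} i∈ →
    summand-zero (absent i (bound (∈-upTo⁻ i∈)))))
    where
    bound : ∀ {i g} → i ℕ.< g ℕ.∸ 1 → suc i ℕ.< g
    bound {g = suc g} i<g = s≤s i<g

module Counting (t : ℕ) .{{_ : NonZero t}} (ω : Partition) (sc : SelfConjugate ω)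
                (core : IsCore (2 ℕ.* t) ω) (w : Vec ℤ t) (vc : IsVCoding (2 ℕ.* t) t ω w) where

  open SelfConjugatePartition ω sc
  open BoxCounts ω sc
  open RelativeToEmpty ω sc
  open Coding t ω sc core w vc using (g; v; t≤v; S-shift; 0<g)

  private
    module Pω = PairCounts t v (IsVCoding.decreasing vc) t≤v
    module P∅ = PairCounts t (v∅ t) (v∅-decreasing t) (t≤v∅ t)

    -- `K` covers all nonempty rows, and N = K + g leaves the margin that `O-relative` requires for
    -- arguments down to -g.
    K N : ℕ
    K = ℓ ω
    N = K ℕ.+ g

    K≤N : K ℕ.≤ N
    K≤N = ℕₚ.m≤m+n K g

  C Z : ℤ → ℤ
  C = pairCount t v
  Z = pairCount t (v∅ t)

  -- Pair sums without the diagonal, that is, over ordered pairs of distinct indices.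
  excess : (ℕ → ℤ) → ℤ → ℤ
  excess y m = pairSums y N N m ℤ.- doubles y N m

  -- In `second-difference` the sums at n and n + g are counts of boxes. Only n - g may be negative,
  -- and its contribution stays as an `excess`.
  C-double : ∀ k → C (+ suc k) ℤ.+ C (+ suc k) ℤ.+ ((up ω (+ suc k) ℤ.+ lo ω (+ suc k)) ℤ.+ (up ω (+ suc k) ℤ.+ lo ω (+ suc k)))
                 ≡ excess x (+ suc k ℤ.- + g) ℤ.+ (up ω (+ suc k ℤ.+ + g) ℤ.+ up ω (+ suc k ℤ.+ + g))
  C-double k = begin
    C n ℤ.+ C n ℤ.+ ((up ω n ℤ.+ lo ω n) ℤ.+ (up ω n ℤ.+ lo ω n))
      ≡⟨ cong (λ s → C n ℤ.+ C n ℤ.+ (s ℤ.+ s)) (up+lo (suc k) {N} {K} K≤N ℕₚ.≤-refl) ⟩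
    C n ℤ.+ C n ℤ.+ (O N K n ℤ.+ O N K n)
      ≡⟨ isolate _ (D N (n ℤ.- + g)) (O N N (n ℤ.- + g)) _ (Pω.SecondDifference.second-difference x K (S-shift ℕₚ.≤-refl) n (ℤ.+<+ (s≤s z≤n))) ⟩
    excess x (n ℤ.- + g) ℤ.+ (O K K (n ℤ.+ + g) ℤ.+ D K (n ℤ.+ + g))
      ≡⟨ cong (λ s → excess x (n ℤ.- + g) ℤ.+ s) (O+D (suc k ℕ.+ g) ℕₚ.≤-refl) ⟩
    excess x (n ℤ.- + g) ℤ.+ (up ω (n ℤ.+ + g) ℤ.+ up ω (n ℤ.+ + g)) ∎
    where
    open ≡-Reasoning
    n : ℤ
    n = + suc k
    isolate : ∀ a d o s → a ℤ.+ d ≡ o ℤ.+ s → a ≡ o ℤ.- d ℤ.+ s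
    isolate a d o s eq = trans (lemma₁ a d) (trans (cong (ℤ._- d) eq) (lemma₂ o s d))
      where
      lemma₁ : ∀ a d → a ≡ a ℤ.+ d ℤ.- d
      lemma₁ = solve-∀
      lemma₂ : ∀ o s d → o ℤ.+ s ℤ.- d ≡ o ℤ.- d ℤ.+ s
      lemma₂ = solve-∀
    -- Eliminating `lo` between up + lo = O and 2 lo + D = O.
    O+D : ∀ m {M} → ℓ ω ℕ.≤ M → O M M (+ m) ℤ.+ D M (+ m) ≡ up ω (+ m) ℤ.+ up ω (+ m)
    O+D m {M} ℓ≤M = from (up ω (+ m)) (lo ω (+ m)) (D M (+ m)) (O M M (+ m)) (up+lo m ℓ≤M ℓ≤M) (lo+lo+D m ℓ≤M)
      where
      from : ∀ u l d o → u ℤ.+ l ≡ o → l ℤ.+ l ℤ.+ d ≡ o → o ℤ.+ d ≡ u ℤ.+ u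
      from u l d o eq₁ eq₂ = trans (cong (ℤ._+ d) (sym eq₁)) (trans (lemma₁ u l d)
        (trans (cong (λ s → u ℤ.+ (s ℤ.- l)) (trans eq₂ (sym eq₁))) (lemma₂ u l)))
        where
        lemma₁ : ∀ u l d → u ℤ.+ l ℤ.+ d ≡ u ℤ.+ (l ℤ.+ l ℤ.+ d ℤ.- l)
        lemma₁ = solve-∀
        lemma₂ : ∀ u l → u ℤ.+ (u ℤ.+ l ℤ.- l) ≡ u ℤ.+ u
        lemma₂ = solve-∀

  -- The same second difference for the empty partition, whose sums at n and n + g vanish. The
  -- truncations are those used for ω, so that the two excesses are comparable.
  Z-double : ∀ k → Z (+ suc k) ℤ.+ Z (+ suc k) ≡ excess (vert ∅) (+ suc k ℤ.- + g)
  Z-double k = from (Z n ℤ.+ Z n) {doubles (vert ∅) N (n ℤ.- + g)} {pairSums (vert ∅) N N (n ℤ.- + g)}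
    (∅-O (suc k) N K) (∅-O (suc k ℕ.+ g) K K) (∅-D (suc k ℕ.+ g) K)
    (P∅.SecondDifference.second-difference (vert ∅) K (∅-shift t K) n (ℤ.+<+ (s≤s z≤n)))
    where
    n : ℤ
    n = + suc k
    from : ∀ a {d o b c e} → b ≡ 0ℤ → c ≡ 0ℤ → e ≡ 0ℤ → a ℤ.+ (b ℤ.+ b) ℤ.+ d ≡ o ℤ.+ (c ℤ.+ e) → a ≡ o ℤ.- d
    from a {d} {o} refl refl refl eq = trans (lemma₁ a d) (trans (cong (ℤ._- d) eq) (lemma₂ o d))
      where
      lemma₁ : ∀ a d → a ≡ a ℤ.+ + 0 ℤ.+ d ℤ.- d
      lemma₁ = solve-∀
      lemma₂ : ∀ o d → o ℤ.+ + 0 ℤ.- d ≡ o ℤ.- d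
      lemma₂ = solve-∀

  excess-nonneg : ∀ m → excess x (+ m) ≡ lo ω (+ m) ℤ.+ lo ω (+ m)
  excess-nonneg m = trans (cong (ℤ._- D N (+ m)) (sym (lo+lo+D m K≤N))) (cancel (lo ω (+ m)) (D N (+ m)))
    where
    cancel : ∀ l d → l ℤ.+ l ℤ.+ d ℤ.- d ≡ l ℤ.+ l
    cancel = solve-∀

  ∅-excess-nonneg : ∀ m → excess (vert ∅) (+ m) ≡ 0ℤ
  ∅-excess-nonneg m = cong₂ ℤ._-_ (∅-O m N N) (∅-D m N)

  -- `O-relative` and `D-relative` turn O - D at -m into the value for the empty partition plus O +
  -- D at m, and O + D is twice `up`.
  excess-negative : ∀ m → m ℕ.≤ g →
    excess x (ℤ.- + m) ≡ excess (vert ∅) (ℤ.- + m) ℤ.+ (up ω (+ m) ℤ.+ up ω (+ m))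
  excess-negative m m≤g = from (up ω (+ m)) (lo ω (+ m)) (D N (+ m)) (O N N (+ m)) (up+lo m K≤N K≤N) (lo+lo+D m K≤N)
    (O-relative m (ℕₚ.+-monoʳ-≤ K m≤g)) (D-relative m K≤N)
    where
    from : ∀ u l d o {d′ o′ d∅ o∅} → u ℤ.+ l ≡ o → l ℤ.+ l ℤ.+ d ≡ o → o′ ≡ o ℤ.+ o∅ → d ℤ.+ d′ ≡ d∅ →
           o′ ℤ.- d′ ≡ o∅ ℤ.- d∅ ℤ.+ (u ℤ.+ u)
    from u l d o {d′} {o∅ = o∅} refl eq refl refl = trans (lemma₁ u l d′ o∅)
      (trans (cong (λ s → u ℤ.+ l ℤ.+ (u ℤ.+ l) ℤ.- s ℤ.+ o∅ ℤ.- d′) (sym eq)) (lemma₂ u l d d′ o∅))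
      where
      lemma₁ : ∀ u l d′ o∅ → u ℤ.+ l ℤ.+ o∅ ℤ.- d′ ≡ u ℤ.+ l ℤ.+ (u ℤ.+ l) ℤ.- (u ℤ.+ l) ℤ.+ o∅ ℤ.- d′
      lemma₁ = solve-∀
      lemma₂ : ∀ u l d d′ o∅ → u ℤ.+ l ℤ.+ (u ℤ.+ l) ℤ.- (l ℤ.+ l ℤ.+ d) ℤ.+ o∅ ℤ.- d′ ≡ o∅ ℤ.- (d ℤ.+ d′) ℤ.+ (u ℤ.+ u)
      lemma₂ = solve-∀

  A⁺ A⁻ : ℤ → ℤ
  A⁺ n = S (αList g ω +_) (λ z → δ (z ℤ.- n))
  A⁻ n = S (αList g ω (λ i → ℤ.- + i)) (λ z → δ (z ℤ.- n))

  up-g : up ω (+ g) ≡ 0ℤ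
  up-g = S-zero (boxes ω) (λ {s} s∈ → trans
    (cong (⟨ not (below s) ⟩_) (δ≢ (λ eq → core s s∈ (subst (g ∣_) (sym (ℤₚ.+-injective eq)) ∣-refl))))
    (⟨⟩-zero (not (below s))))

  A⁺-nonpositive : ∀ {n} → n ℤ.≤ 0ℤ → A⁺ n ≡ 0ℤ
  A⁺-nonpositive n≤0 = αList-absent g ω +_ ℤₚ.+-injective
    (λ i _ → ≢-sym (ℤₚ.<⇒≢ (ℤₚ.≤-<-trans n≤0 (ℤ.+<+ (s≤s z≤n)))))

  A⁻-nonnegative : ∀ {n} → 0ℤ ℤ.≤ n → A⁻ n ≡ 0ℤ
  A⁻-nonnegative 0≤n = αList-absent g ω (λ i → ℤ.- + i) (ℤₚ.+-injective ∘ ℤₚ.neg-injective)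
    (λ i _ → ℤₚ.<⇒≢ (ℤₚ.<-≤-trans ℤ.-<+ 0≤n))

  -- The multiplicities of n on the two sides of the cross-multiplied product formula. A shifted
  -- argument n comes from a hook length n + g when ε = 1 and n - g when ε = -1.
  Balanced : ℤ → Set
  Balanced n = (up ω (n ℤ.+ + g) ℤ.+ lo ω (n ℤ.- + g)) ℤ.+ (A⁺ n ℤ.+ Z n)
             ≡ (A⁻ n ℤ.+ C n) ℤ.+ (up ω n ℤ.+ lo ω n)

  -- Hook lengths, pair factors and the positive indices of the α product contribute nothing at n ≤
  -- 0; only the boxes with ε = 1 shifted down by g face `A⁻`.
  balanced-nonpositive : ∀ n → n ℤ.≤ 0ℤ → up ω (n ℤ.+ + g) ≡ A⁻ n → Balanced n
  balanced-nonpositive n n≤0 eq = begin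
    (up ω (n ℤ.+ + g) ℤ.+ lo ω (n ℤ.- + g)) ℤ.+ (A⁺ n ℤ.+ Z n)
      ≡⟨ cong₂ ℤ._+_ (cong₂ ℤ._+_ eq (lo-nonpositive n-g≤0))
           (cong₂ ℤ._+_ (A⁺-nonpositive n≤0) (P∅.pairCount-nonpositive n≤0)) ⟩
    (A⁻ n ℤ.+ 0ℤ) ℤ.+ (0ℤ ℤ.+ 0ℤ)
      ≡⟨ cong₂ (λ a b → (A⁻ n ℤ.+ a) ℤ.+ b) (Pω.pairCount-nonpositive n≤0)
           (cong₂ ℤ._+_ (up-nonpositive n≤0) (lo-nonpositive n≤0)) ⟨
    (A⁻ n ℤ.+ C n) ℤ.+ (up ω n ℤ.+ lo ω n) ∎
    where
    open ≡-Reasoning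
    n-g≤0 : n ℤ.- + g ℤ.≤ 0ℤ
    n-g≤0 = ℤₚ.≤-trans (ℤₚ.i-j≤i n (+ g)) n≤0

  -- With i = k + 1, both sides equal α i when i < g, and both vanish from i = g on.
  balanced-negative : ∀ k → up ω (-[1+ k ] ℤ.+ + g) ≡ A⁻ -[1+ k ]
  balanced-negative k = from (suc k ℕₚ.<? g)
    where
    from : Dec (suc k ℕ.< g) → up ω (-[1+ k ] ℤ.+ + g) ≡ A⁻ -[1+ k ]
    from (yes k<g) = trans (cong (up ω) (ℤₚ.⊖-≥ (ℕₚ.<⇒≤ k<g)))
      (sym (αList-count g ω (λ i → ℤ.- + i) (ℤₚ.+-injective ∘ ℤₚ.neg-injective) k<g))
    from (no k≮g) = trans (up-nonpositive (subst (ℤ._≤ 0ℤ) (ℤₚ.-m+n≡n⊖m (suc k) g)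
        (subst (ℤ._≤ 0ℤ) (ℤₚ.+-comm (+ g) -[1+ k ]) (ℤₚ.i≤j⇒i-j≤0 (ℤ.+≤+ (ℕₚ.≮⇒≥ k≮g))))))
      (sym (αList-absent g ω (λ i → ℤ.- + i) (ℤₚ.+-injective ∘ ℤₚ.neg-injective)
        (λ i i<g eq → ℕₚ.<⇒≢ (ℕₚ.<-≤-trans i<g (ℕₚ.≮⇒≥ k≮g)) (ℤₚ.+-injective (ℤₚ.neg-injective eq)))))

  -- Counts of pairs are known only doubled, so the doubled equation is proved and then halved. It
  -- compares the excesses of ω and of the empty partition at n - g. For n < g they differ by twice
  -- α n, for n ≥ g by twice `lo` at n - g.
  balanced-positive : ∀ k → Balanced (+ suc k)
  balanced-positive k = double-injective (trans (doubled (suc k ℕₚ.<? g)) (sym rhs))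
    where
    open ≡-Reasoning
    n : ℤ
    n = + suc k
    u u′ l′ a : ℤ
    u  = up ω n ℤ.+ lo ω n
    u′ = up ω (n ℤ.+ + g)
    l′ = lo ω (n ℤ.- + g)
    a  = A⁺ n
    target : ℤ
    target = excess x (n ℤ.- + g) ℤ.+ (u′ ℤ.+ u′)

    rhs : (A⁻ n ℤ.+ C n ℤ.+ u) ℤ.+ (A⁻ n ℤ.+ C n ℤ.+ u) ≡ target
    rhs = trans (cong (λ s → (s ℤ.+ C n ℤ.+ u) ℤ.+ (s ℤ.+ C n ℤ.+ u)) (A⁻-nonnegative (ℤ.+≤+ z≤n)))
      (trans (lemma (C n) u) (C-double k))
      where
      lemma : ∀ c u → (+ 0 ℤ.+ c ℤ.+ u) ℤ.+ (+ 0 ℤ.+ c ℤ.+ u) ≡ c ℤ.+ c ℤ.+ (u ℤ.+ u)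
      lemma = solve-∀

    regroup : ∀ u l a z → (u ℤ.+ l ℤ.+ (a ℤ.+ z)) ℤ.+ (u ℤ.+ l ℤ.+ (a ℤ.+ z)) ≡
      ((z ℤ.+ z) ℤ.+ (l ℤ.+ l) ℤ.+ (a ℤ.+ a)) ℤ.+ (u ℤ.+ u)
    regroup = solve-∀

    doubled : Dec (suc k ℕ.< g) → (u′ ℤ.+ l′ ℤ.+ (a ℤ.+ Z n)) ℤ.+ (u′ ℤ.+ l′ ℤ.+ (a ℤ.+ Z n)) ≡ target
    doubled d = trans (regroup u′ l′ a (Z n)) (cong (ℤ._+ (u′ ℤ.+ u′)) (trans
      (cong (λ z → z ℤ.+ (l′ ℤ.+ l′) ℤ.+ (a ℤ.+ a)) (Z-double k)) (total d)))
      where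
      total : Dec (suc k ℕ.< g) →
        excess (vert ∅) (n ℤ.- + g) ℤ.+ (l′ ℤ.+ l′) ℤ.+ (a ℤ.+ a) ≡ excess x (n ℤ.- + g)
      total (yes k<g) = begin
        excess (vert ∅) (n ℤ.- + g) ℤ.+ (l′ ℤ.+ l′) ℤ.+ (a ℤ.+ a)
          ≡⟨ cong₂ (λ s b → excess (vert ∅) (n ℤ.- + g) ℤ.+ (s ℤ.+ s) ℤ.+ (b ℤ.+ b))
               (lo-nonpositive (ℤₚ.i≤j⇒i-j≤0 (ℤ.+≤+ (ℕₚ.<⇒≤ k<g))))
               (αList-count g ω +_ ℤₚ.+-injective k<g) ⟩
        excess (vert ∅) (n ℤ.- + g) ℤ.+ 0ℤ ℤ.+ (up ω (+ m) ℤ.+ up ω (+ m))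
          ≡⟨ cong₂ ℤ._+_ (trans (ℤₚ.+-identityʳ _) (cong (excess (vert ∅)) n-g≡-m)) refl ⟩
        excess (vert ∅) (ℤ.- + m) ℤ.+ (up ω (+ m) ℤ.+ up ω (+ m))
          ≡⟨ excess-negative m (ℕₚ.m∸n≤m g (suc k)) ⟨
        excess x (ℤ.- + m)
          ≡⟨ cong (excess x) n-g≡-m ⟨
        excess x (n ℤ.- + g) ∎
        where
        m : ℕ
        m = g ℕ.∸ suc k
        n-g≡-m : n ℤ.- + g ≡ ℤ.- + m
        n-g≡-m = trans (ℤₚ.m-n≡m⊖n (suc k) g) (ℤₚ.⊖-≤ (ℕₚ.<⇒≤ k<g))
      total (no k≮g) = begin
        excess (vert ∅) (n ℤ.- + g) ℤ.+ (l′ ℤ.+ l′) ℤ.+ (a ℤ.+ a)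
          ≡⟨ cong₂ (λ s b → s ℤ.+ (l′ ℤ.+ l′) ℤ.+ (b ℤ.+ b))
               (trans (cong (excess (vert ∅)) n-g≡m) (∅-excess-nonneg m))
               (αList-absent g ω +_ ℤₚ.+-injective (λ i i<g eq →
                 ℕₚ.<⇒≢ (ℕₚ.<-≤-trans i<g g≤k) (ℤₚ.+-injective eq))) ⟩
        0ℤ ℤ.+ (l′ ℤ.+ l′) ℤ.+ (0ℤ ℤ.+ 0ℤ)
          ≡⟨ trans (ℤₚ.+-identityʳ _) (ℤₚ.+-identityˡ _) ⟩
        l′ ℤ.+ l′
          ≡⟨ cong (λ z → lo ω z ℤ.+ lo ω z) n-g≡m ⟩
        lo ω (+ m) ℤ.+ lo ω (+ m)
          ≡⟨ excess-nonneg m ⟨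
        excess x (+ m)
          ≡⟨ cong (excess x) n-g≡m ⟨
        excess x (n ℤ.- + g) ∎
        where
        m : ℕ
        m = suc k ℕ.∸ g
        g≤k : g ℕ.≤ suc k
        g≤k = ℕₚ.≮⇒≥ k≮g
        n-g≡m : n ℤ.- + g ≡ + m
        n-g≡m = trans (ℤₚ.m-n≡m⊖n (suc k) g) (ℤₚ.⊖-≥ g≤k)

  balanced : ∀ n → Balanced n
  balanced -[1+ k ]  = balanced-nonpositive -[1+ k ] ℤ.-≤+ (balanced-negative k)
  -- At n = 0 the boxes concerned have hook length g, and a g-core has none.
  balanced (+ zero)  = balanced-nonpositive 0ℤ ℤₚ.≤-refl (trans up-g (sym (A⁻-nonnegative ℤₚ.≤-refl)))
  balanced (+ suc k) = balanced-positive k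

-- Products in the field

count : ℤ → List ℤ → ℤ
count n xs = S xs (λ z → δ (z ℤ.- n))

count-head : ∀ x xs → count x (x ∷ xs) ≢ 0ℤ
count-head x xs eq = ℤₚ.<⇒≢ 0<count (sym eq)
  where
  0<count : 0ℤ ℤ.< count x (x ∷ xs)
  0<count = subst (λ s → 0ℤ ℤ.< δ s ℤ.+ count x xs) (sym (ℤₚ.+-inverseʳ x))
    (ℤₚ.+-mono-<-≤ {0ℤ} {+ 1} (ℤ.+<+ (s≤s z≤n)) (S-nonneg xs (λ z → δ-nonneg (z ℤ.- x))))

-- The head of `xs` has positive multiplicity, hence occurs in `ys`; removing it from both lists
-- keeps all multiplicities equal.
count⇒↭ : ∀ xs ys → (∀ n → count n xs ≡ count n ys) → xs ↭ ys
count⇒↭ []       []       eq = ↭-refl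
count⇒↭ []       (y ∷ ys) eq = contradiction (sym (eq y)) (count-head y ys)
count⇒↭ (x ∷ xs) ys       eq with x ∈? ys
... | no  x∉ys = contradiction
  (trans (eq x) (S-zero ys (λ z∈ → δ≢ (λ z≡x → x∉ys (subst (_∈ ys) z≡x z∈))))) (count-head x xs)
... | yes x∈ys with as , bs , refl ← ∈-∃++ x∈ys =
  ↭-trans (prep x (count⇒↭ xs (as ++ bs) rest)) (↭-sym move)
  where
  move : as ++ x ∷ bs ↭ x ∷ as ++ bs
  move = Permₚ.shift x as bs
  rest : ∀ n → count n xs ≡ count n (as ++ bs)
  rest n = ℤ+.∙-cancelˡ (δ (x ℤ.- n)) _ _ (trans (eq n) (S-↭ (λ z → δ (z ℤ.- n)) move))

module Products {c ℓ₁ ℓ₂} (F : HeytingField c ℓ₁ ℓ₂) (τ : ℤ → FieldOps.F^× F) where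

  open FieldOps F
  open HeytingField F using (Carrier; 1#; heytingCommutativeRing)
  private
    module R = CommutativeRing (HeytingCommutativeRing.commutativeRing heytingCommutativeRing)
  open Algebra.Properties.CommutativeSemigroup R.*-commutativeSemigroup using (x∙yz≈y∙xz) renaming (interchange to *-interchange)
  open Relation.Binary.Reasoning.Setoid R.setoid

  ∏-cong : ∀ {a} {A : Set a} xs {f h : A → Carrier} → (∀ x → f x ≈ h x) → ∏ xs f ≈ ∏ xs h
  ∏-cong []       f≗h = R.refl
  ∏-cong (x ∷ xs) f≗h = R.*-cong (f≗h x) (∏-cong xs f≗h)

  ∏-++ : ∀ {a} {A : Set a} xs ys (f : A → Carrier) → ∏ (xs ++ ys) f ≈ ∏ xs f * ∏ ys f
  ∏-++ []       ys f = R.sym (R.*-identityˡ _)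
  ∏-++ (x ∷ xs) ys f = R.trans (R.*-congˡ (∏-++ xs ys f)) (R.sym (R.*-assoc (f x) (∏ xs f) (∏ ys f)))

  ∏-* : ∀ {a} {A : Set a} xs (f h : A → Carrier) → ∏ xs (λ x → f x * h x) ≈ ∏ xs f * ∏ xs h
  ∏-* []       f h = R.sym (R.*-identityˡ 1#)
  ∏-* (x ∷ xs) f h = R.trans (R.*-congˡ (∏-* xs f h)) (*-interchange (f x) (h x) (∏ xs f) (∏ xs h))

  ∏-map : ∀ {a b} {A : Set a} {B : Set b} (k : A → B) xs (f : B → Carrier) →
          ∏ (map k xs) f ≈ ∏ xs (f ∘ k)
  ∏-map k []       f = R.refl
  ∏-map k (x ∷ xs) f = R.*-congˡ (∏-map k xs f)

  ∏-concatMap : ∀ {a b} {A : Set a} {B : Set b} (k : A → List B) xs (f : B → Carrier) →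
                ∏ (concatMap k xs) f ≈ ∏ xs (λ x → ∏ (k x) f)
  ∏-concatMap k []       f = R.refl
  ∏-concatMap k (x ∷ xs) f =
    R.trans (∏-++ (k x) (concatMap k xs) f) (R.*-congˡ (∏-concatMap k xs f))

  ∏-↭ : ∀ {a} {A : Set a} {xs ys : List A} (f : A → Carrier) → xs ↭ ys → ∏ xs f ≈ ∏ ys f
  ∏-↭ f Perm.refl       = R.refl
  ∏-↭ f (prep x p)      = R.*-congˡ (∏-↭ f p)
  ∏-↭ f (swap x y p)    = R.trans (x∙yz≈y∙xz (f x) (f y) _) (R.*-congˡ (R.*-congˡ (∏-↭ f p)))
  ∏-↭ f (Perm.trans p q) = R.trans (∏-↭ f p) (∏-↭ f q)

  ∏-one : ∀ {a} {A : Set a} xs {f : A → Carrier} → (∀ x → f x ≈ 1#) → ∏ xs f ≈ 1#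
  ∏-one []       f≗1 = R.refl
  ∏-one (x ∷ xs) f≗1 = R.trans (R.*-cong (f≗1 x) (∏-one xs f≗1)) (R.*-identityˡ 1#)

  τ⁻¹ : ℤ → Carrier
  τ⁻¹ z = proj₁ (invertible (τ z))

  num den : List ℤ → Carrier
  num xs = ∏ xs (proj₁ ∘ τ)
  den xs = ∏ xs τ⁻¹

  num*den : ∀ xs → num xs * den xs ≈ 1#
  num*den xs = R.trans (R.sym (∏-* xs (proj₁ ∘ τ) τ⁻¹)) (∏-one xs (λ z → proj₂ (proj₂ (invertible (τ z)))))

  -- Equality of two fractions from the equality of cross products. The missing factors are supplied
  -- by writing 1 as `num * den` of the same list.
  cross-multiply : ∀ xs ys xs′ ys′ → xs ++ ys′ ↭ xs′ ++ ys → num xs * den ys ≈ num xs′ * den ys′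
  cross-multiply xs ys xs′ ys′ p = begin
    num xs * den ys
      ≈⟨ R.*-identityʳ _ ⟨
    num xs * den ys * 1#
      ≈⟨ R.*-congˡ (num*den ys′) ⟨
    num xs * den ys * (num ys′ * den ys′)
      ≈⟨ *-interchange (num xs) (den ys) (num ys′) (den ys′) ⟩
    num xs * num ys′ * (den ys * den ys′)
      ≈⟨ R.*-congʳ (∏-++ xs ys′ (proj₁ ∘ τ)) ⟨
    num (xs ++ ys′) * (den ys * den ys′)
      ≈⟨ R.*-congʳ (∏-↭ (proj₁ ∘ τ) p) ⟩
    num (xs′ ++ ys) * (den ys * den ys′)
      ≈⟨ R.*-cong (∏-++ xs′ ys (proj₁ ∘ τ)) (R.*-comm (den ys) (den ys′)) ⟩
    num xs′ * num ys * (den ys′ * den ys)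
      ≈⟨ *-interchange (num xs′) (num ys) (den ys′) (den ys) ⟩
    num xs′ * den ys′ * (num ys * den ys)
      ≈⟨ R.*-congˡ (num*den ys) ⟩
    num xs′ * den ys′ * 1#
      ≈⟨ R.*-identityʳ _ ⟩
    num xs′ * den ys′ ∎

  quotient-^ : ∀ n a b → (τ a ÷ τ b) ^ n ≈ num (replicate n a) * den (replicate n b)
  quotient-^ zero    a b = R.sym (R.*-identityˡ 1#)
  quotient-^ (suc n) a b = R.trans (R.*-congˡ (quotient-^ n a b))
    (*-interchange (proj₁ (τ a)) (τ⁻¹ b) (num (replicate n a)) (den (replicate n b)))

module CoreProduct (t : ℕ) .{{_ : NonZero t}} (ω : Partition) (sc : SelfConjugate ω)
                   (core : IsCore (2 ℕ.* t) ω) (w : Vec ℤ t) (vc : IsVCoding (2 ℕ.* t) t ω w) where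

  open Counting t ω sc core w vc
  open Coding t ω sc core w vc using (g; v)

  shifted hooks : List ℤ
  shifted = map (λ s → + hook ω s ℤ.- ε s ℤ.* + g) (boxes ω)
  hooks   = map (λ s → + hook ω s) (boxes ω)

  pairList : (Fin t → ℤ) → List ℤ
  pairList u = concatMap (pairValues t u) (pairs t)

  α⁺ α⁻ : List ℤ
  α⁺ = αList g ω +_
  α⁻ = αList g ω (λ i → ℤ.- + i)

  count-hooks : ∀ n → count n hooks ≡ up ω n ℤ.+ lo ω n
  count-hooks n = trans (S-map (λ s → + hook ω s) (boxes ω) _) (trans
    (S-cong (boxes ω) (λ s → sym (⟨⟩-not (below s) (δ (+ hook ω s ℤ.- n)))))
    (S-+ (boxes ω) _ _))

  count-shifted : ∀ n → count n shifted ≡ up ω (n ℤ.+ + g) ℤ.+ lo ω (n ℤ.- + g)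
  count-shifted n = trans (S-map (λ s → + hook ω s ℤ.- ε s ℤ.* + g) (boxes ω) _) (trans
    (S-cong (boxes ω) (λ s → by-side (+ hook ω s) (below s)))
    (S-+ (boxes ω) _ _))
    where
    by-side : ∀ h b → δ (h ℤ.- (if b then -[1+ 0 ] else + 1) ℤ.* + g ℤ.- n) ≡
              ⟨ not b ⟩ δ (h ℤ.- (n ℤ.+ + g)) ℤ.+ ⟨ b ⟩ δ (h ℤ.- (n ℤ.- + g))
    by-side h true  = trans (cong δ (shape h (+ g) n)) (sym (ℤₚ.+-identityˡ _))
      where
      shape : ∀ h g n → h ℤ.- -[1+ 0 ] ℤ.* g ℤ.- n ≡ h ℤ.- (n ℤ.- g)
      shape = solve-∀
    by-side h false = trans (cong δ (shape h (+ g) n)) (sym (ℤₚ.+-identityʳ _))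
      where
      shape : ∀ h g n → h ℤ.- + 1 ℤ.* g ℤ.- n ≡ h ℤ.- (n ℤ.+ g)
      shape = solve-∀

  count-pairList : ∀ u n → count n (pairList u) ≡ pairCount t u n
  count-pairList u n = S-concatMap (pairValues t u) (pairs t) _

  balanced-↭ : shifted ++ (α⁺ ++ pairList (v∅ t)) ↭ (α⁻ ++ pairList v) ++ hooks
  balanced-↭ = count⇒↭ _ _ λ n → begin
    count n (shifted ++ (α⁺ ++ pairList (v∅ t)))
      ≡⟨ trans (S-++ shifted _ _) (cong₂ ℤ._+_ (count-shifted n)
           (trans (S-++ α⁺ _ _) (cong (λ s → A⁺ n ℤ.+ s) (count-pairList (v∅ t) n)))) ⟩
    (up ω (n ℤ.+ + g) ℤ.+ lo ω (n ℤ.- + g)) ℤ.+ (A⁺ n ℤ.+ Z n)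
      ≡⟨ balanced n ⟩
    (A⁻ n ℤ.+ C n) ℤ.+ (up ω n ℤ.+ lo ω n)
      ≡⟨ trans (S-++ (α⁻ ++ pairList v) _ _) (cong₂ ℤ._+_
           (trans (S-++ α⁻ _ _) (cong (λ s → A⁻ n ℤ.+ s) (count-pairList v n))) (count-hooks n)) ⟨
    count n ((α⁻ ++ pairList v) ++ hooks) ∎
    where open ≡-Reasoning

  product-formula : ∀ {c ℓ₁ ℓ₂} (F : HeytingField c ℓ₁ ℓ₂) →
    let open FieldOps F in
    (τ : ℤ → F^×) →
    ∏ (boxes ω) (λ s → τ (+ hook ω s ℤ.- ε s ℤ.* + g) ÷ τ (+ hook ω s))
    ≈
    ∏ (map suc (upTo (g ℕ.∸ 1))) (λ i → (τ (ℤ.- + i) ÷ τ (+ i)) ^ α g ω i)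
      * ∏ (pairs t) (λ (i , j) →
          τ (r-diff g w i j) ÷ τ (idx j ℤ.- idx i)
          * (τ (r-sum g w i j) ÷ τ (+ g ℤ.+ + 1 ℤ.- idx i ℤ.- idx j)))
  product-formula F τ = begin
    ∏ (boxes ω) (λ s → τ (+ hook ω s ℤ.- ε s ℤ.* + g) ÷ τ (+ hook ω s))
      ≈⟨ ∏-* (boxes ω) _ _ ⟩
    ∏ (boxes ω) (λ s → proj₁ (τ (+ hook ω s ℤ.- ε s ℤ.* + g))) * ∏ (boxes ω) (λ s → τ⁻¹ (+ hook ω s))
      ≈⟨ R.*-cong (∏-map _ (boxes ω) (proj₁ ∘ τ)) (∏-map _ (boxes ω) τ⁻¹) ⟨
    num shifted * den hooks
      ≈⟨ cross-multiply shifted hooks (α⁻ ++ pairList v) (α⁺ ++ pairList (v∅ t)) balanced-↭ ⟩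
    num (α⁻ ++ pairList v) * den (α⁺ ++ pairList (v∅ t))
      ≈⟨ R.*-cong (∏-++ α⁻ (pairList v) _) (∏-++ α⁺ (pairList (v∅ t)) _) ⟩
    num α⁻ * num (pairList v) * (den α⁺ * den (pairList (v∅ t)))
      ≈⟨ *-interchange _ _ _ _ ⟩
    num α⁻ * den α⁺ * (num (pairList v) * den (pairList (v∅ t)))
      ≈⟨ R.*-cong α-part pair-part ⟨
    ∏ (map suc (upTo (g ℕ.∸ 1))) (λ i → (τ (ℤ.- + i) ÷ τ (+ i)) ^ α g ω i)
      * ∏ (pairs t) (λ (i , j) →
          τ (r-diff g w i j) ÷ τ (idx j ℤ.- idx i)
          * (τ (r-sum g w i j) ÷ τ (+ g ℤ.+ + 1 ℤ.- idx i ℤ.- idx j))) ∎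
    where
    open FieldOps F
    open Products F τ
    open HeytingField F using (heytingCommutativeRing)
    module R = CommutativeRing (HeytingCommutativeRing.commutativeRing heytingCommutativeRing)
    open Algebra.Properties.CommutativeSemigroup R.*-commutativeSemigroup using () renaming (interchange to *-interchange)
    open Relation.Binary.Reasoning.Setoid R.setoid

    is : List ℕ
    is = map suc (upTo (g ℕ.∸ 1))

    α-part : ∏ is (λ i → (τ (ℤ.- + i) ÷ τ (+ i)) ^ α g ω i) ≈ num α⁻ * den α⁺
    α-part = R.trans (∏-cong is (λ i → quotient-^ (α g ω i) (ℤ.- + i) (+ i))) (R.trans
      (∏-* is (λ i → num (replicate (α g ω i) (ℤ.- + i))) (λ i → den (replicate (α g ω i) (+ i))))
      (R.sym (R.*-cong (∏-concatMap (λ i → replicate (α g ω i) (ℤ.- + i)) is (proj₁ ∘ τ))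
                       (∏-concatMap (λ i → replicate (α g ω i) (+ i)) is τ⁻¹))))

    difference≡ : ∀ i j → idx j ℤ.- idx i ≡ v∅ t i ℤ.- v∅ t j
    difference≡ i j = shape (+ g) (+ toℕ i) (+ toℕ j)
      where
      shape : ∀ g i j → (+ 1 ℤ.+ j) ℤ.- (+ 1 ℤ.+ i) ≡ (g ℤ.- + 1 ℤ.- i) ℤ.- (g ℤ.- + 1 ℤ.- j)
      shape = solve-∀

    sum≡ : ∀ i j → + g ℤ.+ + 1 ℤ.- idx i ℤ.- idx j ≡ v∅ t i ℤ.+ v∅ t j ℤ.- + g ℤ.+ + 1
    sum≡ i j = shape (+ g) (+ toℕ i) (+ toℕ j)
      where
      shape : ∀ g i j → g ℤ.+ + 1 ℤ.- (+ 1 ℤ.+ i) ℤ.- (+ 1 ℤ.+ j) ≡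
        (g ℤ.- + 1 ℤ.- i) ℤ.+ (g ℤ.- + 1 ℤ.- j) ℤ.- g ℤ.+ + 1
      shape = solve-∀

    pair-factor : ∀ i j →
      τ (r-diff g w i j) ÷ τ (idx j ℤ.- idx i) * (τ (r-sum g w i j) ÷ τ (+ g ℤ.+ + 1 ℤ.- idx i ℤ.- idx j))
      ≈ num (pairValues t v (i , j)) * den (pairValues t (v∅ t) (i , j))
    -- `r-diff` and `r-sum` compute to the two entries of `pairValues t v (i , j)`, so only the
    -- denominators have to be rewritten.
    pair-factor i j = R.trans
      (R.reflexive (cong₂ (λ a b → τ (r-diff g w i j) ÷ τ a * (τ (r-sum g w i j) ÷ τ b))
        (difference≡ i j) (sum≡ i j)))
      (R.trans (*-interchange _ _ _ _)
        (R.sym (R.*-cong (R.*-congˡ (R.*-identityʳ _)) (R.*-congˡ (R.*-identityʳ _)))))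

    pair-part : _ ≈ num (pairList v) * den (pairList (v∅ t))
    pair-part = R.trans (∏-cong (pairs t) (λ (i , j) → pair-factor i j)) (R.trans
      (∏-* (pairs t) (λ p → num (pairValues t v p)) (λ p → den (pairValues t (v∅ t) p)))
      (R.sym (R.*-cong (∏-concatMap (pairValues t v) (pairs t) (proj₁ ∘ τ))
                       (∏-concatMap (pairValues t (v∅ t)) (pairs t) τ⁻¹))))

-- The size of a core

+-sum : ∀ xs → + sum xs ≡ S (upTo (length xs)) (λ i → + at xs i)
+-sum []       = refl
+-sum (x ∷ xs) = trans (cong (λ s → + x ℤ.+ s) (+-sum xs)) (sym (S-upTo-head (length xs) (λ i → + at (x ∷ xs) i)))

-- Multiplied by 3, so that no division is needed.
S-squares : ∀ c n → + 3 ℤ.* S (upTo n) (λ i → (c ℤ.- + i ℤ.- + i) ℤ.* (c ℤ.- + i ℤ.- + i)) ≡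
  + 3 ℤ.* + n ℤ.* c ℤ.* c ℤ.- + 6 ℤ.* c ℤ.* + n ℤ.* (+ n ℤ.- + 1)
    ℤ.+ + 2 ℤ.* + n ℤ.* (+ n ℤ.- + 1) ℤ.* (+ 2 ℤ.* + n ℤ.- + 1)
S-squares c zero    = base c
  where
  base : ∀ c → + 0 ≡ + 3 ℤ.* + 0 ℤ.* c ℤ.* c ℤ.- + 6 ℤ.* c ℤ.* + 0 ℤ.* (+ 0 ℤ.- + 1)
    ℤ.+ + 2 ℤ.* + 0 ℤ.* (+ 0 ℤ.- + 1) ℤ.* (+ 2 ℤ.* + 0 ℤ.- + 1)
  base = solve-∀
S-squares c (suc n) = trans (cong (+ 3 ℤ.*_) (S-upTo-suc n f))
  (trans (ℤₚ.*-distribˡ-+ (+ 3) (S (upTo n) f) (f n)) (trans (cong (ℤ._+ + 3 ℤ.* f n) (S-squares c n)) (step c (+ n))))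
  where
  f : ℕ → ℤ
  f i = (c ℤ.- + i ℤ.- + i) ℤ.* (c ℤ.- + i ℤ.- + i)
  step : ∀ c n →
    + 3 ℤ.* n ℤ.* c ℤ.* c ℤ.- + 6 ℤ.* c ℤ.* n ℤ.* (n ℤ.- + 1)
      ℤ.+ + 2 ℤ.* n ℤ.* (n ℤ.- + 1) ℤ.* (+ 2 ℤ.* n ℤ.- + 1)
      ℤ.+ + 3 ℤ.* ((c ℤ.- n ℤ.- n) ℤ.* (c ℤ.- n ℤ.- n))
    ≡ + 3 ℤ.* (+ 1 ℤ.+ n) ℤ.* c ℤ.* c ℤ.- + 6 ℤ.* c ℤ.* (+ 1 ℤ.+ n) ℤ.* (+ 1 ℤ.+ n ℤ.- + 1)
      ℤ.+ + 2 ℤ.* (+ 1 ℤ.+ n) ℤ.* (+ 1 ℤ.+ n ℤ.- + 1) ℤ.* (+ 2 ℤ.* (+ 1 ℤ.+ n) ℤ.- + 1)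
  step = solve-∀

-- The square of 2 y - g + 1, that is (2 r)² for r = y - g / 2 + 1 / 2.
square : ℕ → ℤ → ℤ
square g y = (y ℤ.+ y ℤ.- + g ℤ.+ + 1) ℤ.* (y ℤ.+ y ℤ.- + g ℤ.+ + 1)

module _ (t : ℕ) where

  private
    g : ℕ
    g = 2 ℕ.* t

  -- The shift identity for square, in which only the linear terms in x survive.
  module SquareShift (x : ℕ → ℤ) (K : ℕ) (v : Fin t → ℤ)
    (shift : ∀ (f : ℤ → ℤ) → S (upTo (K ℕ.+ g)) (λ i → f (x i ℤ.+ + g)) ≡
       S (upTo K) (λ i → f (x i)) ℤ.+ S (allFin t) (λ i → f (v i) ℤ.+ f (+ g ℤ.- + 1 ℤ.- v i))) where

    square-shift :
      S (upTo g) (λ i → square g (x (K ℕ.+ i))) ℤ.+ + 4 ℤ.* + g ℤ.* S (upTo (K ℕ.+ g)) (λ i → x i ℤ.+ x i ℤ.+ + 1)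
      ≡ S (allFin t) (λ i → square g (v i)) ℤ.+ S (allFin t) (λ i → square g (v i))
    square-shift = isolate (S (upTo K) (square g ∘ x)) tail linear _ (begin
      S (upTo K) (square g ∘ x) ℤ.+ tail ℤ.+ linear
        ≡⟨ cong (ℤ._+ linear) (S-upTo-+ K g (square g ∘ x)) ⟨
      S (upTo (K ℕ.+ g)) (square g ∘ x) ℤ.+ linear
        ≡⟨ cong (λ s → S (upTo (K ℕ.+ g)) (square g ∘ x) ℤ.+ s) (S-* (upTo (K ℕ.+ g)) (+ 4 ℤ.* + g) _) ⟨
      S (upTo (K ℕ.+ g)) (square g ∘ x) ℤ.+ S (upTo (K ℕ.+ g)) (λ i → + 4 ℤ.* + g ℤ.* (x i ℤ.+ x i ℤ.+ + 1))
        ≡⟨ S-+ (upTo (K ℕ.+ g)) _ _ ⟨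
      S (upTo (K ℕ.+ g)) (λ i → square g (x i) ℤ.+ + 4 ℤ.* + g ℤ.* (x i ℤ.+ x i ℤ.+ + 1))
        ≡⟨ S-cong (upTo (K ℕ.+ g)) (λ i → expand (+ g) (x i)) ⟩
      S (upTo (K ℕ.+ g)) (λ i → square g (x i ℤ.+ + g))
        ≡⟨ shift (square g) ⟩
      S (upTo K) (square g ∘ x) ℤ.+ S (allFin t) (λ i → square g (v i) ℤ.+ square g (+ g ℤ.- + 1 ℤ.- v i))
        ≡⟨ cong (λ s → S (upTo K) (square g ∘ x) ℤ.+ s) (trans
             (S-cong (allFin t) (λ i → cong (λ s → square g (v i) ℤ.+ s) (even (+ g) (v i)))) (S-+ (allFin t) _ _)) ⟩
      S (upTo K) (square g ∘ x) ℤ.+ (S (allFin t) (square g ∘ v) ℤ.+ S (allFin t) (square g ∘ v)) ∎)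
      where
      open ≡-Reasoning
      tail linear : ℤ
      tail   = S (upTo g) (λ i → square g (x (K ℕ.+ i)))
      linear = + 4 ℤ.* + g ℤ.* S (upTo (K ℕ.+ g)) (λ i → x i ℤ.+ x i ℤ.+ + 1)
      -- The increment of `square` under y ↦ y + g is 4 g (2 y + 1), linear in y.
      expand : ∀ g y → (y ℤ.+ y ℤ.- g ℤ.+ + 1) ℤ.* (y ℤ.+ y ℤ.- g ℤ.+ + 1) ℤ.+ + 4 ℤ.* g ℤ.* (y ℤ.+ y ℤ.+ + 1)
        ≡ (y ℤ.+ g ℤ.+ (y ℤ.+ g) ℤ.- g ℤ.+ + 1) ℤ.* (y ℤ.+ g ℤ.+ (y ℤ.+ g) ℤ.- g ℤ.+ + 1)
      expand = solve-∀
      -- Reflection changes only the sign of 2 y - g + 1.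
      even : ∀ g y → let z = g ℤ.- + 1 ℤ.- y in
        (z ℤ.+ z ℤ.- g ℤ.+ + 1) ℤ.* (z ℤ.+ z ℤ.- g ℤ.+ + 1) ≡ (y ℤ.+ y ℤ.- g ℤ.+ + 1) ℤ.* (y ℤ.+ y ℤ.- g ℤ.+ + 1)
      even = solve-∀
      isolate : ∀ a b c d → a ℤ.+ b ℤ.+ c ≡ a ℤ.+ d → b ℤ.+ c ≡ d
      isolate a b c d eq = trans (lemma₁ a b c) (trans (cong (ℤ._- a) eq) (lemma₂ a d))
        where
        lemma₁ : ∀ a b c → b ℤ.+ c ≡ a ℤ.+ b ℤ.+ c ℤ.- a
        lemma₁ = solve-∀
        lemma₂ : ∀ a d → a ℤ.+ d ℤ.- a ≡ d
        lemma₂ = solve-∀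

  -- `square-shift` with K = 0, whose left side becomes the sum of (g - 1 - 2 i)² over i < g. The
  -- factor 6 combines the 3 of `S-squares` with the 2 from counting each value and its reflection.
  ∅-squares : + 6 ℤ.* S (allFin t) (λ i → square g (v∅ t i)) ≡ + g ℤ.* (+ g ℤ.* + g ℤ.- + 1)
  ∅-squares = begin
    + 6 ℤ.* R
      ≡⟨ six R ⟩
    + 3 ℤ.* (R ℤ.+ R)
      ≡⟨ cong (+ 3 ℤ.*_) (SquareShift.square-shift (vert ∅) 0 (v∅ t) (∅-shift t 0)) ⟨
    + 3 ℤ.* (S (upTo g) (λ i → square g (vert ∅ i)) ℤ.+ + 4 ℤ.* + g ℤ.* S (upTo g) (λ i → vert ∅ i ℤ.+ vert ∅ i ℤ.+ + 1))
      ≡⟨ cong (λ s → + 3 ℤ.* (S (upTo g) (λ i → square g (vert ∅ i)) ℤ.+ s)) (S-* (upTo g) (+ 4 ℤ.* + g) _) ⟨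
    + 3 ℤ.* (S (upTo g) (λ i → square g (vert ∅ i)) ℤ.+ S (upTo g) (λ i → + 4 ℤ.* + g ℤ.* (vert ∅ i ℤ.+ vert ∅ i ℤ.+ + 1)))
      ≡⟨ cong (+ 3 ℤ.*_) (trans (sym (S-+ (upTo g) _ _)) (S-cong (upTo g) (λ i → collect (+ g) (+ i)))) ⟩
    + 3 ℤ.* S (upTo g) (λ i → (+ g ℤ.- + 1 ℤ.- + i ℤ.- + i) ℤ.* (+ g ℤ.- + 1 ℤ.- + i ℤ.- + i))
      ≡⟨ S-squares (+ g ℤ.- + 1) g ⟩
    _
      ≡⟨ closed (+ g) ⟩
    + g ℤ.* (+ g ℤ.* + g ℤ.- + 1) ∎
    where
    open ≡-Reasoning
    R : ℤ
    R = S (allFin t) (λ i → square g (v∅ t i))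
    six : ∀ r → + 6 ℤ.* r ≡ + 3 ℤ.* (r ℤ.+ r)
    six = solve-∀
    collect : ∀ g i → let y = + 0 ℤ.- (+ 1 ℤ.+ i) in
      (y ℤ.+ y ℤ.- g ℤ.+ + 1) ℤ.* (y ℤ.+ y ℤ.- g ℤ.+ + 1) ℤ.+ + 4 ℤ.* g ℤ.* (y ℤ.+ y ℤ.+ + 1)
      ≡ (g ℤ.- + 1 ℤ.- i ℤ.- i) ℤ.* (g ℤ.- + 1 ℤ.- i ℤ.- i)
    collect = solve-∀
    closed : ∀ g → + 3 ℤ.* g ℤ.* (g ℤ.- + 1) ℤ.* (g ℤ.- + 1) ℤ.- + 6 ℤ.* (g ℤ.- + 1) ℤ.* g ℤ.* (g ℤ.- + 1)
      ℤ.+ + 2 ℤ.* g ℤ.* (g ℤ.- + 1) ℤ.* (+ 2 ℤ.* g ℤ.- + 1) ≡ g ℤ.* (g ℤ.* g ℤ.- + 1)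
    closed = solve-∀

module SizeFormula (t : ℕ) .{{_ : NonZero t}} (ω : Partition) (sc : SelfConjugate ω)
                   (core : IsCore (2 ℕ.* t) ω) (w : Vec ℤ t) (vc : IsVCoding (2 ℕ.* t) t ω w) where

  open SelfConjugatePartition ω sc
  open Coding t ω sc core w vc using (g; v; S-shift)

  private
    K N : ℕ
    K = ℓ ω
    N = K ℕ.+ g

  -- Each part is the displacement of its vertical step from the place of that step in the empty
  -- partition.
  size≡ : + size ω ≡ S (upTo N) (λ i → x i) ℤ.- S (upTo N) (vert ∅)
  size≡ = begin
    + size ω
      ≡⟨ +-sum (parts ω) ⟩
    S (upTo K) (λ i → + row ω i)
      ≡⟨ S-upTo-extend (λ i → + row ω i) (ℕₚ.m≤m+n K g) (λ i K≤i → cong +_ (row-beyond K≤i)) ⟨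
    S (upTo N) (λ i → + row ω i)
      ≡⟨ S-cong (upTo N) (λ i → split (+ row ω i) (+ i)) ⟩
    S (upTo N) (λ i → x i ℤ.+ ℤ.- vert ∅ i)
      ≡⟨ trans (S-+ (upTo N) x (λ i → ℤ.- vert ∅ i)) (cong (λ s → S (upTo N) x ℤ.+ s) (S-neg (upTo N) (vert ∅))) ⟩
    S (upTo N) x ℤ.- S (upTo N) (vert ∅) ∎
    where
    open ≡-Reasoning
    split : ∀ r i → r ≡ r ℤ.- (+ 1 ℤ.+ i) ℤ.+ ℤ.- (+ 0 ℤ.- (+ 1 ℤ.+ i))
    split = solve-∀

  R² : ℤ
  R² = S (allFin t) (λ i → square g (v i))

  -- Subtracting the two instances of `square-shift` cancels the tails and the constant terms and
  -- leaves 8 g |ω| = 2 R² - 2 R∅. Then 6 R∅ is replaced by its value from `∅-squares`.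
  integer-size-formula : + 24 ℤ.* + g ℤ.* + size ω ℤ.+ + g ℤ.* (+ g ℤ.* + g ℤ.- + 1) ≡ + 6 ℤ.* R²
  integer-size-formula = ℤₚ.*-cancelˡ-≡ (+ 2) _ _ (begin
    + 2 ℤ.* (+ 24 ℤ.* + g ℤ.* + size ω ℤ.+ + g ℤ.* (+ g ℤ.* + g ℤ.- + 1))
      ≡⟨ cong₂ (λ s q → + 2 ℤ.* (+ 24 ℤ.* + g ℤ.* s ℤ.+ q)) size≡ (sym (∅-squares t)) ⟩
    + 2 ℤ.* (+ 24 ℤ.* + g ℤ.* (X ℤ.- Y) ℤ.+ + 6 ℤ.* R∅)
      ≡⟨ from (+ g) X Y M tail∅ R² R∅
           (trans (cong₂ (λ a b → a ℤ.+ + 4 ℤ.* + g ℤ.* b) (sym same-tail) (sym (linear x)))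
             (SquareShift.square-shift t x K v (S-shift ℕₚ.≤-refl)))
           (trans (cong (λ b → tail∅ ℤ.+ + 4 ℤ.* + g ℤ.* b) (sym (linear (vert ∅))))
             (SquareShift.square-shift t (vert ∅) K (v∅ t) (∅-shift t K))) ⟩
    + 2 ℤ.* (+ 6 ℤ.* R²) ∎)
    where
    open ≡-Reasoning
    X Y M R∅ tail∅ : ℤ
    X     = S (upTo N) x
    Y     = S (upTo N) (vert ∅)
    M     = S (upTo N) (λ _ → + 1)
    R∅    = S (allFin t) (λ i → square g (v∅ t i))
    tail∅ = S (upTo g) (λ i → square g (vert ∅ (K ℕ.+ i)))

    same-tail : S (upTo g) (λ i → square g (x (K ℕ.+ i))) ≡ tail∅
    same-tail = S-cong (upTo g) (λ i → cong (square g) (x-beyond (ℕₚ.m≤m+n K i)))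

    linear : ∀ y → S (upTo N) (λ i → y i ℤ.+ y i ℤ.+ + 1) ≡ S (upTo N) y ℤ.+ S (upTo N) y ℤ.+ M
    linear y = trans (S-+ (upTo N) _ _) (cong (ℤ._+ M) (S-+ (upTo N) y y))

    from : ∀ g X Y M T R R∅ → T ℤ.+ + 4 ℤ.* g ℤ.* (X ℤ.+ X ℤ.+ M) ≡ R ℤ.+ R →
      T ℤ.+ + 4 ℤ.* g ℤ.* (Y ℤ.+ Y ℤ.+ M) ≡ R∅ ℤ.+ R∅ →
      + 2 ℤ.* (+ 24 ℤ.* g ℤ.* (X ℤ.- Y) ℤ.+ + 6 ℤ.* R∅) ≡ + 2 ℤ.* (+ 6 ℤ.* R)
    from g X Y M T R R∅ eq eq∅ = begin
      + 2 ℤ.* (+ 24 ℤ.* g ℤ.* (X ℤ.- Y) ℤ.+ + 6 ℤ.* R∅)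
        ≡⟨ lemma₁ g X Y M T R∅ ⟩
      + 6 ℤ.* (T ℤ.+ + 4 ℤ.* g ℤ.* (X ℤ.+ X ℤ.+ M)) ℤ.+ + 6 ℤ.* ((R∅ ℤ.+ R∅) ℤ.- (T ℤ.+ + 4 ℤ.* g ℤ.* (Y ℤ.+ Y ℤ.+ M)))
        ≡⟨ cong₂ (λ a b → + 6 ℤ.* a ℤ.+ + 6 ℤ.* ((R∅ ℤ.+ R∅) ℤ.- b)) eq eq∅ ⟩
      + 6 ℤ.* (R ℤ.+ R) ℤ.+ + 6 ℤ.* ((R∅ ℤ.+ R∅) ℤ.- (R∅ ℤ.+ R∅))
        ≡⟨ lemma₂ R R∅ ⟩
      + 2 ℤ.* (+ 6 ℤ.* R) ∎
      where
      lemma₁ : ∀ g X Y M T R∅ → + 2 ℤ.* (+ 24 ℤ.* g ℤ.* (X ℤ.- Y) ℤ.+ + 6 ℤ.* R∅) ≡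
        + 6 ℤ.* (T ℤ.+ + 4 ℤ.* g ℤ.* (X ℤ.+ X ℤ.+ M)) ℤ.+ + 6 ℤ.* ((R∅ ℤ.+ R∅) ℤ.- (T ℤ.+ + 4 ℤ.* g ℤ.* (Y ℤ.+ Y ℤ.+ M)))
      lemma₁ = solve-∀
      lemma₂ : ∀ R R∅ → + 6 ℤ.* (R ℤ.+ R) ℤ.+ + 6 ℤ.* ((R∅ ℤ.+ R∅) ℤ.- (R∅ ℤ.+ R∅)) ≡ + 2 ℤ.* (+ 6 ℤ.* R)
      lemma₂ = solve-∀

-- Passage from the integers to the rationals

fromℚᵘ-+ : ∀ p q → fromℚᵘ (p ℚᵘ.+ q) ≡ fromℚᵘ p ℚ.+ fromℚᵘ q
fromℚᵘ-+ p q = ℚₚ.toℚᵘ-injective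
  (ℚᵘₚ.≃-trans (ℚₚ.toℚᵘ-fromℚᵘ (p ℚᵘ.+ q))
  (ℚᵘₚ.≃-sym (ℚᵘₚ.≃-trans (ℚₚ.toℚᵘ-homo-+ (fromℚᵘ p) (fromℚᵘ q))
    (ℚᵘₚ.+-cong (ℚₚ.toℚᵘ-fromℚᵘ p) (ℚₚ.toℚᵘ-fromℚᵘ q)))))

fromℚᵘ-* : ∀ p q → fromℚᵘ (p ℚᵘ.* q) ≡ fromℚᵘ p ℚ.* fromℚᵘ q
fromℚᵘ-* p q = ℚₚ.toℚᵘ-injective
  (ℚᵘₚ.≃-trans (ℚₚ.toℚᵘ-fromℚᵘ (p ℚᵘ.* q))
  (ℚᵘₚ.≃-sym (ℚᵘₚ.≃-trans (ℚₚ.toℚᵘ-homo-* (fromℚᵘ p) (fromℚᵘ q))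
    (ℚᵘₚ.*-cong (ℚₚ.toℚᵘ-fromℚᵘ p) (ℚₚ.toℚᵘ-fromℚᵘ q)))))

ι : ℤ → ℚ
ι z = z / 1

ι-+ : ∀ a b → ι (a ℤ.+ b) ≡ ι a ℚ.+ ι b
ι-+ a b = trans (cong ι (sym (cong₂ ℤ._+_ (ℤₚ.*-identityʳ a) (ℤₚ.*-identityʳ b))))
  (fromℚᵘ-+ (mkℚᵘ a 0) (mkℚᵘ b 0))

ι-* : ∀ a b → ι (a ℤ.* b) ≡ ι a ℚ.* ι b
ι-* a b = fromℚᵘ-* (mkℚᵘ a 0) (mkℚᵘ b 0)

ι-neg : ∀ a → ι (ℤ.- a) ≡ ℚ.- ι a
ι-neg a = ℚ+.inverseˡ-unique (ι (ℤ.- a)) (ι a) (trans (sym (ι-+ (ℤ.- a) a)) (cong ι (ℤₚ.+-inverseˡ a)))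
  where
  module ℚ+ = Algebra.Properties.AbelianGroup ℚₚ.+-0-abelianGroup

ι-minus : ∀ a b → ι (a ℤ.- b) ≡ ι a ℚ.- ι b
ι-minus a b = trans (ι-+ a (ℤ.- b)) (cong (λ q → ι a ℚ.+ q) (ι-neg b))

/-ι : ∀ p d .{{_ : NonZero d}} → p / d ≡ ι p ℚ.* (+ 1 / d)
/-ι p (suc d) = trans
  (ℚₚ.fromℚᵘ-cong {mkℚᵘ p d} {mkℚᵘ p 0 ℚᵘ.* mkℚᵘ (+ 1) d} (*≡* (cong₂ ℤ._*_ (sym (ℤₚ.*-identityʳ p)) (cong (λ n → + suc n) (ℕₚ.+-identityʳ d)))))
  (fromℚᵘ-* (mkℚᵘ p 0) (mkℚᵘ (+ 1) d))

ι-inverse : ∀ d .{{_ : NonZero d}} → ι (+ d) ℚ.* (+ 1 / d) ≡ 1ℚ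
ι-inverse (suc d) = trans (sym (/-ι (+ suc d) (suc d)))
  (ℚₚ.fromℚᵘ-cong {mkℚᵘ (+ suc d) d} {mkℚᵘ (+ 1) 0} (*≡* (ℤₚ.*-comm (+ suc d) (+ 1))))

module _ (t : ℕ) .{{_ : NonZero t}} (w : Vec ℤ t) where

  private
    g : ℕ
    g = 2 ℕ.* t

  open Data.Rational.Solver.+-*-Solver
  open ≡-Reasoning

  r² : ∀ i → r g w i ℚ.* r g w i ≡ + 1 / 4 ℚ.* ι (square g (lookup w i))
  r² i = begin
    r g w i ℚ.* r g w i
      ≡⟨ cong (λ h → (ι y ℚ.- h ℚ.+ ½) ℚ.* (ι y ℚ.- h ℚ.+ ½)) (/-ι (+ g) 2) ⟩
    (ι y ℚ.- ι (+ g) ℚ.* ½ ℚ.+ ½) ℚ.* (ι y ℚ.- ι (+ g) ℚ.* ½ ℚ.+ ½)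
      ≡⟨ halve (ι y) (ι (+ g)) ⟩
    + 1 / 4 ℚ.* ((ι y ℚ.+ ι y ℚ.- ι (+ g) ℚ.+ 1ℚ) ℚ.* (ι y ℚ.+ ι y ℚ.- ι (+ g) ℚ.+ 1ℚ))
      ≡⟨ cong (λ q → + 1 / 4 ℚ.* (q ℚ.* q)) linear ⟨
    + 1 / 4 ℚ.* (ι (y ℤ.+ y ℤ.- + g ℤ.+ + 1) ℚ.* ι (y ℤ.+ y ℤ.- + g ℤ.+ + 1))
      ≡⟨ cong (λ q → + 1 / 4 ℚ.* q) (ι-* (y ℤ.+ y ℤ.- + g ℤ.+ + 1) (y ℤ.+ y ℤ.- + g ℤ.+ + 1)) ⟨
    + 1 / 4 ℚ.* ι (square g y) ∎
    where
    y : ℤ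
    y = lookup w i
    linear : ι (y ℤ.+ y ℤ.- + g ℤ.+ + 1) ≡ ι y ℚ.+ ι y ℚ.- ι (+ g) ℚ.+ 1ℚ
    linear = trans (ι-+ (y ℤ.+ y ℤ.- + g) (+ 1)) (cong (ℚ._+ 1ℚ)
      (trans (ι-minus (y ℤ.+ y) (+ g)) (cong (ℚ._- ι (+ g)) (ι-+ y y))))
    halve : ∀ a b → (a ℚ.- b ℚ.* ½ ℚ.+ ½) ℚ.* (a ℚ.- b ℚ.* ½ ℚ.+ ½) ≡
      + 1 / 4 ℚ.* ((a ℚ.+ a ℚ.- b ℚ.+ 1ℚ) ℚ.* (a ℚ.+ a ℚ.- b ℚ.+ 1ℚ))
    halve = solve 2 (λ a b → (a :- b :* con ½ :+ con ½) :* (a :- b :* con ½ :+ con ½) :=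
      con (+ 1 / 4) :* ((a :+ a :- b :+ con 1ℚ) :* (a :+ a :- b :+ con 1ℚ))) refl

  ∑-r² : ∀ is → ∑ is (λ i → r g w i ℚ.* r g w i) ≡ + 1 / 4 ℚ.* ι (S is (λ i → square g (lookup w i)))
  ∑-r² []       = refl
  ∑-r² (i ∷ is) = begin
    r g w i ℚ.* r g w i ℚ.+ ∑ is (λ i → r g w i ℚ.* r g w i)
      ≡⟨ cong₂ ℚ._+_ (r² i) (∑-r² is) ⟩
    + 1 / 4 ℚ.* ι a ℚ.+ + 1 / 4 ℚ.* ι b
      ≡⟨ ℚₚ.*-distribˡ-+ (+ 1 / 4) (ι a) (ι b) ⟨
    + 1 / 4 ℚ.* (ι a ℚ.+ ι b)
      ≡⟨ cong (λ q → + 1 / 4 ℚ.* q) (ι-+ a b) ⟨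
    + 1 / 4 ℚ.* ι (a ℤ.+ b) ∎
    where
    a b : ℤ
    a = square g (lookup w i)
    b = S is (λ i → square g (lookup w i))

  rational-size-formula : ∀ s → let R² = S (allFin t) (λ i → square g (lookup w i)) in
    + 24 ℤ.* + g ℤ.* s ℤ.+ + g ℤ.* (+ g ℤ.* + g ℤ.- + 1) ≡ + 6 ℤ.* R² →
    s / 1 ≡ + 1 / g ℚ.* ∑ (allFin t) (λ i → r g w i ℚ.* r g w i) ℚ.- ((+ g) ℤ.^ 2 ℤ.- + 1) / 24
  rational-size-formula s eq = begin
    ι s
      ≡⟨ ℚₚ.*-identityʳ (ι s) ⟨
    ι s ℚ.* 1ℚ
      ≡⟨ cong (λ q → ι s ℚ.* q) (ι-inverse g) ⟨
    ι s ℚ.* (G ℚ.* u)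
      -- For the ring solver `G` and `u` are independent variables. The factor `G * u`, equal to 1,
      -- is therefore kept on both sides, and the relation is applied separately.
      ≡⟨ regroup (ι s) G u (ι q) ⟩
    + 1 / 24 ℚ.* u ℚ.* (ι (+ 24) ℚ.* G ℚ.* ι s ℚ.+ G ℚ.* ι q) ℚ.- ι q ℚ.* (+ 1 / 24) ℚ.* (G ℚ.* u)
      ≡⟨ cong₂ (λ a b → + 1 / 24 ℚ.* u ℚ.* a ℚ.- ι q ℚ.* (+ 1 / 24) ℚ.* b) ι-eq (ι-inverse g) ⟩
    + 1 / 24 ℚ.* u ℚ.* (ι (+ 6) ℚ.* ι R²) ℚ.- ι q ℚ.* (+ 1 / 24) ℚ.* 1ℚ
      ≡⟨ reduce u (ι R²) (ι q ℚ.* (+ 1 / 24)) ⟩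
    u ℚ.* (+ 1 / 4 ℚ.* ι R²) ℚ.- ι q ℚ.* (+ 1 / 24)
      ≡⟨ cong₂ (λ a b → u ℚ.* a ℚ.- b) (∑-r² (allFin t)) (trans (cong (_/ 24) q≡) (/-ι q 24)) ⟨
    u ℚ.* ∑ (allFin t) (λ i → r g w i ℚ.* r g w i) ℚ.- ((+ g) ℤ.^ 2 ℤ.- + 1) / 24 ∎
    where
    R² q : ℤ
    R² = S (allFin t) (λ i → square g (lookup w i))
    q  = + g ℤ.* + g ℤ.- + 1
    G u : ℚ
    G = ι (+ g)
    u = + 1 / g
    q≡ : (+ g) ℤ.^ 2 ℤ.- + 1 ≡ q
    q≡ = cong (λ z → + g ℤ.* z ℤ.- + 1) (ℤₚ.*-identityʳ (+ g))
    ι-eq : ι (+ 24) ℚ.* G ℚ.* ι s ℚ.+ G ℚ.* ι q ≡ ι (+ 6) ℚ.* ι R²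
    ι-eq = begin
      ι (+ 24) ℚ.* G ℚ.* ι s ℚ.+ G ℚ.* ι q
        ≡⟨ cong₂ ℚ._+_ (trans (ι-* (+ 24 ℤ.* + g) s) (cong (ℚ._* ι s) (ι-* (+ 24) (+ g)))) (ι-* (+ g) q) ⟨
      ι (+ 24 ℤ.* + g ℤ.* s) ℚ.+ ι (+ g ℤ.* q)
        ≡⟨ ι-+ (+ 24 ℤ.* + g ℤ.* s) (+ g ℤ.* q) ⟨
      ι (+ 24 ℤ.* + g ℤ.* s ℤ.+ + g ℤ.* q)
        ≡⟨ cong ι eq ⟩
      ι (+ 6 ℤ.* R²)
        ≡⟨ ι-* (+ 6) R² ⟩
      ι (+ 6) ℚ.* ι R² ∎
    regroup : ∀ s G u q → s ℚ.* (G ℚ.* u) ≡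
      + 1 / 24 ℚ.* u ℚ.* (ι (+ 24) ℚ.* G ℚ.* s ℚ.+ G ℚ.* q) ℚ.- q ℚ.* (+ 1 / 24) ℚ.* (G ℚ.* u)
    regroup = solve 4 (λ s G u q → s :* (G :* u) :=
      con (+ 1 / 24) :* u :* (con (ι (+ 24)) :* G :* s :+ G :* q) :- q :* con (+ 1 / 24) :* (G :* u)) refl
    reduce : ∀ u R p → + 1 / 24 ℚ.* u ℚ.* (ι (+ 6) ℚ.* R) ℚ.- p ℚ.* 1ℚ ≡ u ℚ.* (+ 1 / 4 ℚ.* R) ℚ.- p
    reduce = solve 3 (λ u R p → con (+ 1 / 24) :* u :* (con (ι (+ 6)) :* R) :- p :* con 1ℚ :=
      u :* (con (+ 1 / 4) :* R) :- p) refl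

theorem4p23 : ∀ {c ℓ₁ ℓ₂} (t : ℕ) .{{_ : NonZero t}} →
    let g = 2 ℕ.* t in
    (ω : Partition) → SelfConjugate ω → IsCore g ω →
    (v : Vec ℤ t) → IsVCoding g t ω v →
    (+ size ω / 1 ≡
    + 1 / g ℚ.* ∑ (allFin t) (λ i → r g v i ℚ.* r g v i)
    ℚ.- ((+ g) ℤ.^ 2 ℤ.- + 1) / 24)
    ×
    ((F : HeytingField c ℓ₁ ℓ₂) →
    let open FieldOps F in
    (τ : ℤ → F^×) →
    ∏ (boxes ω) (λ s → τ (+ hook ω s ℤ.- ε s ℤ.* + g) ÷ τ (+ hook ω s))
    ≈
    ∏ (map suc (upTo (g ℕ.∸ 1))) (λ i → (τ (ℤ.- + i) ÷ τ (+ i)) ^ α g ω i)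
    * ∏ (pairs t) (λ (i , j) →
    τ (r-diff g v i j) ÷ τ (idx j ℤ.- idx i)
    * (τ (r-sum g v i j) ÷ τ (+ g ℤ.+ + 1 ℤ.- idx i ℤ.- idx j))))
theorem4p23 t ω sc core w vc =
  rational-size-formula t w (+ size ω) (SizeFormula.integer-size-formula t ω sc core w vc) ,
  CoreProduct.product-formula t ω sc core w vc
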